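{- For every $\epsilon>0$ there is an algorithm that, given any graph $G=(V,E)$ together with realization probabilities $p_e\in(0,1]$ for $e\in E$, and without any knowledge of which edges are realized, picks a subgraph $Q$ of $G$ whose maximum degree is at most $D(\epsilon,p)$, for some function $D$ that depends only on $\epsilon$ and $p:=\min_{e\in E}p_e$ (and not on $G$ or $|V|$), such that $$\mathbb{E}[\mu(\mathcal{Q})]\ \ge\ (1-\epsilon)\,\mathbb{E}[\mu(\mathcal{G})].$$
   Context: Stochastic matching setting: $G=(V,E)$ is a graph and each edge $e\in E$ is realized independently with probability $p_e\in(0,1]$; let $p=\min_e p_e$. The realized subgraph $\mathcal{G}=(V,\mathcal{E})$ of $G$ contains exactly the realized edges, and for a subgraph $Q$ of $G$, $\mathcal{Q}$ denotes its realized subgraph, i.e. the edges of $Q$ that are realized. For a graph $H$, $\mu(H)$ denotes the size of a maximum matching of $H$. The subgraph $Q$ is chosen before (and independently of) the realization; the algorithm may be randomized, and the expectations are over the realization and the algorithm's internal randomness. (The standard model where every $p_e$ equals a common $p$ is a special case.)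
   Formalization: The realization probabilities p_e (hence p) and ε are rational numbers rather than real numbers, and the algorithm's internal randomness is a finite distribution with rational weights. -}

module Defs where

open import Data.Nat as ℕ using (ℕ; zero; suc; _⊔_)
open import Data.Integer using (+_)
open import Data.Fin using (Fin; zero; suc; _≟_)
open import Data.Fin.Properties using (all?)
open import Data.Bool using (Bool; true; false; if_then_else_; _∧_; _∨_)
open import Data.Bool.Properties using () renaming (_≟_ to _≟B_)
open import Data.List using (List; []; _∷_; _++_; map; foldr; filter)
open import Data.List.Membership.Propositional using (_∈_)
open import Data.Product using (Σ; _×_; _,_; proj₁; proj₂)
open import Relation.Nullary using (¬_; Dec)
open import Relation.Nullary.Decidable using (_×-dec_; _→-dec_; ¬?; isYes)
open import Data.Sum using (_⊎_)
open import Relation.Binary.PropositionalEquality using (_≡_; _≢_)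
open import Data.Rational using (ℚ; _/_; _+_; _*_; _-_; _≤_; _<_; 0ℚ; 1ℚ)

SameEnds : ∀ {n} → Fin n × Fin n → Fin n × Fin n → Set
SameEnds (a , b) (c , d) = (a ≡ c × b ≡ d) ⊎ (a ≡ d × b ≡ c)

record Graph (n m : ℕ) : Set where
  field
    ends     : Fin m → Fin n × Fin n
    loopless : ∀ e → proj₁ (ends e) ≢ proj₂ (ends e)
    simple   : ∀ e f → e ≢ f → ¬ SameEnds (ends e) (ends f)
open Graph public

-- A subgraph of G (on the same vertex set) / a set of edges of G.
EdgeSet : ℕ → Set
EdgeSet m = Fin m → Bool

_⊆E_ : ∀ {m} → EdgeSet m → EdgeSet m → Set
S ⊆E H = ∀ e → S e ≡ true → H e ≡ true

-- Edge-wise intersection (realized subgraph of Q w.r.t. realization R).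
_∩E_ : ∀ {m} → EdgeSet m → EdgeSet m → EdgeSet m
(S ∩E T) e = S e ∧ T e

size : ∀ {m} → EdgeSet m → ℕ
size {zero}  S = 0
size {suc m} S = (if S zero then 1 else 0) ℕ.+ size (λ e → S (suc e))

allEdgeSets : (m : ℕ) → List (EdgeSet m)
allEdgeSets zero    = (λ ()) ∷ []
allEdgeSets (suc m) =
  map (λ S → λ { zero → false ; (suc e) → S e }) (allEdgeSets m) ++
  map (λ S → λ { zero → true  ; (suc e) → S e }) (allEdgeSets m)

Disjoint : ∀ {n} → Fin n × Fin n → Fin n × Fin n → Set
Disjoint (a , b) (c , d) = (a ≢ c × a ≢ d) × (b ≢ c × b ≢ d)

IsMatching : ∀ {n m} → Graph n m → EdgeSet m → Set
IsMatching G S = ∀ e f → e ≢ f → S e ≡ true → S f ≡ true →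
                 Disjoint (ends G e) (ends G f)

private
  disjoint? : ∀ {n} (x y : Fin n × Fin n) → Dec (Disjoint x y)
  disjoint? (a , b) (c , d) =
    (¬? (a ≟ c) ×-dec ¬? (a ≟ d)) ×-dec (¬? (b ≟ c) ×-dec ¬? (b ≟ d))

  isMatching? : ∀ {n m} (G : Graph n m) (S : EdgeSet m) → Dec (IsMatching G S)
  isMatching? G S = all? λ e → all? λ f →
    ¬? (e ≟ f) →-dec ((S e ≟B true) →-dec ((S f ≟B true) →-dec
      disjoint? (ends G e) (ends G f)))

  ⊆E? : ∀ {m} (S H : EdgeSet m) → Dec (S ⊆E H)
  ⊆E? S H = all? λ e → (S e ≟B true) →-dec (H e ≟B true)

μ : ∀ {n m} → Graph n m → EdgeSet m → ℕ
μ {m = m} G H =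
  foldr _⊔_ 0 (map size (filter (λ S → ⊆E? S H ×-dec isMatching? G S) (allEdgeSets m)))

fullE : ∀ {m} → EdgeSet m
fullE _ = true

deg : ∀ {n m} → Graph n m → EdgeSet m → Fin n → ℕ
deg {m = m} G Q v = size (λ e → Q e ∧ (isYes (v ≟ proj₁ (ends G e)) ∨ isYes (v ≟ proj₂ (ends G e))))

MaxDegree≤ : ∀ {n m} → Graph n m → EdgeSet m → ℕ → Set
MaxDegree≤ G Q D = ∀ v → deg G Q v ℕ.≤ D

ℕ→ℚ : ℕ → ℚ
ℕ→ℚ k = + k / 1

sumℚ : List ℚ → ℚ
sumℚ = foldr _+_ 0ℚ

-- Probability of realization R (R e = true iff edge e is realized)
-- when edges are realized independently with probabilities p.
prob : ∀ {m} → (Fin m → ℚ) → EdgeSet m → ℚ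
prob {zero}  p R = 1ℚ
prob {suc m} p R = (if R zero then p zero else 1ℚ - p zero) * prob (λ e → p (suc e)) (λ e → R (suc e))

𝔼 : ∀ {m} → (Fin m → ℚ) → (EdgeSet m → ℕ) → ℚ
𝔼 {m} p f = sumℚ (map (λ R → prob p R * ℕ→ℚ (f R)) (allEdgeSets m))

-- A finitely supported probability distribution on subgraphs
-- (the output of a randomized algorithm): list of (weight , subgraph).
Dist : ℕ → Set
Dist m = List (ℚ × EdgeSet m)

IsDistribution : ∀ {m} → Dist m → Set
IsDistribution d = (∀ {x} → x ∈ d → 0ℚ ≤ proj₁ x) × sumℚ (map proj₁ d) ≡ 1ℚ

-- 𝔼[μ(𝒬)] where Q is drawn from d (independently of the realization).
𝔼μQ : ∀ {n m} → Graph n m → (Fin m → ℚ) → Dist m → ℚ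
𝔼μQ G p d = sumℚ (map (λ x → proj₁ x * 𝔼 p (λ R → μ G (proj₂ x ∩E R))) d)

𝔼μG : ∀ {n m} → Graph n m → (Fin m → ℚ) → ℚ
𝔼μG G p = 𝔼 p (λ R → μ G R)

IsMin : ∀ {m} → (Fin m → ℚ) → ℚ → Set
IsMin {m} p p₀ = (∀ e → p₀ ≤ p e) × Σ (Fin m) (λ e → p e ≡ p₀)

ValidProbs : ∀ {m} → (Fin m → ℚ) → Set
ValidProbs p = ∀ e → (0ℚ < p e) × (p e ≤ 1ℚ)

{-# OPTIONS --safe #-}
-- Let x e be the probability that e belongs to a fixed maximum matching M(R) of the realized
-- graph R.  There are thresholds t ≪ t′, bounded in terms of ε and p only, such that the edges
-- with 1/t′ < x e < 1/t contribute little to ∑ x.  The subgraph Q consists of the critical edges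
-- (x e ≥ 1/t) and of the negligible edges (x e ≤ 1/t′) in K independent copies of M(R).
--
-- A matching of the realized part of Q is built in two steps.  First take a maximum weight
-- matching of the realized critical edges for the weights y e + noise; if y is a local minimum
-- of the convex function E (maximum weight) - ∑ x y, then each critical e is selected with
-- probability about x e.  Then match the uncovered vertices by the monomer-dimer model with
-- weight s²/(K p e) on the realized sampled edges.  In both models the deletion of a vertex
-- changes the status of only one other vertex, whatever the weights and degrees, so a martingale
-- bound shows that the events "u stays uncovered" and "v stays uncovered" are nearly independent
-- on average over the sampled edges uv, because their weights are tiny.  Hence uv is matched with
-- probability about s² r_u r_v / K, where r is the probability of staying uncovered.  Call v tight if
-- r_v ≤ 1/s.  Compared with 1/K, an edge without tight ends is matched at least as often, an edge
-- with two tight ends at most as often, and tight vertices are almost saturated; adding the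
-- flow through the tight vertices shows that about ∑ x negligible edges get matched.
module Submission where

open import Defs
open import Data.Bool using (Bool; true; false; if_then_else_; _∧_; _∨_; not)
open import Data.Bool.Properties using (∧-conicalˡ; ∧-conicalʳ)
open import Data.Empty using (⊥-elim)
open import Data.Fin using (Fin; zero; suc; toℕ)
open import Data.Fin.Properties using (all?; ¬∀⟶∃¬) renaming (_≟_ to _≟F_)
import Data.Integer as ℤ
import Data.Integer.Properties as ℤ
open import Data.List as List using (List; []; _∷_; _++_; foldr; filter)
open import Data.List.Membership.Propositional using (_∈_)
open import Data.List.Membership.Propositional.Properties using (∈-++⁺ˡ; ∈-++⁺ʳ; ∈-map⁺)
open import Data.List.Relation.Unary.Any using (here; there)
open import Data.Maybe using (Maybe; just; nothing; is-just)
open import Data.Nat as ℕ using (ℕ; zero; suc)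
import Data.Nat.Properties as ℕ
open import Data.Product using (Σ; _×_; _,_; proj₁; proj₂)
open import Data.Rational using (ℚ; mkℚ; _/_; _+_; _*_; _-_; -_; _≤_; _<_; 0ℚ; 1ℚ; ½; ∣_∣; 1/_; toℚᵘ)
open import Data.Rational.Properties
import Data.Rational.Unnormalised as ℚᵘ
import Data.Rational.Unnormalised.Properties as ℚᵘ
open import Data.Sum using (_⊎_; inj₁; inj₂)
open import Data.Vec using (Vec; []; _∷_; lookup; map; replicate; _[_]≔_)
open import Data.Vec.Properties using (lookup-map; lookup-replicate; lookup∘update; lookup∘update′; []≔-commutes; []≔-idempotent; []≔-lookup)
open import Level using (0ℓ)
open import Relation.Binary.PropositionalEquality using (_≡_; _≢_; refl; sym; trans; cong; cong₂; subst; subst₂)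
open import Relation.Nullary using (¬_; Dec; yes; no)
open import Relation.Nullary.Decidable using (isYes; dec⇒maybe; _×-dec_)
open import Tactic.RingSolver using (solve-∀)
open import Tactic.RingSolver.Core.AlmostCommutativeRing using (AlmostCommutativeRing; fromCommutativeRing)

-- No constant may depend on the number of vertices, so every error has to be paid by a small
-- multiple of the optimum. Overloads are therefore charged to vertices with a critical edge: there
-- are at most `t * opt` critical edges, because `x` sums to `opt`. The sampled edges number at most
-- K times the maximum matching of the whole graph, hence at most `nat K * (q * opt)`. The squared
-- influences of all coordinates then sum to a multiple of `opt` of order t + (s² q / K)² K q, and
-- the martingale bound multiplies this by the largest edge weight s² q / K. This fixes the order of
-- the choices: s from ε, then K large compared with t, then t′ large compared with K, so that a
-- negligible edge rarely occurs in two samples. The threshold 1/s is the place where s² r_u r_v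
-- crosses 1 when both factors are equal. Noise enters because selection probabilities are step
-- functions of y: integer noise spread over a long range makes a unit step of y almost invisible to
-- them, and differences of the expected maximum weight can replace derivatives.

ring : AlmostCommutativeRing 0ℓ 0ℓ
ring = fromCommutativeRing +-*-commutativeRing λ x → dec⇒maybe (0ℚ ≟ x)

-- Order arithmetic of the rationals

2ℚ : ℚ
2ℚ = 1ℚ + 1ℚ

0≤1 : 0ℚ ≤ 1ℚ
0≤1 = nonNegative⁻¹ 1ℚ

≤-diff : ∀ {a b} → a ≤ b → 0ℚ ≤ b - a
≤-diff {a} {b} h = subst (_≤ b - a) (+-inverseʳ a) (+-monoˡ-≤ (- a) h)

-- Inequalities are proved by certificates: an expression built with `_⊕_` and `_⊗_` is visibly
-- nonnegative, and the ring solver identifies it with the difference of the two sides.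
≤-by : ∀ {a b s} → 0ℚ ≤ s → b - a ≡ s → a ≤ b
≤-by {a} {b} h refl = subst₂ _≤_ (+-identityʳ a) (lem a b) (+-monoʳ-≤ a h)
  where
  lem : ∀ a b → a + (b - a) ≡ b
  lem = solve-∀ ring

cancelˡ : ∀ a b → a + b - a ≡ b
cancelˡ = solve-∀ ring

cancelʳ : ∀ a b → a + b - b ≡ a
cancelʳ = solve-∀ ring

infixr 6 _⊕_
infixr 7 _⊗_

_⊕_ : ∀ {a b} → 0ℚ ≤ a → 0ℚ ≤ b → 0ℚ ≤ a + b
_⊕_ {a} {b} p q = subst (_≤ a + b) (+-identityʳ 0ℚ) (+-mono-≤ p q)

_⊗_ : ∀ {a b} → 0ℚ ≤ a → 0ℚ ≤ b → 0ℚ ≤ a * b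
_⊗_ {a} {b} p q = nonNegative⁻¹ (a * b)
  where instance
    ia = Data.Rational.nonNegative p
    ib = Data.Rational.nonNegative q
    ic = nonNeg*nonNeg⇒nonNeg a b

*-monoʳ : ∀ {a b c} → 0ℚ ≤ c → a ≤ b → c * a ≤ c * b
*-monoʳ {a} {b} {c} p q = ≤-by (p ⊗ ≤-diff q) (lem a b c)
  where
  lem : ∀ a b c → c * b - c * a ≡ c * (b - a)
  lem = solve-∀ ring

*-mono : ∀ {a b c d} → 0ℚ ≤ a → 0ℚ ≤ d → a ≤ b → c ≤ d → a * c ≤ b * d
*-mono {a} {b} {c} {d} a0 d0 p q = ≤-by (a0 ⊗ ≤-diff q ⊕ ≤-diff p ⊗ d0) (lem a b c d)
  where
  lem : ∀ a b c d → b * d - a * c ≡ a * (d - c) + (b - a) * d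
  lem = solve-∀ ring

sq≥0 : ∀ a → 0ℚ ≤ a * a
sq≥0 a with ≤-total 0ℚ a
... | inj₁ p = p ⊗ p
... | inj₂ q = subst (0ℚ ≤_) (lem a) (≤-diff q ⊗ ≤-diff q)
  where
  lem : ∀ a → (0ℚ - a) * (0ℚ - a) ≡ a * a
  lem = solve-∀ ring

≰⇒≥ : ∀ {a b} → ¬ (a ≤ b) → b ≤ a
≰⇒≥ h = <⇒≤ (≰⇒> h)

abs-≤ : ∀ {a b} → a ≤ b → - a ≤ b → ∣ a ∣ ≤ b
abs-≤ {a} {b} p q with ∣p∣≡p∨∣p∣≡-p a
... | inj₁ e = subst (_≤ b) (sym e) p
... | inj₂ e = subst (_≤ b) (sym e) q

≤-abs : ∀ a → a ≤ ∣ a ∣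
≤-abs a with ≤-total 0ℚ a
... | inj₁ p = ≤-reflexive (sym (0≤p⇒∣p∣≡p p))
... | inj₂ q = ≤-trans q (0≤∣p∣ a)

-≤-abs : ∀ a → - a ≤ ∣ a ∣
-≤-abs a = subst (- a ≤_) (∣-p∣≡∣p∣ a) (≤-abs (- a))

abs-0 : ∀ {a} → a ≡ 0ℚ → ∣ a ∣ ≡ 0ℚ
abs-0 refl = refl

abs-tri : ∀ a b c → ∣ a - c ∣ ≤ ∣ a - b ∣ + ∣ b - c ∣
abs-tri a b c = subst (λ x → ∣ x ∣ ≤ ∣ a - b ∣ + ∣ b - c ∣) (lem a b c) (∣p+q∣≤∣p∣+∣q∣ (a - b) (b - c))
  where
  lem : ∀ a b c → (a - b) + (b - c) ≡ a - c
  lem = solve-∀ ring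

abs-sym : ∀ a b → ∣ a - b ∣ ≡ ∣ b - a ∣
abs-sym a b = trans (sym (∣-p∣≡∣p∣ (a - b))) (cong ∣_∣ (lem a b))
  where
  lem : ∀ a b → - (a - b) ≡ b - a
  lem = solve-∀ ring

abs-* : ∀ {c} a → 0ℚ ≤ c → ∣ c * a ∣ ≡ c * ∣ a ∣
abs-* {c} a h = trans (∣p*q∣≡∣p∣*∣q∣ c a) (cong (_* ∣ a ∣) (0≤p⇒∣p∣≡p h))

-- The total inverse has the junk value inv 0 = 0.
abstract
  inv : ℚ → ℚ
  inv z with z ≟ 0ℚ
  ... | yes _ = 0ℚ
  ... | no z≢0 = (1/ z) {{Data.Rational.≢-nonZero z≢0}}

  inv-* : ∀ {z} → 0ℚ < z → z * inv z ≡ 1ℚ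
  inv-* {z} h with z ≟ 0ℚ
  ... | yes e = ⊥-elim (<-irrefl (sym e) h)
  ... | no z≢0 = *-inverseʳ z {{Data.Rational.≢-nonZero z≢0}}

  inv-≥0 : ∀ {z} → 0ℚ < z → 0ℚ ≤ inv z
  inv-≥0 {z} h with z ≟ 0ℚ
  ... | yes e = ≤-refl
  ... | no z≢0 = <⇒≤ (positive⁻¹ ((1/ z) {{Data.Rational.≢-nonZero z≢0}}) {{1/pos⇒pos z {{Data.Rational.positive h}}}})

inv-≤ : ∀ {z c} → 0ℚ < z → 1ℚ ≤ c * z → inv z ≤ c
inv-≤ {z} {c} h p = ≤-by (inv-≥0 h ⊗ ≤-diff p) (lem2 z c (inv z) (inv-* h))
  where
  lem : ∀ z c i → i * (c * z - 1ℚ) ≡ c * (z * i) - i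
  lem = solve-∀ ring
  lem2 : ∀ z c i → z * i ≡ 1ℚ → c - i ≡ i * (c * z - 1ℚ)
  lem2 z c i e = sym (trans (lem z c i) (cong (_- i) (trans (cong (c *_) e) (*-identityʳ c))))

-- Indicators and finite sums

⟦_⟧ : Bool → ℚ
⟦ b ⟧ = if b then 1ℚ else 0ℚ

⟦⟧≥0 : ∀ b → 0ℚ ≤ ⟦ b ⟧
⟦⟧≥0 true = 0≤1
⟦⟧≥0 false = ≤-refl

⟦⟧≤1 : ∀ b → ⟦ b ⟧ ≤ 1ℚ
⟦⟧≤1 true = ≤-refl
⟦⟧≤1 false = 0≤1

⟦∧⟧ : ∀ a b → ⟦ a ∧ b ⟧ ≡ ⟦ a ⟧ * ⟦ b ⟧
⟦∧⟧ true b = sym (*-identityˡ ⟦ b ⟧)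
⟦∧⟧ false b = sym (*-zeroˡ ⟦ b ⟧)

⟦⟧-mono : ∀ {a b} → (a ≡ true → b ≡ true) → ⟦ a ⟧ ≤ ⟦ b ⟧
⟦⟧-mono {false} {b} h = ⟦⟧≥0 b
⟦⟧-mono {true} h rewrite h refl = ≤-refl

⟦⟧-idem : ∀ b → ⟦ b ⟧ * ⟦ b ⟧ ≡ ⟦ b ⟧
⟦⟧-idem true = refl
⟦⟧-idem false = refl

isYes-true : ∀ {P : Set} (d : Dec P) → isYes d ≡ true → P
isYes-true (yes p) h = p

isYes-false : ∀ {P : Set} (d : Dec P) → isYes d ≡ false → ¬ P
isYes-false (no np) h = np

isYes-intro : ∀ {P : Set} (d : Dec P) → P → isYes d ≡ true
isYes-intro (yes _) p = refl
isYes-intro (no np) p = ⊥-elim (np p)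

δ : ∀ {n} → Fin n → Fin n → ℚ
δ i j = ⟦ isYes (i ≟F j) ⟧

δ-refl : ∀ {n} (i : Fin n) → δ i i ≡ 1ℚ
δ-refl i with i ≟F i
... | yes _ = refl
... | no ne = ⊥-elim (ne refl)

δ-≢ : ∀ {n} {i j : Fin n} → i ≢ j → δ i j ≡ 0ℚ
δ-≢ {i = i} {j} ne with i ≟F j
... | yes e = ⊥-elim (ne e)
... | no _ = refl

δ-sym : ∀ {n} (i j : Fin n) → δ i j ≡ δ j i
δ-sym i j with i ≟F j
... | yes refl = sym (δ-refl i)
... | no ne = sym (δ-≢ (λ e → ne (sym e)))

δ-suc : ∀ {n} (i j : Fin n) → δ (suc i) (suc j) ≡ δ i j
δ-suc i j with i ≟F j
... | yes _ = refl
... | no _ = refl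

δ-subst : ∀ {n} (f : Fin n → ℚ) i j → δ i j * f i ≡ δ i j * f j
δ-subst f i j with i ≟F j
... | yes refl = refl
... | no ne = trans (*-zeroˡ (f i)) (sym (*-zeroˡ (f j)))

∑ : ∀ {n} → (Fin n → ℚ) → ℚ
∑ {zero} f = 0ℚ
∑ {suc n} f = f zero + ∑ (λ i → f (suc i))

∑-cong : ∀ {n} {f g : Fin n → ℚ} → (∀ i → f i ≡ g i) → ∑ f ≡ ∑ g
∑-cong {zero} h = refl
∑-cong {suc n} h = cong₂ _+_ (h zero) (∑-cong (λ i → h (suc i)))

∑-mono : ∀ {n} {f g : Fin n → ℚ} → (∀ i → f i ≤ g i) → ∑ f ≤ ∑ g
∑-mono {zero} h = ≤-refl
∑-mono {suc n} h = +-mono-≤ (h zero) (∑-mono (λ i → h (suc i)))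

∑-+ : ∀ {n} (f g : Fin n → ℚ) → ∑ (λ i → f i + g i) ≡ ∑ f + ∑ g
∑-+ {zero} f g = refl
∑-+ {suc n} f g = trans (cong (f zero + g zero +_) (∑-+ (λ i → f (suc i)) (λ i → g (suc i)))) (lem (f zero) (g zero) _ _)
  where
  lem : ∀ a b c d → a + b + (c + d) ≡ (a + c) + (b + d)
  lem = solve-∀ ring

∑-* : ∀ {n} c (f : Fin n → ℚ) → ∑ (λ i → c * f i) ≡ c * ∑ f
∑-* {zero} c f = sym (*-zeroʳ c)
∑-* {suc n} c f = trans (cong (c * f zero +_) (∑-* c (λ i → f (suc i)))) (sym (*-distribˡ-+ c (f zero) _))

∑-*ʳ : ∀ {n} (f : Fin n → ℚ) c → ∑ (λ i → f i * c) ≡ ∑ f * c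
∑-*ʳ f c = trans (∑-cong (λ i → *-comm (f i) c)) (trans (∑-* c f) (*-comm c (∑ f)))

∑-0 : ∀ {n} {f : Fin n → ℚ} → (∀ i → f i ≡ 0ℚ) → ∑ f ≡ 0ℚ
∑-0 {zero} h = refl
∑-0 {suc n} h = trans (cong₂ _+_ (h zero) (∑-0 (λ i → h (suc i)))) (+-identityʳ 0ℚ)

∑-≥0 : ∀ {n} {f : Fin n → ℚ} → (∀ i → 0ℚ ≤ f i) → 0ℚ ≤ ∑ f
∑-≥0 {zero} h = ≤-refl
∑-≥0 {suc n} h = h zero ⊕ ∑-≥0 (λ i → h (suc i))

neg-as-* : ∀ a → - a ≡ (- 1ℚ) * a
neg-as-* = solve-∀ ring

∑-− : ∀ {n} (f g : Fin n → ℚ) → ∑ (λ i → f i - g i) ≡ ∑ f - ∑ g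
∑-− f g = trans (∑-cong (λ i → cong (f i +_) (neg-as-* (g i))))
  (trans (∑-+ f (λ i → (- 1ℚ) * g i)) (cong (∑ f +_) (trans (∑-* (- 1ℚ) g) (sym (neg-as-* (∑ g))))))

∑-swap : ∀ {n m} (f : Fin n → Fin m → ℚ) → ∑ (λ i → ∑ (λ j → f i j)) ≡ ∑ (λ j → ∑ (λ i → f i j))
∑-swap {zero} {m} f = sym (∑-0 {m} (λ _ → refl))
∑-swap {suc n} f = trans (cong (∑ (f zero) +_) (∑-swap (λ i → f (suc i))))
  (sym (∑-+ (f zero) (λ j → ∑ (λ i → f (suc i) j))))

∑-abs : ∀ {n} (f : Fin n → ℚ) → ∣ ∑ f ∣ ≤ ∑ (λ i → ∣ f i ∣)
∑-abs {zero} f = ≤-refl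
∑-abs {suc n} f = ≤-trans (∣p+q∣≤∣p∣+∣q∣ (f zero) _) (+-monoʳ-≤ ∣ f zero ∣ (∑-abs (λ i → f (suc i))))

∑-δ : ∀ {n} (a : Fin n) (f : Fin n → ℚ) → ∑ (λ i → δ i a * f i) ≡ f a
∑-δ {suc n} zero f = trans (cong₂ _+_ (*-identityˡ (f zero)) (∑-0 (λ i → *-zeroˡ (f (suc i))))) (+-identityʳ _)
∑-δ {suc n} (suc a) f = trans (cong₂ _+_ (*-zeroˡ (f zero))
  (trans (∑-cong (λ i → cong (_* f (suc i)) (δ-suc i a))) (∑-δ a (λ i → f (suc i))))) (+-identityˡ _)

term≤∑ : ∀ {n} {f : Fin n → ℚ} → (∀ i → 0ℚ ≤ f i) → ∀ i → f i ≤ ∑ f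
term≤∑ {suc n} {f} h zero = ≤-by (∑-≥0 (λ i → h (suc i))) (cancelˡ (f zero) _)
term≤∑ {suc n} {f} h (suc i) = ≤-trans (term≤∑ (λ i → h (suc i)) i) (≤-by (h zero) (cancelʳ (f zero) _))

-- Expectation operators

-- E-attain holds because the operators built below have finite support.
record Expect (A : Set) : Set where
  no-eta-equality
  field
    E      : (A → ℚ) → ℚ
    E-+    : ∀ f g → E (λ a → f a + g a) ≡ E f + E g
    E-*    : ∀ c f → E (λ a → c * f a) ≡ c * E f
    E-mono : ∀ {f g} → (∀ a → f a ≤ g a) → E f ≤ E g
    E-one  : E (λ _ → 1ℚ) ≡ 1ℚ
    E-attain : ∀ f → Σ A λ a → E f ≤ f a

  E-cong : ∀ {f g} → (∀ a → f a ≡ g a) → E f ≡ E g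
  E-cong h = ≤-antisym (E-mono (λ a → ≤-reflexive (h a))) (E-mono (λ a → ≤-reflexive (sym (h a))))

  E-const : ∀ c → E (λ _ → c) ≡ c
  E-const c = trans (E-cong (λ _ → sym (*-identityʳ c))) (trans (E-* c (λ _ → 1ℚ)) (trans (cong (c *_) E-one) (*-identityʳ c)))

  E-*ʳ : ∀ f c → E (λ a → f a * c) ≡ E f * c
  E-*ʳ f c = trans (E-cong (λ a → *-comm (f a) c)) (trans (E-* c f) (*-comm c (E f)))

  E-− : ∀ f g → E (λ a → f a - g a) ≡ E f - E g
  E-− f g = trans (E-cong (λ a → cong (f a +_) (neg-as-* (g a))))
    (trans (E-+ f (λ a → (- 1ℚ) * g a)) (cong (E f +_) (trans (E-* (- 1ℚ) g) (sym (neg-as-* (E g))))))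

  E-≥0 : ∀ {f} → (∀ a → 0ℚ ≤ f a) → 0ℚ ≤ E f
  E-≥0 {f} h = subst (_≤ E f) (E-const 0ℚ) (E-mono h)

  E-≤c : ∀ {f c} → (∀ a → f a ≤ c) → E f ≤ c
  E-≤c {f} {c} h = subst (E f ≤_) (E-const c) (E-mono h)

  E-abs : ∀ f → ∣ E f ∣ ≤ E (λ a → ∣ f a ∣)
  E-abs f = abs-≤ (E-mono (λ a → ≤-abs (f a)))
    (subst (_≤ E (λ a → ∣ f a ∣)) (trans (E-* (- 1ℚ) f) (sym (neg-as-* (E f))))
      (E-mono (λ a → subst (_≤ ∣ f a ∣) (neg-as-* (f a)) (-≤-abs (f a)))))

  E-∑ : ∀ {n} (f : Fin n → A → ℚ) → E (λ a → ∑ (λ i → f i a)) ≡ ∑ (λ i → E (f i))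
  E-∑ {zero} f = E-const 0ℚ
  E-∑ {suc n} f = trans (E-+ (f zero) (λ a → ∑ (λ i → f (suc i) a))) (cong (E (f zero) +_) (E-∑ (λ i → f (suc i))))

open Expect public

point : ∀ {A : Set} → A → Expect A
point a = record
  { E = λ f → f a ; E-+ = λ f g → refl ; E-* = λ c f → refl ; E-mono = λ h → h a
  ; E-one = refl ; E-attain = λ f → a , ≤-refl }

mix : ∀ {A : Set} (p : ℚ) → 0ℚ ≤ p → p ≤ 1ℚ → Expect A → Expect A → Expect A
mix p p≥0 p≤1 μ ν = record
  { E = λ f → (1ℚ - p) * E μ f + p * E ν f
  ; E-+ = λ f g → trans (cong₂ (λ x y → (1ℚ - p) * x + p * y) (E-+ μ f g) (E-+ ν f g)) (l1 (1ℚ - p) p (E μ f) _ (E ν f) _)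
  ; E-* = λ c f → trans (cong₂ (λ x y → (1ℚ - p) * x + p * y) (E-* μ c f) (E-* ν c f)) (l2 (1ℚ - p) p c _ _)
  ; E-mono = λ h → +-mono-≤ (*-monoʳ (≤-diff p≤1) (E-mono μ h)) (*-monoʳ p≥0 (E-mono ν h))
  ; E-one = trans (cong₂ (λ x y → (1ℚ - p) * x + p * y) (E-one μ) (E-one ν)) (l3 p)
  ; E-attain = att }
  where
  l1 : ∀ q p a b c d → q * (a + b) + p * (c + d) ≡ q * a + p * c + (q * b + p * d)
  l1 = solve-∀ ring
  l2 : ∀ q p c a b → q * (c * a) + p * (c * b) ≡ c * (q * a + p * b)
  l2 = solve-∀ ring
  l3 : ∀ p → (1ℚ - p) * 1ℚ + p * 1ℚ ≡ 1ℚ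
  l3 = solve-∀ ring
  l4 : ∀ p a b → b - ((1ℚ - p) * a + p * b) ≡ (1ℚ - p) * (b - a)
  l4 = solve-∀ ring
  l5 : ∀ p a b → a - ((1ℚ - p) * a + p * b) ≡ p * (a - b)
  l5 = solve-∀ ring
  att : ∀ f → Σ _ λ a → (1ℚ - p) * E μ f + p * E ν f ≤ f a
  att f with ≤-total (E μ f) (E ν f)
  ... | inj₁ h = proj₁ (E-attain ν f) , ≤-trans (≤-by (≤-diff p≤1 ⊗ ≤-diff h) (l4 p (E μ f) (E ν f))) (proj₂ (E-attain ν f))
  ... | inj₂ h = proj₁ (E-attain μ f) , ≤-trans (≤-by (p≥0 ⊗ ≤-diff h) (l5 p (E μ f) (E ν f))) (proj₂ (E-attain μ f))

prod : ∀ {A : Set} {m} → (Fin m → Expect A) → Expect (Vec A m)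
prod {m = zero} μ = point []
prod {m = suc m} μ = record
  { E = λ f → E μ₀ (λ a → E ν (λ as → f (a ∷ as)))
  ; E-+ = λ f g → trans (E-cong μ₀ (λ a → E-+ ν (λ as → f (a ∷ as)) (λ as → g (a ∷ as)))) (E-+ μ₀ _ _)
  ; E-* = λ c f → trans (E-cong μ₀ (λ a → E-* ν c (λ as → f (a ∷ as)))) (E-* μ₀ c _)
  ; E-mono = λ h → E-mono μ₀ (λ a → E-mono ν (λ as → h (a ∷ as)))
  ; E-one = trans (E-cong μ₀ (λ a → E-one ν)) (E-one μ₀)
  ; E-attain = λ f → let a , p = E-attain μ₀ (λ a → E ν (λ as → f (a ∷ as)))
                         as , q = E-attain ν (λ as → f (a ∷ as))
                     in a ∷ as , ≤-trans p q }
  where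
  μ₀ = μ zero
  ν = prod (λ i → μ (suc i))

-- Certificates for equations

infixr 6 _⊞_
infixr 7 _⊙_

zer : ∀ {a b} → a ≡ b → a - b ≡ 0ℚ
zer {a} refl = +-inverseʳ a

_⊞_ : ∀ {a b} → a ≡ 0ℚ → b ≡ 0ℚ → a + b ≡ 0ℚ
refl ⊞ refl = refl

_⊙_ : ∀ c {a} → a ≡ 0ℚ → c * a ≡ 0ℚ
c ⊙ refl = *-zeroʳ c

-- The counterpart of `≤-by` for equations that hold modulo hypotheses: each hypothesis becomes a
-- vanishing difference (`zer`) with a polynomial cofactor (`_⊙_`), and the ring solver checks that
-- the combination is the difference of the two sides.
≡-by : ∀ {a b s} → s ≡ 0ℚ → a - b ≡ s → a ≡ b
≡-by {a} {b} refl h = trans (lem a b) (trans (cong (b +_) h) (+-identityʳ b))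
  where
  lem : ∀ a b → a ≡ b + (a - b)
  lem = solve-∀ ring

-- Vertex sets and deletion of vertices

VSet : ℕ → Set
VSet n = Vec Bool n

Pair : ℕ → Set
Pair n = Fin n × Fin n

infixl 8 _∖_ _∖∖_

_∖_ : ∀ {n} → VSet n → Fin n → VSet n
U ∖ v = U [ v ]≔ false

_∖∖_ : ∀ {n} → VSet n → Pair n → VSet n
U ∖∖ (a , b) = U ∖ a ∖ b

u : ∀ {n} → VSet n → Fin n → ℚ
u U v = ⟦ lookup U v ⟧

avail : ∀ {n} → VSet n → Pair n → ℚ
avail U (a , b) = u U a * u U b

ι : ∀ {n} → Fin n → Pair n → ℚ
ι v (a , b) = δ v a + δ v b

ι≥0 : ∀ {n} (v : Fin n) p → 0ℚ ≤ ι v p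
ι≥0 v (a , b) = ⟦⟧≥0 (isYes (v ≟F a)) ⊕ ⟦⟧≥0 (isYes (v ≟F b))

Loopless : ∀ {n m} → (Fin m → Pair n) → Set
Loopless ends = ∀ e → proj₁ (ends e) ≢ proj₂ (ends e)

∖-comm : ∀ {n} (U : VSet n) a b → U ∖ a ∖ b ≡ U ∖ b ∖ a
∖-comm U a b with a ≟F b
... | yes refl = refl
... | no ne = []≔-commutes U a b ne

∖-absent : ∀ {n} (U : VSet n) v → lookup U v ≡ false → U ∖ v ≡ U
∖-absent U v h = trans (cong (U [ v ]≔_) (sym h)) ([]≔-lookup U v)

∖∖-∖ : ∀ {n} (U : VSet n) p v → U ∖∖ p ∖ v ≡ U ∖ v ∖∖ p
∖∖-∖ U (a , b) v = trans (∖-comm (U ∖ a) b v) (cong (_∖ b) (∖-comm U a v))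

∖∖-comm : ∀ {n} (U : VSet n) p q → U ∖∖ p ∖∖ q ≡ U ∖∖ q ∖∖ p
∖∖-comm U p (c , d) = trans (cong (_∖ d) (∖∖-∖ U p c)) (∖∖-∖ (U ∖ c) p d)

lookup-∖-self : ∀ {n} (U : VSet n) v → lookup (U ∖ v) v ≡ false
lookup-∖-self U v = lookup∘update v U false

lookup-∖-other : ∀ {n} (U : VSet n) {v x} → x ≢ v → lookup (U ∖ v) x ≡ lookup U x
lookup-∖-other U ne = lookup∘update′ ne U false

u-∖ : ∀ {n} (U : VSet n) v x → u (U ∖ v) x ≡ u U x * (1ℚ - δ x v)
u-∖ U v x with x ≟F v
... | yes refl rewrite lookup-∖-self U x = sym (*-zeroʳ (u U x))
... | no ne rewrite lookup-∖-other U ne = sym (*-identityʳ (u U x))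

u-∖∖ : ∀ {n} (U : VSet n) p x → u (U ∖∖ p) x ≡ u U x * (1ℚ - δ x (proj₁ p)) * (1ℚ - δ x (proj₂ p))
u-∖∖ U (a , b) x = trans (u-∖ (U ∖ a) b x) (cong (_* (1ℚ - δ x b)) (u-∖ U a x))

δδ-0 : ∀ {n} {a b : Fin n} v → a ≢ b → δ v a * δ v b ≡ 0ℚ
δδ-0 {a = a} {b} v ne with v ≟F a
... | no _ = *-zeroˡ (δ v b)
... | yes refl = trans (*-identityˡ (δ v b)) (δ-≢ ne)

ι-∖ : ∀ {n} (p : Pair n) v (f : VSet n → ℚ) (U : VSet n) → ι v p * f (U ∖∖ p) ≡ ι v p * f (U ∖∖ p ∖ v)
ι-∖ (a , b) v f U = trans (*-distribʳ-+ (f (U ∖∖ (a , b))) (δ v a) (δ v b))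
  (trans (cong₂ _+_ (one a (lookup-a)) (one b (lookup-∖-self (U ∖ a) b))) (sym (*-distribʳ-+ (f (U ∖∖ (a , b) ∖ v)) (δ v a) (δ v b))))
  where
  X = U ∖∖ (a , b)
  lookup-a : lookup X a ≡ false
  lookup-a rewrite ∖-comm U a b = lookup-∖-self (U ∖ b) a
  one : ∀ c → lookup X c ≡ false → δ v c * f X ≡ δ v c * f (X ∖ v)
  one c h with v ≟F c
  ... | no _ = trans (*-zeroˡ (f X)) (sym (*-zeroˡ (f (X ∖ v))))
  ... | yes refl = cong (λ Y → 1ℚ * f Y) (sym (∖-absent X v h))

avail-∖ : ∀ {n} (U : VSet n) p v → proj₁ p ≢ proj₂ p → avail (U ∖ v) p + ι v p * avail U p ≡ avail U p
avail-∖ U (a , b) v ne = ≡-by ((u U a * u U b) ⊙ δδ-0 v ne)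
  (trans (cong (λ x → x + (δ v a + δ v b) * (u U a * u U b) - u U a * u U b) (cong₂ _*_ (ua a) (ua b)))
    (lem (u U a) (u U b) (δ v a) (δ v b)))
  where
  ua : ∀ x → u (U ∖ v) x ≡ u U x * (1ℚ - δ v x)
  ua x = trans (u-∖ U v x) (cong (λ d → u U x * (1ℚ - d)) (δ-sym x v))
  lem : ∀ x y s t → x * (1ℚ - s) * (y * (1ℚ - t)) + (s + t) * (x * y) - x * y ≡ x * y * (s * t)
  lem = solve-∀ ring

-- Both sides indicate that the two pairs are disjoint and lie in `U`. This lets two edges be used
-- in either order.
avail-sym : ∀ {n} (U : VSet n) p q → avail U p * avail (U ∖∖ p) q ≡ avail U q * avail (U ∖∖ q) p
avail-sym U p@(a , b) q@(c , d) = trans (cong (avail U p *_) (cong₂ _*_ (u-∖∖ U p c) (u-∖∖ U p d)))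
  (trans (lem (u U a) (u U b) (u U c) (u U d) (δ c a) (δ c b) (δ d a) (δ d b))
   (cong (avail U q *_) (sym (cong₂ _*_ (trans (u-∖∖ U q a) (cong₂ (λ s t → u U a * (1ℚ - s) * (1ℚ - t)) (δ-sym a c) (δ-sym a d)))
                                       (trans (u-∖∖ U q b) (cong₂ (λ s t → u U b * (1ℚ - s) * (1ℚ - t)) (δ-sym b c) (δ-sym b d)))))))
  where
  lem : ∀ a b c d s t x y → a * b * (c * (1ℚ - s) * (1ℚ - t) * (d * (1ℚ - x) * (1ℚ - y))) ≡ c * d *
      (a * (1ℚ - s) * (1ℚ - x) * (b * (1ℚ - t) * (1ℚ - y)))
  lem = solve-∀ ring

avail-self : ∀ {n} (U : VSet n) p → avail (U ∖∖ p) p ≡ 0ℚ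
avail-self U (a , b) rewrite lookup-∖-self (U ∖ a) b = *-zeroʳ (u (U ∖∖ (a , b)) a)

-- The monomer-dimer model

-- The partition function: the sum over all matchings inside `U` of the product of their edge
-- weights, split by whether the first edge is used. Availability is a numerical factor, so that
-- identities for `Z` become polynomial identities.
Z : ∀ {n m} → (Fin m → Pair n) → Vec ℚ m → VSet n → ℚ
Z ends [] U = 1ℚ
Z ends (k ∷ ks) U = Z (λ e → ends (suc e)) ks U + avail U (ends zero) * (k * Z (λ e → ends (suc e)) ks (U ∖∖ ends zero))

-- Total weight of the matchings that contain e
T : ∀ {n m} → (Fin m → Pair n) → Vec ℚ m → VSet n → Fin m → ℚ
T ends k U e = lookup k e * (avail U (ends e) * Z ends k (U ∖∖ ends e))

Nonneg : ∀ {m} → Vec ℚ m → Set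
Nonneg k = ∀ e → 0ℚ ≤ lookup k e

avail≥0 : ∀ {n} (U : VSet n) p → 0ℚ ≤ avail U p
avail≥0 U p = ⟦⟧≥0 (lookup U (proj₁ p)) ⊗ ⟦⟧≥0 (lookup U (proj₂ p))

avail≤1 : ∀ {n} (U : VSet n) p → avail U p ≤ 1ℚ
avail≤1 U p = *-mono (⟦⟧≥0 (lookup U (proj₁ p))) 0≤1 (⟦⟧≤1 (lookup U (proj₁ p))) (⟦⟧≤1 (lookup U (proj₂ p)))

Z≥1 : ∀ {n m} (ends : Fin m → Pair n) k → Nonneg k → ∀ U → 1ℚ ≤ Z ends k U
Z≥1 ends [] h U = ≤-refl
Z≥1 ends (k ∷ ks) h U = ≤-trans (Z≥1 _ ks (λ e → h (suc e)) U)
  (≤-by (avail≥0 U (ends zero) ⊗ h zero ⊗ ≤-trans 0≤1 (Z≥1 _ ks (λ e → h (suc e)) (U ∖∖ ends zero)))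
    (cancelˡ (Z (λ e → ends (suc e)) ks U) _))

Z>0 : ∀ {n m} (ends : Fin m → Pair n) k → Nonneg k → ∀ U → 0ℚ < Z ends k U
Z>0 ends k h U = <-≤-trans (positive⁻¹ 1ℚ) (Z≥1 ends k h U)

T-zero : ∀ {n m} (ends : Fin (suc m) → Pair n) k ks U →
  T ends (k ∷ ks) U zero ≡ k * (avail U (ends zero) * Z (λ e → ends (suc e)) ks (U ∖∖ ends zero))
T-zero ends k ks U = ≡-by ((k * A * (k * Z' (U ∖∖ e₀ ∖∖ e₀))) ⊙ avail-self U e₀)
     (l k A (Z' (U ∖∖ e₀)) (avail (U ∖∖ e₀) e₀) (Z' (U ∖∖ e₀ ∖∖ e₀)))
  where
  e₀ = ends zero
  A = avail U e₀
  Z' = Z (λ e → ends (suc e)) ks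
  l : ∀ k A z y w → k * (A * (z + y * (k * w))) - k * (A * z) ≡ k * A * (k * w) * y
  l = solve-∀ ring

T-suc : ∀ {n m} (ends : Fin (suc m) → Pair n) k ks U e → let es = λ e → ends (suc e) in
  T ends (k ∷ ks) U (suc e) ≡ T es ks U e + avail U (ends zero) * k * T es ks (U ∖∖ ends zero) e
T-suc ends k ks U e = ≡-by ((lookup ks e * k * Z' (U ∖∖ p ∖∖ e₀)) ⊙ zer (avail-sym U p e₀)
           ⊞ (lookup ks e * k * A * avail (U ∖∖ e₀) p) ⊙ zer (cong Z' (∖∖-comm U p e₀)))
     (l (lookup ks e) (avail U p) (Z' (U ∖∖ p)) (avail (U ∖∖ p) e₀) k (Z' (U ∖∖ p ∖∖ e₀)) A (avail (U ∖∖ e₀) p) (Z' (U ∖∖ e₀ ∖∖ p)))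
  where
  e₀ = ends zero
  p = ends (suc e)
  A = avail U e₀
  Z' = Z (λ e → ends (suc e)) ks
  l : ∀ w x z1 y k z2 A b z3 → w * (x * (z1 + y * (k * z2))) - (w * (x * z1) + A * k * (w * (b * z3)))
        ≡ w * k * z2 * (x * y - A * b) + w * k * A * b * (z2 - z3)
  l = solve-∀ ring

-- Matchings are classified by the edge that covers `v`, if any. For `v` outside `U` the sum
-- vanishes and the deletion does nothing.
Z-vertex : ∀ {n m} (ends : Fin m → Pair n) → Loopless ends → ∀ k U v →
  Z ends k U ≡ Z ends k (U ∖ v) + ∑ (λ e → ι v (ends e) * T ends k U e)
Z-vertex ends ll [] U v = sym (+-identityʳ 1ℚ)
Z-vertex ends ll (k ∷ ks) U v = ≡-by
  (zer h1 ⊞ (A * k) ⊙ zer h2 ⊞ (- (k * W)) ⊙ zer h3 ⊞ (- (k * A)) ⊙ zer h5)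
  (trans (cong (λ x → z + A * (k * zb) - x) rhs) (lem z a S1 zb W S2 A Av ι0 k))
  where
  es = λ e → ends (suc e)
  e₀ = ends zero
  ll' : Loopless es
  ll' e = ll (suc e)
  z = Z es ks U
  a = Z es ks (U ∖ v)
  zb = Z es ks (U ∖∖ e₀)
  W = Z es ks (U ∖∖ e₀ ∖ v)
  A = avail U e₀
  Av = avail (U ∖ v) e₀
  ι0 = ι v e₀
  S1 = ∑ (λ e → ι v (es e) * T es ks U e)
  S2 = ∑ (λ e → ι v (es e) * T es ks (U ∖∖ e₀) e)
  h1 : z ≡ a + S1
  h1 = Z-vertex es ll' ks U v
  h2 : zb ≡ W + S2
  h2 = Z-vertex es ll' ks (U ∖∖ e₀) v
  h3 : Av + ι0 * A ≡ A
  h3 = avail-∖ U e₀ v (ll zero)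
  h5 : ι0 * zb ≡ ι0 * W
  h5 = ι-∖ e₀ v (Z es ks) U
  tl : ∀ e → ι v (es e) * T ends (k ∷ ks) U (suc e) ≡ ι v (es e) * T es ks U e + A * k * (ι v (es e) * T es ks (U ∖∖ e₀) e)
  tl e = trans (cong (ι v (es e) *_) (T-suc ends k ks U e)) (l (ι v (es e)) (T es ks U e) (A * k) (T es ks (U ∖∖ e₀) e))
    where
    l : ∀ i t a s → i * (t + a * s) ≡ i * t + a * (i * s)
    l = solve-∀ ring
  hd : ι0 * T ends (k ∷ ks) U zero ≡ ι0 * (k * (A * zb))
  hd = cong (ι0 *_) (T-zero ends k ks U)
  rhs : Z ends (k ∷ ks) (U ∖ v) + ∑ (λ e → ι v (ends e) * T ends (k ∷ ks) U e)
      ≡ a + Av * (k * W) + (ι0 * (k * (A * zb)) + (S1 + A * k * S2))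
  rhs = cong₂ _+_ (cong (λ X → a + Av * (k * Z es ks X)) (sym (∖∖-∖ U e₀ v)))
     (cong₂ _+_ hd (trans (∑-cong tl) (trans (∑-+ (λ e → ι v (es e) * T es ks U e) (λ e → A * k * (ι v (es e) * T es ks (U ∖∖ e₀) e)))
       (cong (S1 +_) (∑-* (A * k) (λ e → ι v (es e) * T es ks (U ∖∖ e₀) e))))))
  lem : ∀ z a S1 zb W S2 A Av i k → z + A * (k * zb) - (a + Av * (k * W) + (i * (k * (A * zb)) + (S1 + A * k * S2)))
      ≡ z - (a + S1) + (A * k * (zb - (W + S2)) + ((- (k * W)) * (Av + i * A - A) + (- (k * A)) * (i * zb - i * W)))
  lem = solve-∀ ring

count : ∀ {n} → VSet n → ℕ
count [] = 0
count (true ∷ U) = suc (count U)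
count (false ∷ U) = count U

count-∖ : ∀ {n} (U : VSet n) v → lookup U v ≡ true → suc (count (U ∖ v)) ≡ count U
count-∖ (true ∷ U) zero h = refl
count-∖ (true ∷ U) (suc v) h = cong suc (count-∖ U v h)
count-∖ (false ∷ U) (suc v) h = count-∖ U v h

∑-atMostOne : ∀ {m} (b : Fin m → Bool) → (∀ e f → b e ≡ true → b f ≡ true → e ≡ f) → ∑ (λ e → ⟦ b e ⟧) ≤ 1ℚ
∑-atMostOne {zero} b h = 0≤1
∑-atMostOne {suc m} b h with b zero in b₀
... | true = ≤-reflexive (trans (cong (1ℚ +_) (∑-0 {m} rest)) (+-identityʳ 1ℚ))
  where
  rest : ∀ e → ⟦ b (suc e) ⟧ ≡ 0ℚ
  rest e with b (suc e) in be
  ... | false = refl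
  ... | true with h zero (suc e) b₀ be
  ... | ()
... | false = subst (_≤ 1ℚ) (sym (+-identityˡ _))
  (∑-atMostOne (λ e → b (suc e)) (λ e f p q → suc-inj (h (suc e) (suc f) p q)))
  where
  suc-inj : ∀ {m} {i j : Fin m} → _≡_ {A = Fin (suc m)} (suc i) (suc j) → i ≡ j
  suc-inj refl = refl

Distinct : ∀ {n m} → (Fin m → Pair n) → Set
Distinct ends = ∀ e f → ends e ≡ ends f → e ≡ f

-- Distinct edges occupy distinct ordered pairs. This is how simplicity of the graph enters: sums
-- over edges are controlled by sums over vertices, whatever the degrees.
∑-pairs : ∀ {n m} (ends : Fin m → Pair n) → Distinct ends → (A : Fin n → Fin n → ℚ) → (∀ a b → 0ℚ ≤ A a b) →
  ∑ (λ e → A (proj₁ (ends e)) (proj₂ (ends e))) ≤ ∑ (λ a → ∑ (λ b → A a b))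
∑-pairs {n} {m} ends inj A A≥0 = ≤-trans (≤-reflexive eq) (∑-mono (λ a → ∑-mono (λ b → le a b)))
  where
  a₁ b₁ : Fin m → Fin n
  a₁ e = proj₁ (ends e)
  b₁ e = proj₂ (ends e)
  isAt : Fin n → Fin n → Fin m → Bool
  isAt a b e = isYes (a ≟F a₁ e) ∧ isYes (b ≟F b₁ e)
  yes-eq : ∀ {n} (a b : Fin n) → isYes (a ≟F b) ≡ true → a ≡ b
  yes-eq a b = isYes-true (a ≟F b)
  once : ∀ a b e f → isAt a b e ≡ true → isAt a b f ≡ true → e ≡ f
  once a b e f p q = inj e f (cong₂ _,_
    (trans (sym (yes-eq a (a₁ e) (∧-conicalˡ _ _ p))) (yes-eq a (a₁ f) (∧-conicalˡ _ _ q)))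
    (trans (sym (yes-eq b (b₁ e) (∧-conicalʳ (isYes (a ≟F a₁ e)) _ p))) (yes-eq b (b₁ f) (∧-conicalʳ (isYes (a ≟F a₁ f)) _ q))))
  le : ∀ a b → ∑ (λ e → ⟦ isAt a b e ⟧ * A a b) ≤ A a b
  le a b = subst₂ _≤_ (sym (∑-*ʳ (λ e → ⟦ isAt a b e ⟧) (A a b))) (*-identityˡ (A a b))
    (*-mono (∑-≥0 (λ e → ⟦⟧≥0 (isAt a b e))) (A≥0 a b) (∑-atMostOne (isAt a b) (once a b)) ≤-refl)
  eq : ∑ (λ e → A (a₁ e) (b₁ e)) ≡ ∑ (λ a → ∑ (λ b → ∑ (λ e → ⟦ isAt a b e ⟧ * A a b)))
  eq = trans (∑-cong (λ e → sym (trans (∑-cong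
      (λ a → trans (∑-cong (λ b → trans (cong (_* A a b) (⟦∧⟧ (isYes (a ≟F a₁ e)) _)) (*-assoc (δ a (a₁ e)) (δ b (b₁ e)) (A a b))))
                    (trans (∑-* {n} (δ a (a₁ e)) _) (cong (δ a (a₁ e) *_) (∑-δ (b₁ e) (A a))))))
                (∑-δ (a₁ e) (λ a → A a (b₁ e))))))
       (trans (∑-swap {m} {n} _) (∑-cong (λ a → ∑-swap {m} {n} (λ e b → ⟦ isAt a b e ⟧ * A a b))))

-- Unmatched vertices in the monomer-dimer model

module Gibbs {n m : ℕ} (ends : Fin m → Pair n) (ll : Loopless ends) where

  -- probability that x stays unmatched in a random matching of U
  g : Vec ℚ m → VSet n → Fin n → ℚ
  g k U x = u U x * Z ends k (U ∖ x) * inv (Z ends k U)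

  -- probability that both ends of p stay unmatched
  J : Vec ℚ m → VSet n → Pair n → ℚ
  J k U p = avail U p * Z ends k (U ∖∖ p) * inv (Z ends k U)

  module _ (k : Vec ℚ m) (k≥0 : Nonneg k) where

    private
      Zk = Z ends k
      i : VSet n → ℚ
      i U = inv (Zk U)
      iZ : ∀ U → Zk U * i U ≡ 1ℚ
      iZ U = inv-* (Z>0 ends k k≥0 U)
      i≥0 : ∀ U → 0ℚ ≤ i U
      i≥0 U = inv-≥0 (Z>0 ends k k≥0 U)
      Z≥0 : ∀ U → 0ℚ ≤ Zk U
      Z≥0 U = ≤-trans 0≤1 (Z≥1 ends k k≥0 U)

    g≥0 : ∀ U x → 0ℚ ≤ g k U x
    g≥0 U x = (⟦⟧≥0 (lookup U x) ⊗ Z≥0 (U ∖ x)) ⊗ i≥0 U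

    J≥0 : ∀ U p → 0ℚ ≤ J k U p
    J≥0 U p = (avail≥0 U p ⊗ Z≥0 (U ∖∖ p)) ⊗ i≥0 U

    -- The probability that `e` lies in the random matching: removing `e` from a matching that
    -- contains it leaves one in which both ends are free, at the price of the factor `lookup k e`.
    P : VSet n → Fin m → ℚ
    P U e = lookup k e * J k U (ends e)

    P≥0 : ∀ U e → 0ℚ ≤ P U e
    P≥0 U e = k≥0 e ⊗ J≥0 U (ends e)

    P-T : ∀ U e → T ends k U e * i U ≡ P U e
    P-T U e = lem (lookup k e) (avail U (ends e)) (Zk (U ∖∖ ends e)) (i U)
      where
      lem : ∀ a b c d → a * (b * c) * d ≡ a * (b * c * d)
      lem = solve-∀ ring

    ι-avail : ∀ (U : VSet n) v p → u U v * (ι v p * avail U p) ≡ ι v p * avail U p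
    ι-avail U v (a , b) = ≡-by
      (  (u U a * u U b) ⊙ zer (δ-subst (u U) v a) ⊞ (u U a * u U b) ⊙ zer (δ-subst (u U) v b)
       ⊞ (δ v a * u U b) ⊙ zer (⟦⟧-idem (lookup U a)) ⊞ (δ v b * u U a) ⊙ zer (⟦⟧-idem (lookup U b)))
      (lem (u U v) (δ v a) (δ v b) (u U a) (u U b))
      where
      lem : ∀ x s t a b → x * ((s + t) * (a * b)) - (s + t) * (a * b)
        ≡ a * b * (s * x - s * a) + (a * b * (t * x - t * b) + (s * b * (a * a - a) + t * a * (b * b - b)))
      lem = solve-∀ ring

    unmatched-or-matched : ∀ U v → u U v ≡ g k U v + ∑ (λ e → ι v (ends e) * P U e)
    unmatched-or-matched U v = ≡-by
      ((- u U v) ⊙ zer (iZ U) ⊞ (u U v * i U) ⊙ zer (Z-vertex ends ll k U v) ⊞ zer sum-eq)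
      (lem (u U v) (Zk U) (i U) (Zk (U ∖ v)) (∑ (λ e → ι v (ends e) * T ends k U e)) _)
      where
      tm : ∀ e → u U v * i U * (ι v (ends e) * T ends k U e) ≡ ι v (ends e) * P U e
      tm e = ≡-by ((lookup k e * Zk (U ∖∖ ends e) * i U) ⊙ zer (ι-avail U v (ends e)))
        (l (u U v) (i U) (ι v (ends e)) (lookup k e) (avail U (ends e)) (Zk (U ∖∖ ends e)))
        where
        l : ∀ x i t k a z → x * i * (t * (k * (a * z))) - t * (k * (a * z * i)) ≡ k * z * i * (x * (t * a) - t * a)
        l = solve-∀ ring
      sum-eq : u U v * i U * ∑ (λ e → ι v (ends e) * T ends k U e) ≡ ∑ (λ e → ι v (ends e) * P U e)
      sum-eq = trans (sym (∑-* (u U v * i U) (λ e → ι v (ends e) * T ends k U e))) (∑-cong tm)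
      lem : ∀ x z i zv s s' → x - (x * zv * i + s') ≡ (- x) * (z * i - 1ℚ) + (x * i * (z - (zv + s)) + (x * i * s - s'))
      lem = solve-∀ ring

    g≤u : ∀ U v → g k U v ≤ u U v
    g≤u U v = ≤-by (∑-≥0 (λ e → ι≥0 v (ends e) ⊗ P≥0 U e))
      (trans (cong (_- g k U v) (unmatched-or-matched U v)) (cancelˡ (g k U v) _))

    -- The Markov property: given that the first end is unmatched, the matching is distributed as in
    -- the model with this vertex deleted.
    J-chain : ∀ U e → J k U (ends e) ≡ g k U (proj₁ (ends e)) * g k (U ∖ proj₁ (ends e)) (proj₂ (ends e))
    J-chain U e = ≡-by ((- (u U a * u U b * zab * i U)) ⊙ zer (iZ (U ∖ a)) ⊞ (- (u U a * za * i U * zab * i (U ∖ a))) ⊙ zer ub)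
        (lem (u U a) (u U b) za zab (i U) (i (U ∖ a)) (u (U ∖ a) b))
      where
      a = proj₁ (ends e)
      b = proj₂ (ends e)
      za = Zk (U ∖ a)
      zab = Zk (U ∖ a ∖ b)
      ub : u (U ∖ a) b ≡ u U b
      ub = cong ⟦_⟧ (lookup-∖-other U (λ q → ll e (sym q)))
      lem : ∀ x y za zab i j y' → x * y * zab * i - (x * za * i * (y' * zab * j))
         ≡ (- (x * y * zab * i)) * (za * j - 1ℚ) + (- (x * za * i * zab * j)) * (y' - y)
      lem = solve-∀ ring

    -- Condition on the partner of `v`. If `v` is matched by `e`, the rest is a Gibbs matching of
    -- `U ∖∖ ends e`; if `v` is unmatched, it is one of `U ∖ v`, and the contribution cancels.
    g-vertex : ∀ U v x → x ≢ v → lookup U v ≡ true →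
      g k U x - g k (U ∖ v) x ≡ ∑ (λ e → ι v (ends e) * (P U e * (g k (U ∖∖ ends e) x - g k (U ∖ v) x)))
    g-vertex U v x ne hv = ≡-by
      (  i U ⊙ zer zg ⊞ (- (u (U ∖ v) x * Zk (U ∖ v ∖ x) * i U)) ⊙ zer (iZ (U ∖ v)) ⊞ gv ⊙ zer (iZ U) ⊞ (- (gv * i U)) ⊙ zer
          (Z-vertex ends ll k U v) ⊞ zer sum-eq)
      (lem (u U x * Zk (U ∖ x)) (i U) (u (U ∖ v) x) (Zk (U ∖ v ∖ x)) (i (U ∖ v)) (Zk (U ∖ v)) (Zk U) S1 S2 _)
      where
      gv = g k (U ∖ v) x
      S1 = ∑ (λ e → ι v (ends e) * T ends k U e)
      S2 = ∑ (λ e → ι v (ends e) * (lookup k e * (avail U (ends e) * (u (U ∖∖ ends e) x * Zk (U ∖∖ ends e ∖ x)))))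
      ux : u U x ≡ u (U ∖ v) x
      ux = cong ⟦_⟧ (sym (lookup-∖-other U ne))
      av : ∀ p → u U x * avail (U ∖ x) p ≡ avail U p * u (U ∖∖ p) x
      av p@(a , b) = trans (cong (u U x *_) (cong₂ _*_ (trans (u-∖ U x a) (cong (λ d → u U a * (1ℚ - d)) (δ-sym a x)))
          (trans (u-∖ U x b) (cong (λ d → u U b * (1ℚ - d)) (δ-sym b x)))))
        (trans (l (u U x) (u U a) (u U b) (δ x a) (δ x b)) (cong (avail U p *_) (sym (u-∖∖ U p x))))
        where
        l : ∀ x a b s t → x * (a * (1ℚ - s) * (b * (1ℚ - t))) ≡ a * b * (x * (1ℚ - s) * (1ℚ - t))
        l = solve-∀ ring
      zg : u U x * Zk (U ∖ x) ≡ u (U ∖ v) x * Zk (U ∖ v ∖ x) + S2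
      zg = trans (cong (u U x *_) (Z-vertex ends ll k (U ∖ x) v))
        (trans (*-distribˡ-+ (u U x) _ _) (cong₂ _+_ (cong₂ (λ s t → s * Zk t) ux (∖-comm U x v))
          (trans (sym (∑-* (u U x) (λ e → ι v (ends e) * T ends k (U ∖ x) e))) (∑-cong tm))))
        where
        tm : ∀ e → u U x * (ι v (ends e) * T ends k (U ∖ x) e) ≡ ι v (ends e) *
            (lookup k e * (avail U (ends e) * (u (U ∖∖ ends e) x * Zk (U ∖∖ ends e ∖ x))))
        tm e = trans (cong (λ Y → u U x * (ι v (ends e) * (lookup k e * (avail (U ∖ x) (ends e) * Zk Y)))) (sym (∖∖-∖ U (ends e) x)))
          (≡-by ((ι v (ends e) * lookup k e * Zk (U ∖∖ ends e ∖ x)) ⊙ zer (av (ends e)))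
              (l (u U x) (ι v (ends e)) (lookup k e) (avail (U ∖ x) (ends e)) (Zk (U ∖∖ ends e ∖ x)) (avail U (ends e))
              (u (U ∖∖ ends e) x)))
          where
          l : ∀ x t k a z b y → x * (t * (k * (a * z))) - t * (k * (b * (y * z))) ≡ t * k * z * (x * a - b * y)
          l = solve-∀ ring
      sum-eq : i U * S2 - gv * i U * S1 ≡ ∑ (λ e → ι v (ends e) * (P U e * (g k (U ∖∖ ends e) x - gv)))
      sum-eq = trans (cong₂ _-_ (sym (∑-* (i U) f₁)) (sym (∑-* (gv * i U) f₂)))
        (trans (sym (∑-− (λ e → i U * f₁ e) (λ e → gv * i U * f₂ e))) (∑-cong tm))
        where
        f₁ f₂ : Fin m → ℚ
        f₁ e = ι v (ends e) * (lookup k e * (avail U (ends e) * (u (U ∖∖ ends e) x * Zk (U ∖∖ ends e ∖ x))))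
        f₂ e = ι v (ends e) * T ends k U e
        tm : ∀ e → i U * (ι v (ends e) * (lookup k e *
            (avail U (ends e) * (u (U ∖∖ ends e) x * Zk (U ∖∖ ends e ∖ x))))) - gv * i U * (ι v (ends e) * T ends k U e)
               ≡ ι v (ends e) * (P U e * (g k (U ∖∖ ends e) x - gv))
        tm e = ≡-by ((- (ι v (ends e) * lookup k e * avail U (ends e) * i U * u (U ∖∖ ends e) x * Zk (U ∖∖ ends e ∖ x))) ⊙ zer
            (iZ (U ∖∖ ends e)))
          (l (i U) (ι v (ends e)) (lookup k e) (avail U (ends e)) (u (U ∖∖ ends e) x) (Zk (U ∖∖ ends e ∖ x)) gv (Zk (U ∖∖ ends e))
              (i (U ∖∖ ends e)))
          where
          l : ∀ i t k a y z g w j → i * (t * (k * (a * (y * z)))) - g * i * (t * (k * (a * w))) - t * (k * (a * w * i) * (y * z * j - g))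
             ≡ (- (t * k * a * i * y * z)) * (w * j - 1ℚ)
          l = solve-∀ ring
      lem : ∀ zx i y zvx j zv z S1 S2 s → zx * i - y * zvx * j - s ≡
        i * (zx - (y * zvx + S2)) + ((- (y * zvx * i)) * (zv * j - 1ℚ) +
            (y * zvx * j * (z * i - 1ℚ) + ((- (y * zvx * j * i)) * (z - (zv + S1)) + (i * S2 - y * zvx * j * i * S1 - s))))
      lem = solve-∀ ring

    P-unavail : ∀ U e → (lookup U (proj₁ (ends e)) ≡ false) ⊎ (lookup U (proj₂ (ends e)) ≡ false) → P U e ≡ 0ℚ
    P-unavail U e (inj₁ h) rewrite h = lem (lookup k e) (u U (proj₂ (ends e))) (Zk (U ∖∖ ends e)) (i U)
      where
      lem : ∀ k b z i → k * (0ℚ * b * z * i) ≡ 0ℚ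
      lem = solve-∀ ring
    P-unavail U e (inj₂ h) rewrite h = lem (lookup k e) (u U (proj₁ (ends e))) (Zk (U ∖∖ ends e)) (i U)
      where
      lem : ∀ k b z i → k * (b * 0ℚ * z * i) ≡ 0ℚ
      lem = solve-∀ ring

    dist : VSet n → VSet n → ℚ
    dist U W = ∑ (λ x → ∣ g k U x - g k W x ∣)

    dist-sym : ∀ U W → dist U W ≡ dist W U
    dist-sym U W = ∑-cong (λ x → abs-sym (g k U x) (g k W x))

    dist-tri : ∀ U W X → dist U X ≤ dist U W + dist W X
    dist-tri U W X = subst (dist U X ≤_) (∑-+ {n} _ _) (∑-mono (λ x → abs-tri (g k U x) (g k W x) (g k X x)))

    g-self : ∀ U v → g k (U ∖ v) v ≡ 0ℚ
    g-self U v rewrite lookup-∖-self U v = lem (Zk (U ∖ v ∖ v)) (i (U ∖ v))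
      where
      lem : ∀ a b → 0ℚ * a * b ≡ 0ℚ
      lem = solve-∀ ring

    private
      R : VSet n → Fin n → Fin n → ℚ
      R U v x = δ x v * g k U v + ∑ (λ e → ι v (ends e) * (P U e * ∣ g k (U ∖∖ ends e) x - g k (U ∖ v) x ∣))

    private
      point-bound : ∀ U v → lookup U v ≡ true → ∀ x → ∣ g k U x - g k (U ∖ v) x ∣ ≤ R U v x
      point-bound U v h x with x ≟F v
      ... | yes refl = subst (λ d → ∣ g k U x - d ∣ ≤ 1ℚ * g k U x + ∑
          (λ e → ι x (ends e) * (P U e * ∣ g k (U ∖∖ ends e) x - g k (U ∖ x) x ∣))) (sym (g-self U x))
              (≤-trans (≤-reflexive (trans (cong ∣_∣ (l (g k U x))) (0≤p⇒∣p∣≡p (g≥0 U x))))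
               (≤-by (∑-≥0 (λ e → ι≥0 x (ends e) ⊗ P≥0 U e ⊗ 0≤∣p∣ (g k (U ∖∖ ends e) x - g k (U ∖ x) x))) (l2 (g k U x) _)))
        where
        l : ∀ a → a - 0ℚ ≡ a
        l = solve-∀ ring
        l2 : ∀ a s → 1ℚ * a + s - a ≡ s
        l2 = solve-∀ ring
      ... | no ne = ≤-trans (≤-reflexive (cong ∣_∣ (g-vertex U v x ne h)))
          (≤-trans (∑-abs {m} _) (≤-trans (∑-mono (λ e → ≤-reflexive
              (trans (abs-* _ (ι≥0 v (ends e))) (cong (ι v (ends e) *_) (abs-* _ (P≥0 U e))))))
            (≤-reflexive (l (g k U v) _))))
        where
        l : ∀ a s → s ≡ 0ℚ * a + s
        l = solve-∀ ring

    -- The vertex `v` itself contributes `g k U v`. With probability `P U e` it is matched by `e`,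
    -- and then `U ∖∖ ends e` is compared with `U ∖ v`; these differ by the other end of `e` alone,
    -- so the induction hypothesis for the smaller set `U ∖ v` gives at most 1. The probabilities of
    -- these cases sum to 1.
    lipschitz-≤ : ∀ j U v → count U ℕ.≤ j → lookup U v ≡ true → dist U (U ∖ v) ≤ 1ℚ
    lipschitz-≤ zero U v c h with count U | count-∖ U v h
    lipschitz-≤ zero U v ℕ.z≤n h | .zero | ()
    lipschitz-≤ (suc j) U v c h = ≤-trans (∑-mono (point-bound U v h))
      (≤-trans (≤-reflexive sum-R) (≤-trans (+-monoʳ-≤ (g k U v) (∑-mono edge))
        (≤-reflexive (trans (sym (unmatched-or-matched U v)) (cong ⟦_⟧ h)))))
      where
      sum-R : ∑ (R U v) ≡ g k U v + ∑ (λ e → ι v (ends e) * (P U e * dist (U ∖∖ ends e) (U ∖ v)))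
      sum-R = trans (∑-+ {n} _ _) (cong₂ _+_ (∑-δ v (λ x → g k U v))
        (trans (∑-swap {n} {m} _) (∑-cong (λ e → trans (∑-* {n} (ι v (ends e)) _) (cong (ι v (ends e) *_) (∑-* {n} (P U e) _))))))
      c' : count (U ∖ v) ℕ.≤ j
      c' = ℕ.≤-pred (subst (ℕ._≤ suc j) (sym (count-∖ U v h)) c)
      half : ∀ e a b → (lookup U a ≡ false ⊎ lookup U b ≡ false → P U e ≡ 0ℚ) → a ≢ b → U ∖∖ ends e ≡ U ∖ a ∖ b →
             δ v a * (P U e * dist (U ∖∖ ends e) (U ∖ v)) ≤ δ v a * P U e
      half e a b P0 ne eq with v ≟F a
      ... | no _ = ≤-reflexive (trans (*-zeroˡ (P U e * dist (U ∖∖ ends e) (U ∖ v))) (sym (*-zeroˡ (P U e))))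
      ... | yes refl with lookup U b in hb
      ... | false rewrite P0 (inj₂ refl) = ≤-reflexive (l (dist (U ∖∖ ends e) (U ∖ v)))
        where
        l : ∀ a → 1ℚ * (0ℚ * a) ≡ 1ℚ * 0ℚ
        l = solve-∀ ring
      ... | true = *-monoʳ 0≤1 (subst (P U e * dist (U ∖∖ ends e) (U ∖ v) ≤_) (*-identityʳ (P U e)) (*-monoʳ (P≥0 U e)
              (subst (_≤ 1ℚ) (trans (dist-sym (U ∖ v) (U ∖ v ∖ b)) (cong (λ X → dist X (U ∖ v)) (sym eq)))
                (lipschitz-≤ j (U ∖ v) b c' (trans (lookup-∖-other U (λ q → ne (sym q))) hb)))))
      edge : ∀ e → ι v (ends e) * (P U e * dist (U ∖∖ ends e) (U ∖ v)) ≤ ι v (ends e) * P U e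
      edge e = subst₂ _≤_ (sym (*-distribʳ-+ (P U e * dist (U ∖∖ ends e) (U ∖ v)) (δ v a) (δ v b)))
          (sym (*-distribʳ-+ (P U e) (δ v a) (δ v b)))
        (+-mono-≤ (half e a b (P-unavail U e) (ll e) refl)
                  (half e b a (λ { (inj₁ p) → P-unavail U e (inj₂ p) ; (inj₂ p) → P-unavail U e (inj₁ p) }) (λ q → ll e (sym q))
                      (∖-comm U a b)))
        where
        a = proj₁ (ends e)
        b = proj₂ (ends e)

    -- Deleting v reroutes the matching along an alternating path, which changes the
    -- status of only one vertex, namely its other end.
    lipschitz : ∀ U v → dist U (U ∖ v) ≤ 1ℚ
    lipschitz U v with lookup U v in h
    ... | true = lipschitz-≤ (count U) U v ℕ.≤-refl h
    ... | false = subst (_≤ 1ℚ) (sym (∑-0 (λ x → abs-0 (zer (cong (λ W → g k W x) (sym (∖-absent U v h))))))) 0≤1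

    lipschitz₂ : ∀ U p → dist U (U ∖∖ p) ≤ 2ℚ
    lipschitz₂ U (a , b) = ≤-trans (dist-tri U (U ∖ a) (U ∖ a ∖ b)) (+-mono-≤ (lipschitz U a) (lipschitz (U ∖ a) b))

    Z-∖ : ∀ U v → Zk (U ∖ v) ≤ Zk U
    Z-∖ U v = ≤-by (∑-≥0 (λ e → ι≥0 v (ends e) ⊗ k≥0 e ⊗ avail≥0 U (ends e) ⊗ Z≥0 (U ∖∖ ends e)))
      (trans (cong (_- Zk (U ∖ v)) (Z-vertex ends ll k U v)) (cancelˡ (Zk (U ∖ v)) _))

    J≤1 : ∀ U p → J k U p ≤ 1ℚ
    J≤1 U p@(a , b) = subst (J k U p ≤_) (iZ U) (*-mono (avail≥0 U p ⊗ Z≥0 (U ∖∖ p)) (i≥0 U)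
      (subst (avail U p * Zk (U ∖∖ p) ≤_) (*-identityˡ (Zk U))
          (*-mono (avail≥0 U p) (Z≥0 U) (avail≤1 U p) (≤-trans (Z-∖ (U ∖ a) b) (Z-∖ U a)))) ≤-refl)

    private
      g-J : ∀ U e → let a = proj₁ (ends e) ; b = proj₂ (ends e) in
        ∣ J k U (ends e) - g k U a * g k U b ∣ ≡ g k U a * ((1ℚ - δ b a) * ∣ g k U b - g k (U ∖ a) b ∣)
      g-J U e = trans (cong ∣_∣ (trans (cong (_- g k U a * g k U b) (J-chain U e)) (l (g k U a) (g k (U ∖ a) b) (g k U b))))
        (trans (abs-* _ (g≥0 U a)) (cong (g k U a *_) (trans (abs-sym (g k (U ∖ a) b) (g k U b))
          (trans (sym (*-identityˡ _)) (cong (λ d → (1ℚ - d) * ∣ g k U b - g k (U ∖ a) b ∣) (sym (δ-≢ (λ q → ll e (sym q)))))))))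
        where
        a = proj₁ (ends e)
        b = proj₂ (ends e)
        l : ∀ x y z → x * y - x * z ≡ x * (y - z)
        l = solve-∀ ring

      -- Of the total change 1 allowed by `lipschitz`, the deleted vertex `a` uses up `g k U a`
      -- itself; the other vertices share what is left.
      row : ∀ U a → ∑ (λ b → (1ℚ - δ b a) * ∣ g k U b - g k (U ∖ a) b ∣) ≤ u U a - g k U a
      row U a with lookup U a in h
      ... | false = ≤-by {s = 0ℚ} ≤-refl (trans
          (cong₂ _-_ (cong (λ z → 0ℚ - z) ga0) (∑-0
          (λ b → trans (cong (λ W → (1ℚ - δ b a) * ∣ g k U b - g k W b ∣) (∖-absent U a h))
          (trans (cong (λ z → (1ℚ - δ b a) * z) (abs-0 (+-inverseʳ (g k U b)))) (*-zeroʳ (1ℚ - δ b a)))))) refl)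
        where
        ga0 : 0ℚ * Zk (U ∖ a) * i U ≡ 0ℚ
        ga0 = trans (cong (_* i U) (*-zeroˡ (Zk (U ∖ a)))) (*-zeroˡ (i U))
      ... | true = ≤-by (≤-diff (lipschitz U a)) (trans (cong (λ s → 1ℚ - ga - s) sum-eq) (l ga (dist U (U ∖ a))))
        where
        ga = 1ℚ * Zk (U ∖ a) * i U
        D : Fin n → ℚ
        D b = ∣ g k U b - g k (U ∖ a) b ∣
        Da : D a ≡ ga
        Da = trans (cong (λ z → ∣ g k U a - z ∣) (g-self U a)) (trans (cong ∣_∣ (l0 (g k U a))) (trans (0≤p⇒∣p∣≡p (g≥0 U a))
              (cong (λ b → ⟦ b ⟧ * Zk (U ∖ a) * i U) h)))
          where
          l0 : ∀ a → a - 0ℚ ≡ a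
          l0 = solve-∀ ring
        l1 : ∀ d x → (1ℚ - d) * x ≡ x - d * x
        l1 = solve-∀ ring
        sum-eq : ∑ (λ b → (1ℚ - δ b a) * D b) ≡ dist U (U ∖ a) - ga
        sum-eq = trans (∑-cong (λ b → l1 (δ b a) (D b)))
            (trans (∑-− D (λ b → δ b a * D b)) (cong (λ z → dist U (U ∖ a) - z) (trans (∑-δ a D) Da)))
        l : ∀ g d → 1ℚ - g - (d - g) ≡ 1ℚ - d
        l = solve-∀ ring

    -- By `J-chain` the error on an edge is the effect of deleting one end on the other, and `row`
    -- sums these effects. The bound is the expected number of matched vertices rather than of all
    -- vertices, hence comparable with a matching size.
    pair-correlation : Distinct ends → ∀ U →
      ∑ (λ e → ∣ J k U (ends e) - g k U (proj₁ (ends e)) * g k U (proj₂ (ends e)) ∣) ≤ ∑ (λ v → u U v - g k U v)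
    pair-correlation inj U = ≤-trans (≤-reflexive (∑-cong (g-J U)))
      (≤-trans (∑-pairs ends inj (λ a b → g k U a * ((1ℚ - δ b a) * ∣ g k U b - g k (U ∖ a) b ∣)) (λ a b → nn a b))
        (∑-mono (λ a → ≤-trans (≤-reflexive (∑-* (g k U a) (λ b → (1ℚ - δ b a) * ∣ g k U b - g k (U ∖ a) b ∣)))
          (≤-trans (*-monoʳ (g≥0 U a) (row U a)) (subst (g k U a * (u U a - g k U a) ≤_) (*-identityˡ _)
            (*-mono (g≥0 U a) (≤-diff (g≤u U a)) (≤-trans (g≤u U a) (⟦⟧≤1 (lookup U a))) ≤-refl))))))
      where
      nn : ∀ a b → 0ℚ ≤ g k U a * ((1ℚ - δ b a) * ∣ g k U b - g k (U ∖ a) b ∣)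
      nn a b = g≥0 U a ⊗ ≤-diff (⟦⟧≤1 (isYes (b ≟F a))) ⊗ 0≤∣p∣ _

  Nonneg-≔0 : ∀ {k : Vec ℚ m} → Nonneg k → ∀ e → Nonneg (k [ e ]≔ 0ℚ)
  Nonneg-≔0 {k} h e f with f ≟F e
  ... | yes refl = ≤-reflexive (sym (lookup∘update e k 0ℚ))
  ... | no ne = subst (0ℚ ≤_) (sym (lookup∘update′ ne k 0ℚ)) (h f)

-- Effect of a single edge weight on the Gibbs measure

Z-edge : ∀ {n m} (ends : Fin m → Pair n) k U e →
  Z ends k U ≡ Z ends (k [ e ]≔ 0ℚ) U + lookup k e * (avail U (ends e) * Z ends (k [ e ]≔ 0ℚ) (U ∖∖ ends e))
Z-edge ends (k ∷ ks) U zero = ≡-by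
  ((- (k * A * avail (U ∖∖ ends zero) (ends zero))) ⊙ zer (*-zeroˡ (Z' (U ∖∖ ends zero ∖∖ ends zero))) ⊞ (- A) ⊙ zer
      (*-zeroˡ (Z' (U ∖∖ ends zero))))
  (lem (Z' U) A k (Z' (U ∖∖ ends zero)) (Z' (U ∖∖ ends zero ∖∖ ends zero)) (avail (U ∖∖ ends zero) (ends zero)))
  where
  Z' = Z (λ e → ends (suc e)) ks
  A = avail U (ends zero)
  lem : ∀ z a k y w b → z + a * (k * y) - (z + a * (0ℚ * y) + k * (a * (y + b * (0ℚ * w))))
      ≡ (- (k * a * b)) * (0ℚ * w - 0ℚ) + (- a) * (0ℚ * y - 0ℚ)
  lem = solve-∀ ring
Z-edge {m = suc m} ends (k ∷ ks) U (suc e) = ≡-by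
  (zer (Z-edge es ks U e) ⊞ (A * k) ⊙ zer (Z-edge es ks (U ∖∖ e₀) e) ⊞ (k * ke * Z° (U ∖∖ e₀ ∖∖ es e)) ⊙ zer (avail-sym U e₀ (es e))
     ⊞ (k * ke * avail U (es e) * avail (U ∖∖ es e) e₀) ⊙ zer (cong Z° (∖∖-comm U e₀ (es e))))
  (lem (Z es ks U) A k (Z es ks (U ∖∖ e₀)) (Z° U) ke (avail U (es e)) (Z° (U ∖∖ es e)) (Z° (U ∖∖ e₀)) (avail (U ∖∖ e₀) (es e))
      (Z° (U ∖∖ e₀ ∖∖ es e)) (avail (U ∖∖ es e) e₀) (Z° (U ∖∖ es e ∖∖ e₀)))
  where
  es = λ e → ends (suc e)
  e₀ = ends zero
  Z° = Z es (ks [ e ]≔ 0ℚ)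
  A = avail U e₀
  ke = lookup ks e
  lem : ∀ z A k z0 zU ke a zUe z0' b z0e c ze0 →
    z + A * (k * z0) - (zU + A * (k * z0') + ke * (a * (zUe + c * (k * ze0))))
    ≡ (z - (zU + ke * (a * zUe))) + (A * k * (z0 - (z0' + ke * (b * z0e))) +
        (k * ke * z0e * (A * b - a * c) + k * ke * a * c * (z0e - ze0)))
  lem = solve-∀ ring

module GibbsChange {n m : ℕ} (ends : Fin m → Pair n) (ll : Loopless ends) (k : Vec ℚ m) (k≥0 : Nonneg k) (e : Fin m) where
  open Gibbs ends ll

  private
    k° = k [ e ]≔ 0ℚ
    k°≥0 : Nonneg k°
    k°≥0 = Nonneg-≔0 {k} k≥0 e
    Zk = Z ends k
    Z° = Z ends k°
    ke = lookup k e
    p = ends e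
    iZ : ∀ U → Zk U * inv (Zk U) ≡ 1ℚ
    iZ U = inv-* (Z>0 ends k k≥0 U)
    iZ° : ∀ U → Z° U * inv (Z° U) ≡ 1ℚ
    iZ° U = inv-* (Z>0 ends k° k°≥0 U)
    sameZ : ∀ U → Zk (U ∖∖ p) ≡ Z° (U ∖∖ p)
    sameZ U = ≡-by (zer (Z-edge ends k (U ∖∖ p) e) ⊞ (ke * Z° (U ∖∖ p ∖∖ p)) ⊙ avail-self U p)
      (l (Zk (U ∖∖ p)) (Z° (U ∖∖ p)) ke (avail (U ∖∖ p) p) (Z° (U ∖∖ p ∖∖ p)))
      where
      l : ∀ z y k a w → z - y ≡ z - (y + k * (a * w)) + k * w * a
      l = solve-∀ ring

  -- Restoring the weight of `e` multiplies the partition function by `1 + ke * J k° U p` and leaves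
  -- the numerator of `J` alone, so the difference is exactly `ke * (J k° U p * J k U p)`.
  J-change : ∀ U → ∣ J k° U p - J k U p ∣ ≤ ke
  J-change U = subst (_≤ ke) (sym (trans (cong ∣_∣ eq) (0≤p⇒∣p∣≡p (k≥0 e ⊗ J≥0 k° k°≥0 U p ⊗ J≥0 k k≥0 U p))))
    (subst (ke * (J k° U p * J k U p) ≤_) (*-identityʳ ke) (*-monoʳ (k≥0 e)
      (*-mono (J≥0 k° k°≥0 U p) 0≤1 (J≤1 k° k°≥0 U p) (J≤1 k k≥0 U p))))
    where
    A = avail U p
    eq : J k° U p - J k U p ≡ ke * (J k° U p * J k U p)
    eq = ≡-by ((- (A * y * j)) ⊙ zer (iZ U) ⊞ (A * y * i) ⊙ zer (iZ° U) ⊞ (A * y * i * j) ⊙ zer (Z-edge ends k U e)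
               ⊞ (- (A * i + ke * A * y * j * A * i)) ⊙ zer (sameZ U))
      (l A y j (Zk (U ∖∖ p)) i (Zk U) (Z° U) ke)
      where
      y = Z° (U ∖∖ p)
      j = inv (Z° U)
      i = inv (Zk U)
      l : ∀ A y j z i Z Y k → A * y * j - A * z * i - k * (A * y * j * (A * z * i)) ≡
        (- (A * y * j)) * (Z * i - 1ℚ) + (A * y * i * (Y * j - 1ℚ) + (A * y * i * j * (Z - (Y + k * (A * y)))
        + (- (A * i + k * A * y * j * A * i)) * (z - y)))
      l = solve-∀ ring

  -- The measure for `k` is a mixture: with probability `θ` the edge `e` is used and both of its
  -- ends are gone, otherwise the measure is the one for `k°`. Deleting two vertices costs at most
  -- 2.
  g-change : ∀ U → ∑ (λ x → ∣ g k U x - g k° U x ∣) ≤ 2ℚ * ke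
  g-change U = ≤-trans (≤-reflexive (∑-cong pt)) (≤-trans (≤-reflexive (∑-* {n} θ _))
     (≤-trans (*-mono θ≥0 (0≤1 ⊕ 0≤1) θ≤ (subst (_≤ 2ℚ) (dist-sym k° k°≥0 U (U ∖∖ p)) (lipschitz₂ k° k°≥0 U p)))
         (≤-reflexive (*-comm ke 2ℚ))))
    where
    A = avail U p
    θ = ke * J k U p
    θ≥0 : 0ℚ ≤ θ
    θ≥0 = k≥0 e ⊗ J≥0 k k≥0 U p
    θ≤ : θ ≤ ke
    θ≤ = subst (θ ≤_) (*-identityʳ ke) (*-monoʳ (k≥0 e) (J≤1 k k≥0 U p))
    pt : ∀ x → ∣ g k U x - g k° U x ∣ ≡ θ * ∣ g k° (U ∖∖ p) x - g k° U x ∣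
    pt x = trans (cong ∣_∣ eq) (abs-* _ θ≥0)
      where
      ux = u U x
      up = u (U ∖∖ p) x
      av : ux * avail (U ∖ x) p ≡ A * up
      av = trans (cong (ux *_) (cong₂ _*_ (trans (u-∖ U x a) (cong (λ d → u U a * (1ℚ - d)) (δ-sym a x)))
          (trans (u-∖ U x b) (cong (λ d → u U b * (1ℚ - d)) (δ-sym b x)))))
        (trans (l (u U x) (u U a) (u U b) (δ x a) (δ x b)) (cong (A *_) (sym (u-∖∖ U p x))))
        where
        a = proj₁ p
        b = proj₂ p
        l : ∀ x a b s t → x * (a * (1ℚ - s) * (b * (1ℚ - t))) ≡ a * b * (x * (1ℚ - s) * (1ℚ - t))
        l = solve-∀ ring
      zx = Zk (U ∖ x)
      zx° = Z° (U ∖ x)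
      w = Z° (U ∖ x ∖∖ p)
      w' = Z° (U ∖∖ p ∖ x)
      i = inv (Zk U)
      j = inv (Z° U)
      h = inv (Z° (U ∖∖ p))
      eq : g k U x - g k° U x ≡ θ * (g k° (U ∖∖ p) x - g k° U x)
      eq = ≡-by ((ux * i) ⊙ zer (Z-edge ends k (U ∖ x) e) ⊞ (ke * w * i) ⊙ zer av ⊞ (ke * A * up * i) ⊙ zer (cong Z° (sym (∖∖-∖ U p x)))
          ⊞ (- (ke * A * i * up * w')) ⊙ zer (iZ° (U ∖∖ p)) ⊞ (- (ke * A * i * (up * w' * h - ux * zx° * j))) ⊙ zer (sameZ U)
          ⊞ (- (ux * zx° * j * i)) ⊙ zer (Z-edge ends k U e) ⊞ (ux * zx° * j) ⊙ zer (iZ U) ⊞ (- (ux * zx° * i)) ⊙ zer (iZ° U))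
        (l ux zx i zx° j ke A (Zk (U ∖∖ p)) up w' h (avail (U ∖ x) p) w (Z° (U ∖∖ p)) (Zk U) (Z° U))
        where
        l : ∀ x zx i zx° j k A zp up w' h ax w yp Z Y → x * zx * i - x * zx° * j - k * (A * zp * i) * (up * w' * h - x * zx° * j)
          ≡ x * i * (zx - (zx° + k * (ax * w))) + (k * w * i * (x * ax - A * up) + (k * A * up * i * (w - w')
           + ((- (k * A * i * up * w')) * (yp * h - 1ℚ) + ((- (k * A * i * (up * w' * h - x * zx° * j))) * (zp - yp)
           + ((- (x * zx° * j * i)) * (Z - (Y + k * (A * yp))) + (x * zx° * j * (Z * i - 1ℚ) + (- (x * zx° * i)) * (Y * j - 1ℚ)))))))
        l = solve-∀ ring

-- Maximum weight matchings

Av : ∀ {n} → VSet n → Pair n → Set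
Av U p = lookup U (proj₁ p) ≡ true × lookup U (proj₂ p) ≡ true

∖-true : ∀ {n} (U : VSet n) {v x} → lookup (U ∖ v) x ≡ true → lookup U x ≡ true × x ≢ v
∖-true U {v} {x} h with x ≟F v
... | no ne = trans (sym (lookup-∖-other U ne)) h , ne
... | yes refl with trans (sym h) (lookup-∖-self U x)
... | ()

true-∖ : ∀ {n} (U : VSet n) {v x} → lookup U x ≡ true → x ≢ v → lookup (U ∖ v) x ≡ true
true-∖ U h ne = trans (lookup-∖-other U ne) h

∖∖-true : ∀ {n} (U : VSet n) p {x} → lookup (U ∖∖ p) x ≡ true → lookup U x ≡ true × x ≢ proj₁ p × x ≢ proj₂ p
∖∖-true U (a , b) h with ∖-true (U ∖ a) h
... | h₁ , ne with ∖-true U h₁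
... | h₂ , ne′ = h₂ , ne′ , ne

true-∖∖ : ∀ {n} (U : VSet n) p {x} → lookup U x ≡ true → x ≢ proj₁ p → x ≢ proj₂ p → lookup (U ∖∖ p) x ≡ true
true-∖∖ U (a , b) h ne ne′ = true-∖ (U ∖ a) (true-∖ U h ne) ne′

Av-∖∖ : ∀ {n} (U : VSet n) p q → Av U p → Av (U ∖∖ p) q → Av U q × Av (U ∖∖ q) p
Av-∖∖ U p q (pa , pb) (qa , qb) with ∖∖-true U p qa | ∖∖-true U p qb
... | c , ca , cb | d , da , db = (c , d) ,
  (true-∖∖ U q pa (λ r → ca (sym r)) (λ r → da (sym r)) , true-∖∖ U q pb (λ r → cb (sym r)) (λ r → db (sym r)))

Av-∖ : ∀ {n} (U : VSet n) p v → Av (U ∖ v) p → Av U p × proj₁ p ≢ v × proj₂ p ≢ v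
Av-∖ U p v (a , b) with ∖-true U a | ∖-true U b
... | a₁ , a₂ | b₁ , b₂ = (a₁ , b₁) , a₂ , b₂

tl : ∀ {A : Set} {m} → (Fin (suc m) → A) → Fin m → A
tl ends e = ends (suc e)

-- The recursion considers the edges in order and breaks ties against the current edge.
takes : ∀ {n m} → (Fin (suc m) → Pair n) → ℚ → Vec ℚ m → VSet n → Bool
val : ∀ {n m} → (Fin m → Pair n) → Vec ℚ m → VSet n → ℚ

takes ends w ws U = (lookup U (proj₁ (ends zero)) ∧ lookup U (proj₂ (ends zero)))
  ∧ isYes (val (tl ends) ws U <? w + val (tl ends) ws (U ∖∖ ends zero))
val ends [] U = 0ℚ
val ends (w ∷ ws) U = if takes ends w ws U then w + val (tl ends) ws (U ∖∖ ends zero) else val (tl ends) ws U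

unc : ∀ {n m} → (Fin m → Pair n) → Vec ℚ m → VSet n → VSet n
unc ends [] U = U
unc ends (w ∷ ws) U = if takes ends w ws U then unc (tl ends) ws (U ∖∖ ends zero) else unc (tl ends) ws U

sel : ∀ {n m} → (Fin m → Pair n) → Vec ℚ m → VSet n → Fin m → Bool
sel ends (w ∷ ws) U zero = takes ends w ws U
sel ends (w ∷ ws) U (suc e) = if takes ends w ws U then sel (tl ends) ws (U ∖∖ ends zero) e else sel (tl ends) ws U e

if-cong : ∀ {A : Set} {b c : Bool} {x y : A} → b ≡ c → (if b then x else y) ≡ (if c then x else y)
if-cong refl = refl

false≢true : false ≢ true
false≢true ()

data Takes {n m} (ends : Fin (suc m) → Pair n) (w : ℚ) (ws : Vec ℚ m) (U : VSet n) : Bool → Set where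
  take : Av U (ends zero) → val (tl ends) ws U < w + val (tl ends) ws (U ∖∖ ends zero) → Takes ends w ws U true
  skip : (Av U (ends zero) → w + val (tl ends) ws (U ∖∖ ends zero) ≤ val (tl ends) ws U) → Takes ends w ws U false

takes? : ∀ {n m} (ends : Fin (suc m) → Pair n) w ws U → Takes ends w ws U (takes ends w ws U)
takes? ends w ws U with lookup U (proj₁ (ends zero)) in ha
... | false = skip (λ { (p , _) → ⊥-elim (false≢true (trans (sym ha) p)) })
... | true with lookup U (proj₂ (ends zero)) in hb
... | false = skip (λ { (_ , p) → ⊥-elim (false≢true (trans (sym hb) p)) })
... | true with val (tl ends) ws U <? w + val (tl ends) ws (U ∖∖ ends zero)
... | yes lt = take (ha , hb) lt
... | no nlt = skip (λ _ → ≮⇒≥ nlt)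

takes-unique : ∀ {n m} {ends : Fin (suc m) → Pair n} {w ws U b c} → Takes ends w ws U b → Takes ends w ws U c → b ≡ c
takes-unique (take x x₁) (take x₂ x₃) = refl
takes-unique (take x x₁) (skip x₂) = ⊥-elim (<-irrefl refl (<-≤-trans x₁ (x₂ x)))
takes-unique (skip x) (take x₁ x₂) = ⊥-elim (<-irrefl refl (<-≤-trans x₂ (x x₁)))
takes-unique (skip x) (skip x₁) = refl

takes-≡ : ∀ {n m} (ends : Fin (suc m) → Pair n) w ws U {b} → Takes ends w ws U b → takes ends w ws U ≡ b
takes-≡ ends w ws U t = takes-unique (takes? ends w ws U) t

module _ {n : ℕ} where

  val≥tl : ∀ {m} (ends : Fin (suc m) → Pair n) w ws U → val (tl ends) ws U ≤ val ends (w ∷ ws) U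
  val≥tl ends w ws U with takes ends w ws U | takes? ends w ws U
  ... | true | take _ lt = <⇒≤ lt
  ... | false | skip _ = ≤-refl

  val≥hd : ∀ {m} (ends : Fin (suc m) → Pair n) w ws U → Av U (ends zero) → w + val (tl ends) ws (U ∖∖ ends zero) ≤ val ends (w ∷ ws) U
  val≥hd ends w ws U av with takes ends w ws U | takes? ends w ws U
  ... | true | take _ lt = ≤-refl
  ... | false | skip le = le av

  val≥0 : ∀ {m} (ends : Fin m → Pair n) w U → 0ℚ ≤ val ends w U
  val≥0 ends [] U = ≤-refl
  val≥0 ends (w ∷ ws) U = ≤-trans (val≥0 (tl ends) ws U) (val≥tl ends w ws U)

  val-∖ : ∀ {m} (ends : Fin m → Pair n) w U v → val ends w (U ∖ v) ≤ val ends w U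
  val-∖ ends [] U v = ≤-refl
  val-∖ ends (w ∷ ws) U v with takes ends w ws (U ∖ v) | takes? ends w ws (U ∖ v)
  ... | false | skip _ = ≤-trans (val-∖ (tl ends) ws U v) (val≥tl ends w ws U)
  ... | true | take av _ = ≤-trans (+-monoʳ-≤ w
      (subst (λ X → val (tl ends) ws X ≤ val (tl ends) ws (U ∖∖ ends zero)) (∖∖-∖ U (ends zero) v)
      (val-∖ (tl ends) ws (U ∖∖ ends zero) v)))
      (val≥hd ends w ws U (proj₁ (Av-∖ U (ends zero) v av)))

  val-∖∖ : ∀ {m} (ends : Fin m → Pair n) w U p → val ends w (U ∖∖ p) ≤ val ends w U
  val-∖∖ ends w U (a , b) = ≤-trans (val-∖ ends w (U ∖ a) b) (val-∖ ends w U a)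

  private
    swap : ∀ a b c → a + (b + c) ≡ b + (a + c)
    swap = solve-∀ ring

  -- The recursion provides this for the first edge (`val≥hd`); a later edge is moved past the first
  -- one by exchanging the two deletions.
  val-avail : ∀ {m} (ends : Fin m → Pair n) w U e → Av U (ends e) → lookup w e + val ends w (U ∖∖ ends e) ≤ val ends w U
  val-avail ends (w ∷ ws) U zero av = ≤-trans (+-monoʳ-≤ w (≤-reflexive no-take)) (val≥hd ends w ws U av)
    where
    no-take : val ends (w ∷ ws) (U ∖∖ ends zero) ≡ val (tl ends) ws (U ∖∖ ends zero)
    no-take with takes ends w ws (U ∖∖ ends zero) | takes? ends w ws (U ∖∖ ends zero)
    ... | false | skip _ = refl
    ... | true | take (_ , h) _ = ⊥-elim (proj₂ (proj₂ (∖∖-true U (ends zero) h)) refl)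
  val-avail ends (w ∷ ws) U (suc e) av with takes ends w ws (U ∖∖ ends (suc e)) | takes? ends w ws (U ∖∖ ends (suc e))
  ... | false | skip _ = ≤-trans (val-avail (tl ends) ws U e av) (val≥tl ends w ws U)
  ... | true | take av₀ _ with Av-∖∖ U (ends (suc e)) (ends zero) av av₀
  ... | avU , avE = ≤-trans (≤-reflexive (trans (swap (lookup ws e) w _)
      (cong (λ X → w + (lookup ws e + val (tl ends) ws X)) (∖∖-comm U (ends (suc e)) (ends zero)))))
      (≤-trans (+-monoʳ-≤ w (val-avail (tl ends) ws (U ∖∖ ends zero) e avE)) (val≥hd ends w ws U avU))

  record Selected {m} (ends : Fin m → Pair n) (w : Vec ℚ m) (U : VSet n) (e : Fin m) : Set where
    field
      available : Av U (ends e)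
      unc-eq : unc ends w U ≡ unc ends w (U ∖∖ ends e)
      val-eq : val ends w U ≡ lookup w e + val ends w (U ∖∖ ends e)
      positive : 0ℚ < lookup w e
  open Selected public

  -- The principle of optimality: once the ends of a selected edge are deleted, every other edge is
  -- decided as before, ties included. In each comparison the winning side loses exactly the weight
  -- of the selected edge, and the losing side at least as much (`val-avail`).
  selected : ∀ {m} (ends : Fin m → Pair n) w U e → sel ends w U e ≡ true → Selected ends w U e
  selected ends (w ∷ ws) U zero h with takes ends w ws U in tk₀ | takes? ends w ws U
  selected ends (w ∷ ws) U zero refl | true | take av lt = record
    { available = av
    ; unc-eq = trans (if-cong tk₀) (sym (if-cong no-take))
    ; val-eq = trans (if-cong tk₀) (cong (w +_) (sym (if-cong no-take)))
    ; positive = ≰⇒> (λ w≤0 → <-irrefl refl (<-≤-trans lt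
        (≤-trans (+-mono-≤ w≤0 (val-∖∖ (tl ends) ws U e₀)) (≤-reflexive (+-identityˡ _))))) }
    where
    e₀ = ends zero
    no-take : takes ends w ws (U ∖∖ e₀) ≡ false
    no-take = takes-≡ ends w ws (U ∖∖ e₀) (skip (λ { (_ , h) → ⊥-elim (proj₂ (proj₂ (∖∖-true U e₀ h)) refl) }))
  selected ends (w ∷ ws) U (suc e) h with takes ends w ws U in tk₀ | takes? ends w ws U
  ... | true | take av lt = record
    { available = proj₁ avs
    ; unc-eq = trans (if-cong tk₀) (trans (unc-eq IH) (trans (cong (unc (tl ends) ws) (∖∖-comm U e₀ p)) (sym (if-cong tk))))
    ; val-eq = trans (if-cong tk₀) (trans (cong (w +_) (val-eq IH))
        (trans (swap w (lookup ws e) _) (cong (lookup ws e +_) (trans (cong (λ X → w + val (tl ends) ws X) (∖∖-comm U e₀ p))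
         (sym (if-cong tk))))))
    ; positive = positive IH }
    where
    e₀ = ends zero
    p = ends (suc e)
    IH = selected (tl ends) ws (U ∖∖ e₀) e h
    avs = Av-∖∖ U e₀ p av (available IH)
    x = lookup ws e
    lt' : x + val (tl ends) ws (U ∖∖ p) < x + (w + val (tl ends) ws (U ∖∖ p ∖∖ e₀))
    lt' = ≤-<-trans (val-avail (tl ends) ws U e (proj₁ avs)) (<-≤-trans lt (≤-reflexive (trans (cong (w +_) (val-eq IH))
        (trans (swap w x _) (cong (λ X → x + (w + val (tl ends) ws X)) (∖∖-comm U e₀ p))))))
    tk : takes ends w ws (U ∖∖ p) ≡ true
    tk = takes-≡ ends w ws (U ∖∖ p) (take (proj₂ avs) (≰⇒> (λ le → <-irrefl refl (<-≤-trans lt' (+-monoʳ-≤ x le)))))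
  ... | false | skip le = record
    { available = available IH
    ; unc-eq = trans (if-cong tk₀) (trans (unc-eq IH) (sym (if-cong tk)))
    ; val-eq = trans (if-cong tk₀) (trans (val-eq IH) (cong (lookup ws e +_) (sym (if-cong tk))))
    ; positive = positive IH }
    where
    e₀ = ends zero
    p = ends (suc e)
    IH = selected (tl ends) ws U e h
    x = lookup ws e
    no-better : Av (U ∖∖ p) e₀ → w + val (tl ends) ws (U ∖∖ p ∖∖ e₀) ≤ val (tl ends) ws (U ∖∖ p)
    no-better av₀ with Av-∖∖ U p e₀ (available IH) av₀
    ... | avU , avE = ≮⇒≥ (λ lt → <-irrefl refl (<-≤-trans (+-monoʳ-< x lt)
          (≤-trans (≤-reflexive (trans (swap x w _) (cong (λ X → w + (x + val (tl ends) ws X)) (∖∖-comm U p e₀))))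
           (≤-trans (+-monoʳ-≤ w (val-avail (tl ends) ws (U ∖∖ e₀) e avE)) (≤-trans (le avU) (≤-reflexive (val-eq IH)))))))
    tk : takes ends w ws (U ∖∖ p) ≡ false
    tk = takes-≡ ends w ws (U ∖∖ p) (skip no-better)

  unc-⊆ : ∀ {m} (ends : Fin m → Pair n) w U v → lookup (unc ends w U) v ≡ true → lookup U v ≡ true
  unc-⊆ ends [] U v h = h
  unc-⊆ ends (w ∷ ws) U v h with takes ends w ws U
  ... | true = proj₁ (∖∖-true U (ends zero) (unc-⊆ (tl ends) ws (U ∖∖ ends zero) v h))
  ... | false = unc-⊆ (tl ends) ws U v h

  unc-keep : ∀ {m} (ends : Fin m → Pair n) w U v → lookup (unc ends w U) v ≡ true →
    unc ends w (U ∖ v) ≡ unc ends w U ∖ v × val ends w (U ∖ v) ≡ val ends w U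
  unc-keep ends [] U v h = refl , refl
  unc-keep ends (w ∷ ws) U v h with takes ends w ws U | takes? ends w ws U
  ... | true | take (ha , hb) lt = trans (if-cong tk) (trans (cong (unc (tl ends) ws) (sym (∖∖-∖ U e₀ v))) (proj₁ IH)) ,
        trans (if-cong tk) (cong (w +_) veq)
    where
    e₀ = ends zero
    IH = unc-keep (tl ends) ws (U ∖∖ e₀) v h
    v∈ = ∖∖-true U e₀ (unc-⊆ (tl ends) ws (U ∖∖ e₀) v h)
    veq : val (tl ends) ws (U ∖ v ∖∖ e₀) ≡ val (tl ends) ws (U ∖∖ e₀)
    veq = trans (cong (val (tl ends) ws) (sym (∖∖-∖ U e₀ v))) (proj₂ IH)
    tk : takes ends w ws (U ∖ v) ≡ true
    tk = takes-≡ ends w ws (U ∖ v) (take (true-∖ U ha (λ q → proj₁ (proj₂ v∈) (sym q)) , true-∖ U hb (λ q → proj₂ (proj₂ v∈) (sym q)))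
       (≤-<-trans (val-∖ (tl ends) ws U v) (<-≤-trans lt (≤-reflexive (cong (w +_) (sym veq))))))
  ... | false | skip le = trans (if-cong tk) (proj₁ IH) ,
        trans (if-cong tk) (proj₂ IH)
    where
    e₀ = ends zero
    IH = unc-keep (tl ends) ws U v h
    tk : takes ends w ws (U ∖ v) ≡ false
    tk = takes-≡ ends w ws (U ∖ v) (skip (λ av → ≤-trans
        (+-monoʳ-≤ w (≤-trans (≤-reflexive (cong (val (tl ends) ws) (sym (∖∖-∖ U e₀ v)))) (val-∖ (tl ends) ws (U ∖∖ e₀) v)))
        (≤-trans (le (proj₁ (Av-∖ U e₀ v av))) (≤-reflexive (sym (proj₂ IH))))))

  unc-cover : ∀ {m} (ends : Fin m → Pair n) w U v → lookup U v ≡ true → lookup (unc ends w U) v ≡ false →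
    Σ (Fin m) λ e → sel ends w U e ≡ true × (v ≡ proj₁ (ends e) ⊎ v ≡ proj₂ (ends e))
  unc-cover ends [] U v h h' with trans (sym h) h'
  ... | ()
  unc-cover ends (w ∷ ws) U v h h' with takes ends w ws U in eq
  ... | false with unc-cover (tl ends) ws U v h h'
  ... | e , s , o = suc e , trans (if-cong eq) s , o
  unc-cover ends (w ∷ ws) U v h h' | true with v ≟F proj₁ (ends zero) | v ≟F proj₂ (ends zero)
  ... | yes p | _ = zero , eq , inj₁ p
  ... | no _ | yes p = zero , eq , inj₂ p
  ... | no p | no q with unc-cover (tl ends) ws (U ∖∖ ends zero) v (true-∖∖ U (ends zero) h p q) h'
  ... | e , s , o = suc e , trans (if-cong eq) s , o

  data Near (X Y : VSet n) : Set where
    same : X ≡ Y → Near X Y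
    less : ∀ x → Y ≡ X ∖ x → Near X Y
    more : ∀ x → X ≡ Y ∖ x → Near X Y

  Near-sym : ∀ {X Y} → Near X Y → Near Y X
  Near-sym (same p) = same (sym p)
  Near-sym (less x p) = more x p
  Near-sym (more x p) = less x p

  -- If `v` is covered and its partner is b, then `U` and `U ∖ v ∖ b` leave the same vertices
  -- uncovered (`unc-eq`). Comparing `U` with `U ∖ v` thus becomes comparing `U ∖ v` with
  -- `U ∖ v ∖ b` in exchanged roles, which is one step along an alternating path.
  unc-near : ∀ {m} (ends : Fin m → Pair n) → Loopless ends → ∀ w j U v → count U ℕ.≤ j → Near (unc ends w U) (unc ends w (U ∖ v))
  unc-near ends ll w j U v c with lookup U v in hv
  ... | false = same (cong (unc ends w) (sym (∖-absent U v hv)))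
  ... | true with lookup (unc ends w U) v in hu
  ... | true = less v (proj₁ (unc-keep ends w U v hu))
  unc-near ends ll w zero U v c | true | false with count U | count-∖ U v hv
  unc-near ends ll w zero U v ℕ.z≤n | true | false | .zero | ()
  unc-near ends ll w (suc j) U v c | true | false with unc-cover ends w U v hv hu
  ... | e , s , o = subst (λ X → Near X (unc ends w (U ∖ v))) (sym (unc-eq S)) (Near-sym (go o))
    where
    S = selected ends w U e s
    c' : count (U ∖ v) ℕ.≤ j
    c' = ℕ.≤-pred (subst (ℕ._≤ suc j) (sym (count-∖ U v hv)) c)
    go : (v ≡ proj₁ (ends e) ⊎ v ≡ proj₂ (ends e)) → Near (unc ends w (U ∖ v)) (unc ends w (U ∖∖ ends e))
    go (inj₁ refl) = unc-near ends ll w j (U ∖ v) (proj₂ (ends e)) c'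
    go (inj₂ refl) = subst (λ X → Near (unc ends w (U ∖ v)) (unc ends w X)) (∖-comm U v (proj₁ (ends e)))
        (unc-near ends ll w j (U ∖ v) (proj₁ (ends e)) c')

  val-≔0 : ∀ {m} (ends : Fin m → Pair n) w U e → val ends (w [ e ]≔ 0ℚ) U ≤ val ends w U
  val-≔0 ends (w ∷ ws) U zero with takes ends 0ℚ ws U
  ... | true = ≤-trans (≤-reflexive (+-identityˡ _)) (≤-trans (val-∖∖ (tl ends) ws U (ends zero)) (val≥tl ends w ws U))
  ... | false = val≥tl ends w ws U
  val-≔0 ends (w ∷ ws) U (suc e) with takes ends w (ws [ e ]≔ 0ℚ) U | takes? ends w (ws [ e ]≔ 0ℚ) U
  ... | true | take av _ = ≤-trans (+-monoʳ-≤ w (val-≔0 (tl ends) ws (U ∖∖ ends zero) e)) (val≥hd ends w ws U av)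
  ... | false | skip _ = ≤-trans (val-≔0 (tl ends) ws U e) (val≥tl ends w ws U)

  -- Weight 0 amounts to the absence of the edge, because ties are broken against it; this holds for
  -- an unselected edge of negative weight as well.
  unselected : ∀ {m} (ends : Fin m → Pair n) w U e → sel ends w U e ≡ false →
    unc ends w U ≡ unc ends (w [ e ]≔ 0ℚ) U × val ends w U ≡ val ends (w [ e ]≔ 0ℚ) U
  unselected ends (w ∷ ws) U zero h with takes ends w ws U
  unselected ends (w ∷ ws) U zero refl | false =
      sym (if-cong tk)
    , sym (if-cong tk)
    where
    tk : takes ends 0ℚ ws U ≡ false
    tk = takes-≡ ends 0ℚ ws U (skip (λ _ → ≤-trans (≤-reflexive (+-identityˡ _)) (val-∖∖ (tl ends) ws U (ends zero))))
  unselected ends (w ∷ ws) U (suc e) h with takes ends w ws U | takes? ends w ws U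
  ... | true | take av lt = trans (proj₁ IH) (sym (if-cong tk)) ,
        trans (cong (w +_) (proj₂ IH)) (sym (if-cong tk))
    where
    e₀ = ends zero
    ws° = ws [ e ]≔ 0ℚ
    IH = unselected (tl ends) ws (U ∖∖ e₀) e h
    tk : takes ends w ws° U ≡ true
    tk = takes-≡ ends w ws° U (take av (≤-<-trans (val-≔0 (tl ends) ws U e) (<-≤-trans lt (≤-reflexive (cong (w +_) (proj₂ IH))))))
  ... | false | skip le = trans (proj₁ IH) (sym (if-cong tk)) ,
        trans (proj₂ IH) (sym (if-cong tk))
    where
    e₀ = ends zero
    ws° = ws [ e ]≔ 0ℚ
    IH = unselected (tl ends) ws U e h
    tk : takes ends w ws° U ≡ false
    tk = takes-≡ ends w ws° U (skip (λ av → ≤-trans (+-monoʳ-≤ w (val-≔0 (tl ends) ws (U ∖∖ e₀) e))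
        (≤-trans (le av) (≤-reflexive (proj₂ IH)))))

  unc-update : ∀ {m} (ends : Fin m → Pair n) w U e →
    unc ends w U ≡ unc ends (w [ e ]≔ 0ℚ) U ⊎ unc ends w U ≡ unc ends (w [ e ]≔ 0ℚ) (U ∖∖ ends e)
  unc-update ends w U e with sel ends w U e in s
  ... | false = inj₁ (proj₁ (unselected ends w U e s))
  ... | true with sel ends w (U ∖∖ ends e) e in s'
  ... | false = inj₂ (trans (unc-eq (selected ends w U e s)) (proj₁ (unselected ends w (U ∖∖ ends e) e s')))
  ... | true = ⊥-elim (proj₂ (proj₂ (∖∖-true U (ends e) (proj₂ (available (selected ends w (U ∖∖ ends e) e s'))))) refl)

positive? : ℚ → ℚ
positive? x = ⟦ isYes (0ℚ <? x) ⟧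

positive?-1 : ∀ {x} → 0ℚ < x → positive? x ≡ 1ℚ
positive?-1 {x} h with 0ℚ <? x
... | yes _ = refl
... | no n = ⊥-elim (n h)

positive?-< : ∀ x → 0ℚ < positive? x → 0ℚ < x
positive?-< x h with 0ℚ <? x
... | yes p = p
... | no _ = ⊥-elim (<-irrefl refl h)

-- With these weights `val` is the maximum size of a matching among the edges of positive weight.
support : ∀ {m} → Vec ℚ m → Vec ℚ m
support = map positive?

module _ {n : ℕ} where

  u-∖∖-ι : ∀ (U : VSet n) p → proj₁ p ≢ proj₂ p → Av U p → ∀ x → u (U ∖∖ p) x ≡ u U x - ι x p
  u-∖∖-ι U p@(a , b) ne (ha , hb) x = trans (u-∖∖ U p x)
      (≡-by (u U x ⊙ δδ-0 x ne ⊞ (- 1ℚ) ⊙ zer (δ-subst (u U) x a) ⊞ (- 1ℚ) ⊙ zer (δ-subst (u U) x b)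
      ⊞ (- δ x a) ⊙ zer (cong ⟦_⟧ ha) ⊞ (- δ x b) ⊙ zer (cong ⟦_⟧ hb))
    (l (u U x) (δ x a) (δ x b) (u U a) (u U b)))
    where
    l : ∀ x s t a b → x * (1ℚ - s) * (1ℚ - t) - (x - (s + t)) ≡ x * (s * t) + ((- 1ℚ) * (s * x - s * a)
       + ((- 1ℚ) * (t * x - t * b) + ((- s) * (a - 1ℚ) + (- t) * (b - 1ℚ))))
    l = solve-∀ ring

  unc-incidence : ∀ {m} (ends : Fin m → Pair n) → Loopless ends → ∀ w U v →
    u (unc ends w U) v ≡ u U v - ∑ (λ e → ι v (ends e) * ⟦ sel ends w U e ⟧)
  unc-incidence ends ll [] U v = sym (+-identityʳ (u U v))
  unc-incidence ends ll (w ∷ ws) U v with takes ends w ws U | takes? ends w ws U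
  ... | false | skip _ = trans (unc-incidence (tl ends) (λ e → ll (suc e)) ws U v)
          (l (u U v) (ι v (ends zero)) (∑ (λ e → ι v (ends (suc e)) * ⟦ sel (tl ends) ws U e ⟧)))
    where
    l : ∀ x i s → x - s ≡ x - (i * 0ℚ + s)
    l = solve-∀ ring
  ... | true | take av _ = trans (unc-incidence (tl ends) (λ e → ll (suc e)) ws (U ∖∖ ends zero) v)
          (trans (cong (_- ∑ (λ e → ι v (ends (suc e)) * ⟦ sel (tl ends) ws (U ∖∖ ends zero) e ⟧)) (u-∖∖-ι U (ends zero) (ll zero) av v))
          (l (u U v) (ι v (ends zero)) (∑ (λ e → ι v (ends (suc e)) * ⟦ sel (tl ends) ws (U ∖∖ ends zero) e ⟧))))
    where
    l : ∀ x i s → x - i - s ≡ x - (i * 1ℚ + s)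
    l = solve-∀ ring

  val-sum : ∀ {m} (ends : Fin m → Pair n) w U → val ends w U ≡ ∑ (λ e → ⟦ sel ends w U e ⟧ * lookup w e)
  val-sum ends [] U = refl
  val-sum ends (w ∷ ws) U with takes ends w ws U
  ... | false = trans (val-sum (tl ends) ws U) (l w _)
    where
    l : ∀ w s → s ≡ 0ℚ * w + s
    l = solve-∀ ring
  ... | true = trans (cong (w +_) (val-sum (tl ends) ws (U ∖∖ ends zero))) (l w _)
    where
    l : ∀ w s → w + s ≡ 1ℚ * w + s
    l = solve-∀ ring

  -- S is the indicator of a matching inside U
  Fits : ∀ {m} → (Fin m → Pair n) → VSet n → (Fin m → Bool) → Set
  Fits ends U S = ∀ v → ∑ (λ e → ι v (ends e) * ⟦ S e ⟧) ≤ u U v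

  ι₁ : ∀ (p : Pair n) → 1ℚ ≤ ι (proj₁ p) p
  ι₁ (a , b) = ≤-by (⟦⟧≥0 (isYes (a ≟F b))) (trans (cong (λ d → d + δ a b - 1ℚ) (δ-refl a)) (l (δ a b)))
    where
    l : ∀ d → 1ℚ + d - 1ℚ ≡ d
    l = solve-∀ ring

  ι₂ : ∀ (p : Pair n) → 1ℚ ≤ ι (proj₂ p) p
  ι₂ (a , b) = ≤-by (⟦⟧≥0 (isYes (b ≟F a))) (trans (cong (λ d → δ b a + d - 1ℚ) (δ-refl b)) (l (δ b a)))
    where
    l : ∀ d → d + 1ℚ - 1ℚ ≡ d
    l = solve-∀ ring

  u-positive : ∀ (U : VSet n) v → 1ℚ ≤ u U v → lookup U v ≡ true
  u-positive U v h with lookup U v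
  ... | true = refl
  ... | false = ⊥-elim (<-irrefl refl (<-≤-trans (positive⁻¹ 1ℚ) h))

  Fits-Av : ∀ {m} (ends : Fin m → Pair n) U S → Fits ends U S → ∀ e → S e ≡ true → Av U (ends e)
  Fits-Av ends U S fits e Se = u-positive U a (≤-trans (one a (ι₁ (ends e))) (fits a)) , u-positive U b
      (≤-trans (one b (ι₂ (ends e))) (fits b))
    where
    a = proj₁ (ends e)
    b = proj₂ (ends e)
    one : ∀ v → 1ℚ ≤ ι v (ends e) → 1ℚ ≤ ∑ (λ e → ι v (ends e) * ⟦ S e ⟧)
    one v h = ≤-trans (≤-trans h (≤-reflexive (trans (sym (*-identityʳ (ι v (ends e)))) (cong (λ b → ι v (ends e) * ⟦ b ⟧) (sym Se)))))
      (term≤∑ {f = λ e → ι v (ends e) * ⟦ S e ⟧} (λ f → ι≥0 v (ends f) ⊗ ⟦⟧≥0 (S f)) e)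

  val-max : ∀ {m} (ends : Fin m → Pair n) → Loopless ends → ∀ w U S → Fits ends U S → ∑ (λ e → ⟦ S e ⟧ * lookup w e) ≤ val ends w U
  val-max ends ll [] U S fits = ≤-refl
  val-max ends ll (w ∷ ws) U S fits = go (S zero) refl
    where
    R = ∑ (λ e → ⟦ S (suc e) ⟧ * lookup ws e)
    go : ∀ b → S zero ≡ b → ⟦ b ⟧ * w + R ≤ val ends (w ∷ ws) U
    go false s₀ = ≤-trans (≤-reflexive (trans (cong (_+ R) (*-zeroˡ w)) (+-identityˡ _)))
      (≤-trans (val-max (tl ends) (λ e → ll (suc e)) ws U (tl S) fits') (val≥tl ends w ws U))
      where
      fits' : Fits (tl ends) U (tl S)
      fits' v = ≤-trans (≤-by (ι≥0 v (ends zero) ⊗ ⟦⟧≥0 (S zero)) (l (ι v (ends zero) * ⟦ S zero ⟧) _)) (fits v)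
        where
        l : ∀ a s → a + s - s ≡ a
        l = solve-∀ ring
    go true s₀ = ≤-trans (≤-reflexive (cong (_+ R) (*-identityˡ w)))
      (≤-trans (+-monoʳ-≤ w (val-max (tl ends) (λ e → ll (suc e)) ws (U ∖∖ ends zero) (tl S) fits')) (val≥hd ends w ws U av))
      where
      av : Av U (ends zero)
      av = Fits-Av ends U S fits zero s₀
      fits' : Fits (tl ends) (U ∖∖ ends zero) (tl S)
      fits' v = subst (∑ (λ e → ι v (ends (suc e)) * ⟦ S (suc e) ⟧) ≤_) (sym (u-∖∖-ι U (ends zero) (ll zero) av v))
        (≤-by (≤-diff (fits v)) ((trans (l (u U v) (ι v (ends zero)) (∑ (λ e → ι v (ends (suc e)) * ⟦ S (suc e) ⟧)))
           (cong (λ b → u U v - (ι v (ends zero) * ⟦ b ⟧ + ∑ (λ e → ι v (ends (suc e)) * ⟦ S (suc e) ⟧))) (sym s₀)))))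
        where
        l : ∀ x i s → x - i - s ≡ x - (i * 1ℚ + s)
        l = solve-∀ ring

  sel-fits : ∀ {m} (ends : Fin m → Pair n) → Loopless ends → ∀ w U → Fits ends U (sel ends w U)
  sel-fits ends ll w U v = ≤-by (⟦⟧≥0 (lookup (unc ends w U) v)) (sym (unc-incidence ends ll w U v))

  guarded : ∀ (U : VSet n) p {x} → (Av U p → 0ℚ ≤ x) → 0ℚ ≤ avail U p * x
  guarded U (a , b) {x} h with lookup U a | lookup U b
  ... | false | y = ≤-reflexive (sym (trans (cong (_* x) (*-zeroˡ ⟦ y ⟧)) (*-zeroˡ x)))
  ... | true | false = ≤-reflexive (sym (*-zeroˡ x))
  ... | true | true = 0≤1 ⊗ h (refl , refl)

  -- The left side is the weighted sum of the sizes of all matchings, and a matching of positive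
  -- weight has at most `val ends (support k) U` edges. Division by `Z` then bounds the expected
  -- size of the Gibbs matching.
  size-bound-T : ∀ {m} (ends : Fin m → Pair n) k → Nonneg k → ∀ U → ∑ (T ends k U) ≤ val ends (support k) U * Z ends k U
  size-bound-T ends [] k≥0 U = ≤-reflexive (sym (*-zeroˡ 1ℚ))
  size-bound-T {suc m} ends (k ∷ ks) k≥0 U = ≤-trans (≤-reflexive sum-eq)
      (≤-trans (+-mono-≤ {x = k * (A * zb)} ≤-refl (+-mono-≤ (IH U) (*-monoʳ (avail≥0 U e₀ ⊗ k≥0 zero) (IH (U ∖∖ e₀)))))
      (≤-by (≤-diff (val≥tl ends κ (support ks) U) ⊗ Z≥0 U ⊕ head≥0 ⊗ Z≥0 (U ∖∖ e₀))
          (l k A zb (val (tl ends) (support ks) U) (val (tl ends) (support ks) (U ∖∖ e₀)) (Z es ks U)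
          (val ends (support (k ∷ ks)) U))))
    where
    es = tl ends
    e₀ = ends zero
    κ = positive? k
    A = avail U e₀
    ks≥0 : Nonneg ks
    ks≥0 e = k≥0 (suc e)
    Z≥0 : ∀ U → 0ℚ ≤ Z es ks U
    Z≥0 U = ≤-trans 0≤1 (Z≥1 es ks ks≥0 U)
    zb = Z es ks (U ∖∖ e₀)
    IH = size-bound-T es ks ks≥0
    sum-eq : ∑ (T ends (k ∷ ks) U) ≡ k * (A * zb) + (∑ (T es ks U) + A * k * ∑ (T es ks (U ∖∖ e₀)))
    sum-eq = cong₂ _+_ (T-zero ends k ks U) (trans (∑-cong (T-suc ends k ks U))
        (trans (∑-+ (T es ks U) (λ e → A * k * T es ks (U ∖∖ e₀) e)) (cong (∑ (T es ks U) +_) (∑-* (A * k) (T es ks (U ∖∖ e₀))))))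
    hd : Av U e₀ → Dec (0ℚ < k) → 0ℚ ≤ k * (val ends (support (k ∷ ks)) U - (1ℚ + val es (support ks) (U ∖∖ e₀)))
    hd av (yes lt) = k≥0 zero ⊗ ≤-diff (subst (λ x → x + val es (support ks) (U ∖∖ e₀) ≤ val ends (κ ∷ support ks) U) (positive?-1 lt)
                     (val≥hd ends κ (support ks) U av))
    hd av (no nlt) = ≤-reflexive (sym (trans (cong (_* gain) (≤-antisym (≮⇒≥ nlt) (k≥0 zero))) (*-zeroˡ gain)))
      where
      gain = val ends (support (k ∷ ks)) U - (1ℚ + val es (support ks) (U ∖∖ e₀))
    head≥0 : 0ℚ ≤ A * (k * (val ends (support (k ∷ ks)) U - (1ℚ + val es (support ks) (U ∖∖ e₀))))
    head≥0 = guarded U e₀ (λ av → hd av (0ℚ <? k))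
    l : ∀ k A zb v' vb z v → v * (z + A * (k * zb)) - (k * (A * zb) + (v' * z + A * k * (vb * zb))) ≡ (v - v') * z + A *
        (k * (v - (1ℚ + vb))) * zb
    l = solve-∀ ring

  size-bound : ∀ {m} (ends : Fin m → Pair n) (ll : Loopless ends) k (k≥0 : Nonneg k) U →
    ∑ (λ e → lookup k e * Gibbs.J ends ll k U (ends e)) ≤ val ends (support k) U
  size-bound ends ll k k≥0 U = ≤-trans (≤-reflexive
      (trans (∑-cong (λ e → sym (Gibbs.P-T ends ll k k≥0 U e))) (∑-*ʳ (T ends k U) (inv (Z ends k U)))))
    (≤-trans (*-mono (∑-≥0 (λ e → k≥0 e ⊗ avail≥0 U (ends e) ⊗ ≤-trans 0≤1 (Z≥1 ends k k≥0 (U ∖∖ ends e))))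
        (inv-≥0 (Z>0 ends k k≥0 U)) (size-bound-T ends k k≥0 U) ≤-refl)
     (≤-reflexive (trans (*-assoc (val ends (support k) U) (Z ends k U) _)
         (trans (cong (val ends (support k) U *_) (inv-* (Z>0 ends k k≥0 U))) (*-identityʳ _)))))

  -- Changing one weight moves the uncovered set by at most two vertices.
  module _ {m} (ends : Fin m → Pair n) (ll : Loopless ends) (k : Vec ℚ m) (k≥0 : Nonneg k) where
    open Gibbs ends ll

    dist-near : ∀ {X Y} → Near X Y → dist k k≥0 X Y ≤ 1ℚ
    dist-near {X} (same refl) = ≤-trans (≤-reflexive (∑-0 (λ x → abs-0 (+-inverseʳ (g k X x))))) 0≤1
    dist-near {X} (less x refl) = lipschitz k k≥0 X x
    dist-near {Y = Y} (more x refl) = subst (_≤ 1ℚ) (dist-sym k k≥0 Y (Y ∖ x)) (lipschitz k k≥0 Y x)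

    dist-unc : ∀ {l} (ends' : Fin l → Pair n) → Loopless ends' → ∀ w e U →
      dist k k≥0 (unc ends' (w [ e ]≔ 0ℚ) U) (unc ends' w U) ≤ 2ℚ
    dist-unc ends' ll' w e U with unc-update ends' w U e
    ... | inj₁ p rewrite p = ≤-trans (≤-reflexive (∑-0 (λ x → abs-0 (+-inverseʳ (g k (unc ends' (w [ e ]≔ 0ℚ) U) x))))) (0≤1 ⊕ 0≤1)
    ... | inj₂ p rewrite p = ≤-trans (dist-tri k k≥0 X Y W)
        (+-mono-≤ (dist-near (unc-near ends' ll' w° _ U a ℕ.≤-refl)) (dist-near (unc-near ends' ll' w° _ (U ∖ a) b ℕ.≤-refl)))
      where
      w° = w [ e ]≔ 0ℚ
      a = proj₁ (ends' e)
      b = proj₂ (ends' e)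
      X = unc ends' w° U
      Y = unc ends' w° (U ∖ a)
      W = unc ends' w° (U ∖ a ∖ b)

-- Covariances on product spaces

private
  ∑∑-* : ∀ {n} (A : Fin n → ℚ) → ∑ (λ a → ∑ (λ b → A a * A b)) ≡ ∑ A * ∑ A
  ∑∑-* A = trans (∑-cong (λ a → ∑-* (A a) A)) (∑-*ʳ A (∑ A))

module _ {n M : ℕ} (ends : Fin M → Pair n) (inj : Distinct ends) (c : Fin M → ℚ) (c≥0 : ∀ f → 0ℚ ≤ c f)
         (ĉ : ℚ) (ĉ≥0 : 0ℚ ≤ ĉ) (c≤ĉ : ∀ f → c f ≤ ĉ) where

  private
    u₁ v₁ : Fin M → Fin n
    u₁ f = proj₁ (ends f)
    v₁ f = proj₂ (ends f)

  covariance : ∀ {A : Set} → Expect A → (A → Fin n → ℚ) → Fin M → ℚ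
  covariance μ φ f = E μ (λ a → φ a (u₁ f) * φ a (v₁ f)) - E μ (λ a → φ a (u₁ f)) * E μ (λ a → φ a (v₁ f))

  -- After centring, a covariance is the mean of a product of two deviations. Summed over edges
  -- these products are dominated by the sum over all pairs, which factors into the square of the
  -- total deviation.
  cov-one : ∀ {A : Set} (μ : Expect A) (φ : A → Fin n → ℚ) d → 0ℚ ≤ d → (∀ a a' → ∑ (λ v → ∣ φ a v - φ a' v ∣) ≤ d) →
    ∑ (λ f → c f * ∣ covariance μ φ f ∣) ≤ ĉ * (d * d)
  cov-one {A} μ φ d d≥0 h = ≤-trans (∑-mono (λ f → *-monoʳ (c≥0 f) (one f)))
      (≤-trans (≤-reflexive (trans (∑-cong (λ f → sym (E-* μ (c f) (λ a → ∣ D a (u₁ f) ∣ * ∣ D a (v₁ f) ∣))))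
          (sym (E-∑ μ (λ f a → c f * (∣ D a (u₁ f) ∣ * ∣ D a (v₁ f) ∣))))))
        (E-≤c μ bound))
    where
    m : Fin n → ℚ
    m v = E μ (λ a → φ a v)
    D : A → Fin n → ℚ
    D a v = φ a v - m v
    D-sum : ∀ a → ∑ (λ v → ∣ D a v ∣) ≤ d
    D-sum a = ≤-trans (∑-mono (λ v → ≤-trans (≤-reflexive
        (cong ∣_∣ (sym (trans (E-− μ (λ _ → φ a v) (λ a' → φ a' v)) (cong (_- m v) (E-const μ (φ a v)))))))
        (E-abs μ (λ a' → φ a v - φ a' v))))
       (≤-trans (≤-reflexive (sym (E-∑ μ (λ v a' → ∣ φ a v - φ a' v ∣)))) (E-≤c μ (h a)))
    one : ∀ f → ∣ covariance μ φ f ∣ ≤ E μ (λ a → ∣ D a (u₁ f) ∣ * ∣ D a (v₁ f) ∣)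
    one f = ≤-trans (≤-reflexive (cong ∣_∣ (sym eq)))
        (≤-trans (E-abs μ (λ a → D a x * D a y)) (≤-reflexive (E-cong μ (λ a → ∣p*q∣≡∣p∣*∣q∣ (D a x) (D a y)))))
      where
      x = u₁ f
      y = v₁ f
      ex : ∀ s t p q → (s - p) * (t - q) ≡ s * t - (q * s + (p * t - p * q))
      ex = solve-∀ ring
      fin : ∀ w p q → w - (q * p + (p * q - p * q)) ≡ w - p * q
      fin = solve-∀ ring
      eq : E μ (λ a → D a x * D a y) ≡ covariance μ φ f
      eq = trans (E-cong μ (λ a → ex (φ a x) (φ a y) (m x) (m y)))
        (trans (E-− μ (λ a → φ a x * φ a y) (λ a → m y * φ a x + (m x * φ a y - m x * m y)))
          (trans (cong (λ z → E μ (λ a → φ a x * φ a y) - z) (trans (E-+ μ (λ a → m y * φ a x) (λ a → m x * φ a y - m x * m y))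
            (cong₂ _+_ (E-* μ (m y) (λ a → φ a x)) (trans (E-− μ (λ a → m x * φ a y) (λ _ → m x * m y))
                (cong₂ _-_ (E-* μ (m x) (λ a → φ a y)) (E-const μ (m x * m y)))))))
           (fin (E μ (λ a → φ a x * φ a y)) (m x) (m y))))
    bound : ∀ a → ∑ (λ f → c f * (∣ D a (u₁ f) ∣ * ∣ D a (v₁ f) ∣)) ≤ ĉ * (d * d)
    bound a = ≤-trans (∑-mono (λ f → *-mono (c≥0 f) (0≤∣p∣ (D a (u₁ f)) ⊗ 0≤∣p∣ (D a (v₁ f))) (c≤ĉ f) ≤-refl))
      (≤-trans (≤-reflexive (∑-* ĉ (λ f → ∣ D a (u₁ f) ∣ * ∣ D a (v₁ f) ∣))) (*-monoʳ ĉ≥0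
        (≤-trans (∑-pairs ends inj (λ x y → ∣ D a x ∣ * ∣ D a y ∣) (λ x y → 0≤∣p∣ (D a x) ⊗ 0≤∣p∣ (D a y)))
         (≤-trans (≤-reflexive (∑∑-* (λ x → ∣ D a x ∣))) (*-mono (∑-≥0 (λ x → 0≤∣p∣ (D a x))) d≥0 (D-sum a) (D-sum a))))))

  -- Martingale argument: the covariance is split over the coordinates, and coordinate e
  -- contributes at most ĉ (d e)², whatever the individual influences are.
  cov-bound : ∀ {A : Set} {m} (μ : Fin m → Expect A) (g : Vec A m → Fin n → ℚ) (d : Fin m → ℚ) → (∀ e → 0ℚ ≤ d e) →
    (∀ ω e a → ∑ (λ v → ∣ g ω v - g (ω [ e ]≔ a) v ∣) ≤ d e) →
    ∑ (λ f → c f * ∣ covariance (prod μ) g f ∣) ≤ ĉ * ∑ (λ e → d e * d e)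
  cov-bound {m = zero} μ g d d≥0 lip = ≤-reflexive
      (trans (∑-0 (λ f → trans (cong (c f *_) (abs-0 (+-inverseʳ (g [] (u₁ f) * g [] (v₁ f))))) (*-zeroʳ (c f)))) (sym (*-zeroʳ ĉ)))
  cov-bound {A} {suc m} μ g d d≥0 lip = ≤-trans (∑-mono split)
     (≤-trans (≤-reflexive (trans (∑-+ {M} _ _)
         (cong (_+ ∑ (λ f → c f * ∣ covariance μ₀ ḡ f ∣))
         (trans (∑-cong (λ f → sym (E-* μ₀ (c f) (λ a → ∣ cv a f ∣)))) (sym (E-∑ μ₀ (λ f a → c f * ∣ cv a f ∣)))))))
      (≤-trans (+-mono-≤ (E-≤c μ₀ IH) (cov-one μ₀ ḡ (d zero) (d≥0 zero) lip₀))
        (≤-reflexive (l ĉ (d zero) (∑ (λ e → d (suc e) * d (suc e)))))))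
    where
    μ₀ = μ zero
    ν = prod (λ e → μ (suc e))
    ḡ : A → Fin n → ℚ
    ḡ a v = E ν (λ as → g (a ∷ as) v)
    cv : A → Fin M → ℚ
    cv a f = covariance ν (λ as → g (a ∷ as)) f
    IH : ∀ a → ∑ (λ f → c f * ∣ cv a f ∣) ≤ ĉ * ∑ (λ e → d (suc e) * d (suc e))
    IH a = cov-bound (λ e → μ (suc e)) (λ as → g (a ∷ as)) (λ e → d (suc e)) (λ e → d≥0 (suc e)) (λ as e b → lip (a ∷ as) (suc e) b)
    lip₀ : ∀ a a' → ∑ (λ v → ∣ ḡ a v - ḡ a' v ∣) ≤ d zero
    lip₀ a a' = ≤-trans (∑-mono (λ v → ≤-trans (≤-reflexive (cong ∣_∣ (sym (E-− ν (λ as → g (a ∷ as) v) (λ as → g (a' ∷ as) v)))))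
        (E-abs ν (λ as → g (a ∷ as) v - g (a' ∷ as) v))))
      (≤-trans (≤-reflexive (sym (E-∑ ν (λ v as → ∣ g (a ∷ as) v - g (a' ∷ as) v ∣)))) (E-≤c ν (λ as → lip (a ∷ as) zero a')))
    l : ∀ c x s → c * s + c * (x * x) ≡ c * (x * x + s)
    l = solve-∀ ring
    split : ∀ f → c f * ∣ covariance (prod μ) g f ∣ ≤ c f * E μ₀ (λ a → ∣ cv a f ∣) + c f * ∣ covariance μ₀ ḡ f ∣
    split f = ≤-trans (*-monoʳ (c≥0 f) (≤-trans (≤-reflexive (cong ∣_∣ eq))
        (≤-trans (∣p+q∣≤∣p∣+∣q∣ (E μ₀ (λ a → cv a f)) (covariance μ₀ ḡ f))
        (+-monoˡ-≤ ∣ covariance μ₀ ḡ f ∣ (E-abs μ₀ (λ a → cv a f)))))) (≤-reflexive (*-distribˡ-+ (c f) _ _))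
      where
      l' : ∀ a b c → a - c ≡ (a - b) + (b - c)
      l' = solve-∀ ring
      -- The law of total covariance, conditioning on the first coordinate.
      eq : covariance (prod μ) g f ≡ E μ₀ (λ a → cv a f) + covariance μ₀ ḡ f
      eq = trans (l' (E (prod μ) (λ a → g a (u₁ f) * g a (v₁ f))) (E μ₀ (λ a → ḡ a (u₁ f) * ḡ a (v₁ f))) _)
        (cong (_+ covariance μ₀ ḡ f) (sym (E-− μ₀ (λ a → E ν (λ as → g (a ∷ as) (u₁ f) * g (a ∷ as) (v₁ f)))
            (λ a → ḡ a (u₁ f) * ḡ a (v₁ f)))))

-- The other coordinates are averaged out; the mean of `f` given coordinate `e` then stays within
-- `d` of its overall mean. This separates the realization of an edge from the survival of its two
-- ends.
cov-coordinate : ∀ {A : Set} {m} (μ : Fin m → Expect A) (h : A → ℚ) → (∀ a → 0ℚ ≤ h a) → (∀ a → h a ≤ 1ℚ) →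
  ∀ (f : Vec A m → ℚ) e d → (∀ ω a → ∣ f ω - f (ω [ e ]≔ a) ∣ ≤ d) →
  ∣ E (prod μ) (λ ω → h (lookup ω e) * f ω) - E (μ e) h * E (prod μ) f ∣ ≤ d
cov-coordinate {A} {suc m} μ h h≥0 h≤1 f zero d lip = ≤-trans (≤-reflexive (cong ∣_∣ eq))
    (≤-trans (E-abs μ₀ (λ a → h a * (φ a - w))) (E-≤c μ₀ le))
  where
  μ₀ = μ zero
  ν = prod (λ e → μ (suc e))
  φ : A → ℚ
  φ a = E ν (λ as → f (a ∷ as))
  w = E μ₀ φ
  lip₀ : ∀ a a' → ∣ φ a - φ a' ∣ ≤ d
  lip₀ a a' = ≤-trans (≤-reflexive (cong ∣_∣ (sym (E-− ν (λ as → f (a ∷ as)) (λ as → f (a' ∷ as))))))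
      (≤-trans (E-abs ν (λ as → f (a ∷ as) - f (a' ∷ as))) (E-≤c ν (λ as → lip (a ∷ as) a')))
  le : ∀ a → ∣ h a * (φ a - w) ∣ ≤ d
  le a = ≤-trans (≤-reflexive (abs-* (φ a - w) (h≥0 a))) (≤-trans (*-mono (h≥0 a) (0≤∣p∣ (φ a - w)) (h≤1 a) ≤-refl)
     (≤-trans (≤-reflexive (trans (*-identityˡ _)
         (cong ∣_∣ (sym (trans (E-− μ₀ (λ _ → φ a) φ) (cong (_- w) (E-const μ₀ (φ a))))))))
         (≤-trans (E-abs μ₀ (λ a' → φ a - φ a')) (E-≤c μ₀ (lip₀ a)))))
  ex : ∀ a b c → a * (b - c) ≡ a * b - a * c
  ex = solve-∀ ring
  eq : E (prod μ) (λ ω → h (lookup ω zero) * f ω) - E μ₀ h * w ≡ E μ₀ (λ a → h a * (φ a - w))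
  eq = sym (trans (E-cong μ₀ (λ a → ex (h a) (φ a) w)) (trans (E-− μ₀ (λ a → h a * φ a) (λ a → h a * w))
     (cong₂ _-_ (E-cong μ₀ (λ a → sym (E-* ν (h a) (λ as → f (a ∷ as))))) (E-*ʳ μ₀ h w))))
cov-coordinate {A} {suc m} μ h h≥0 h≤1 f (suc e) d lip = ≤-trans (≤-reflexive (cong ∣_∣ eq)) (≤-trans (E-abs μ₀ _) (E-≤c μ₀ (λ a →
    cov-coordinate (λ e → μ (suc e)) h h≥0 h≤1 (λ as → f (a ∷ as)) e d (λ as b → lip (a ∷ as) b))))
  where
  μ₀ = μ zero
  ν = prod (λ e → μ (suc e))
  eq : E (prod μ) (λ ω → h (lookup ω (suc e)) * f ω) - E (μ (suc e)) h * E (prod μ) f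
     ≡ E μ₀ (λ a → E ν (λ as → h (lookup as e) * f (a ∷ as)) - E (μ (suc e)) h * E ν (λ as → f (a ∷ as)))
  eq = sym (trans (E-− μ₀ (λ a → E ν (λ as → h (lookup as e) * f (a ∷ as))) (λ a → E (μ (suc e)) h * E ν (λ as → f (a ∷ as))))
     (cong (λ z → E (prod μ) (λ ω → h (lookup ω (suc e)) * f ω) - z) (E-* μ₀ (E (μ (suc e)) h) (λ a → E ν (λ as → f (a ∷ as))))))

E-coordinate : ∀ {A : Set} {m} (μ : Fin m → Expect A) (h : A → ℚ) e → E (prod μ) (λ ω → h (lookup ω e)) ≡ E (μ e) h
E-coordinate {m = suc m} μ h zero = E-cong (μ zero) (λ a → E-const (prod (λ e → μ (suc e))) (h a))
E-coordinate {m = suc m} μ h (suc e) = trans (E-cong (μ zero) (λ a → E-coordinate (λ e → μ (suc e)) h e)) (E-const (μ zero) _)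

-- Sums of independent copies

nat : ℕ → ℚ
nat zero = 0ℚ
nat (suc k) = 1ℚ + nat k

nat≥0 : ∀ k → 0ℚ ≤ nat k
nat≥0 zero = ≤-refl
nat≥0 (suc k) = 0≤1 ⊕ nat≥0 k

power : ∀ {A : Set} → Expect A → (k : ℕ) → Expect (Vec A k)
power μ k = prod {m = k} (λ _ → μ)

total : ∀ {A : Set} {k} → (A → ℚ) → Vec A k → ℚ
total φ [] = 0ℚ
total φ (a ∷ as) = φ a + total φ as

E-total : ∀ {A : Set} (μ : Expect A) k (φ : A → ℚ) → E (power μ k) (total φ) ≡ nat k * E μ φ
E-total μ zero φ = sym (*-zeroˡ (E μ φ))
E-total μ (suc k) φ = trans (E-cong μ (λ a → trans (E-+ ν (λ _ → φ a) (total φ)) (cong₂ _+_ (E-const ν (φ a)) (E-total μ k φ))))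
   (trans (E-+ μ φ (λ _ → nat k * E μ φ)) (trans (cong (E μ φ +_) (E-const μ (nat k * E μ φ))) (l (nat k) (E μ φ))))
  where
  ν = power μ k
  l : ∀ k x → x + k * x ≡ (1ℚ + k) * x
  l = solve-∀ ring

E-total² : ∀ {A : Set} (μ : Expect A) k (φ : A → ℚ) →
  E (power μ k) (λ as → total φ as * total φ as) ≡ nat k * E μ (λ a → φ a * φ a) + (nat k * nat k - nat k) * (E μ φ * E μ φ)
E-total² μ zero φ = sym (l (E μ (λ a → φ a * φ a)) (E μ φ * E μ φ))
  where
  l : ∀ a b → 0ℚ * a + (0ℚ * 0ℚ - 0ℚ) * b ≡ 0ℚ
  l = solve-∀ ring
E-total² μ (suc k) φ = trans (E-cong μ inner) (trans (E-+ μ (λ a → φ a * φ a) (λ a → 2ℚ * (nat k * m) * φ a + S₂))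
    (trans (cong (q +_) (trans (E-+ μ (λ a → 2ℚ * (nat k * m) * φ a) (λ _ → S₂)) (cong₂ _+_ (E-* μ (2ℚ * (nat k * m)) φ) (E-const μ S₂))))
      (l (nat k) m q)))
  where
  ν = power μ k
  m = E μ φ
  q = E μ (λ a → φ a * φ a)
  S₂ = nat k * q + (nat k * nat k - nat k) * (m * m)
  ex : ∀ x s → (x + s) * (x + s) ≡ x * x + (2ℚ * x * s + s * s)
  ex = solve-∀ ring
  l : ∀ k m q → q + (2ℚ * (k * m) * m + (k * q + (k * k - k) * (m * m))) ≡ (1ℚ + k) * q + ((1ℚ + k) * (1ℚ + k) - (1ℚ + k)) * (m * m)
  l = solve-∀ ring
  l' : ∀ x k m s → x * x + (2ℚ * x * (k * m) + s) ≡ x * x + (2ℚ * (k * m) * x + s)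
  l' = solve-∀ ring
  inner : ∀ a → E ν (λ as → (φ a + total φ as) * (φ a + total φ as)) ≡ φ a * φ a + (2ℚ * (nat k * m) * φ a + S₂)
  inner a = trans (E-cong ν (λ as → ex (φ a) (total φ as)))
      (trans (E-+ ν (λ _ → φ a * φ a) (λ as → 2ℚ * φ a * total φ as + total φ as * total φ as))
    (trans (cong₂ _+_ (E-const ν (φ a * φ a)) (trans (E-+ ν (λ as → 2ℚ * φ a * total φ as) (λ as → total φ as * total φ as))
       (cong₂ _+_ (trans (E-* ν (2ℚ * φ a) (total φ)) (cong (2ℚ * φ a *_) (E-total μ k φ))) (E-total² μ k φ))))
     (l' (φ a) (nat k) m S₂)))

-- Edge states with uniform integer noise

argmax : ∀ {k} (f : Fin (suc k) → ℚ) → Σ (Fin (suc k)) λ i → ∀ j → f j ≤ f i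
argmax {zero} f = zero , λ { zero → ≤-refl }
argmax {suc k} f with argmax (λ i → f (suc i))
... | i , h with ≤-total (f zero) (f (suc i))
... | inj₁ p = suc i , λ { zero → p ; (suc j) → h j }
... | inj₂ p = zero , λ { zero → ≤-refl ; (suc j) → ≤-trans (h j) p }

∑-const : ∀ {k} c → ∑ {k} (λ _ → c) ≡ nat k * c
∑-const {zero} c = sym (*-zeroˡ c)
∑-const {suc k} c = trans (cong (c +_) (∑-const {k} c)) (l (nat k) c)
  where
  l : ∀ k c → c + k * c ≡ (1ℚ + k) * c
  l = solve-∀ ring

nat-suc>0 : ∀ k → 0ℚ < nat (suc k)
nat-suc>0 k = <-≤-trans (positive⁻¹ 1ℚ) (≤-by (nat≥0 k) (l (nat k)))
  where
  l : ∀ k → 1ℚ + k - 1ℚ ≡ k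
  l = solve-∀ ring

-- The shift by one keeps the denominator positive for every `l`; it also means that `uniform l` has
-- `l + 1` values.
recip : ℕ → ℚ
recip l = inv (nat (suc l))

recip≥0 : ∀ l → 0ℚ ≤ recip l
recip≥0 l = inv-≥0 (nat-suc>0 l)

uniform : ∀ {A : Set} l → (ℕ → A) → Expect A
uniform l s = record
  { E = λ f → recip l * ∑ {suc l} (λ i → f (s (toℕ i)))
  ; E-+ = λ f g → trans (cong (recip l *_) (∑-+ {suc l} (λ i → f (s (toℕ i))) (λ i → g (s (toℕ i))))) (*-distribˡ-+ (recip l) _ _)
  ; E-* = λ c f → trans (cong (recip l *_) (∑-* {suc l} c (λ i → f (s (toℕ i))))) (swap* (recip l) c _)
  ; E-mono = λ h → *-monoʳ (recip≥0 l) (∑-mono {suc l} (λ i → h (s (toℕ i))))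
  ; E-one = trans (cong (recip l *_) (∑-const {suc l} 1ℚ)) (unit 1ℚ)
  ; E-attain = λ f → let i , h = argmax {l} (λ i → f (s (toℕ i))) in s (toℕ i) ,
      ≤-trans (*-monoʳ (recip≥0 l) (∑-mono {suc l} h))
          (≤-reflexive (trans (cong (recip l *_) (∑-const {suc l} (f (s (toℕ i))))) (unit (f (s (toℕ i)))))) }
  where
  swap* : ∀ a b c → a * (b * c) ≡ b * (a * c)
  swap* = solve-∀ ring
  l₁ : ∀ r k c → r * (k * c) ≡ (k * r) * c
  l₁ = solve-∀ ring
  unit : ∀ c → recip l * (nat (suc l) * c) ≡ c
  unit c = trans (l₁ (recip l) (nat (suc l)) c) (trans (cong (_* c) (inv-* (nat-suc>0 l))) (*-identityˡ c))

E-uniform-const : ∀ {A : Set} l (s : ℕ → A) (f : A → ℚ) c → (∀ k → c ≡ f (s k)) → c ≡ E (uniform l s) f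
E-uniform-const l s f c h = trans (sym (E-const (uniform l s) c)) (cong (recip l *_) (∑-cong {suc l} (λ i → h (toℕ i))))

-- nothing: the edge is not realized; just i: it is realized and carries the noise value i
State : Set
State = Maybe ℕ

coin : (p : ℚ) → 0ℚ ≤ p → p ≤ 1ℚ → ℕ → Expect State
coin p p≥0 p≤1 l = mix p p≥0 p≤1 (point nothing) (uniform l just)

-- Edges outside C and unrealized edges get weight 0, hence are never selected.
wt : Bool → ℚ → State → ℚ
wt true y (just i) = y + nat i
wt true y nothing = 0ℚ
wt false y a = 0ℚ

Wt : ∀ {m} → (Fin m → Bool) → Vec ℚ m → Vec State m → Vec ℚ m
Wt C [] [] = []
Wt C (y ∷ ys) (a ∷ ω) = wt (C zero) y a ∷ Wt (tl C) ys ω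

lookup-Wt : ∀ {m} (C : Fin m → Bool) y ω e → lookup (Wt C y ω) e ≡ wt (C e) (lookup y e) (lookup ω e)
lookup-Wt C (y ∷ ys) (a ∷ ω) zero = refl
lookup-Wt C (y ∷ ys) (a ∷ ω) (suc e) = lookup-Wt (tl C) ys ω e

Wt-update : ∀ {m} (C : Fin m → Bool) y ω e a → Wt C y (ω [ e ]≔ a) [ e ]≔ 0ℚ ≡ Wt C y ω [ e ]≔ 0ℚ
Wt-update C (y ∷ ys) (b ∷ ω) zero a = refl
Wt-update C (y ∷ ys) (b ∷ ω) (suc e) a = cong (wt (C zero) y b ∷_) (Wt-update (tl C) ys ω e a)

Wt-outside : ∀ {m} (C : Fin m → Bool) y ω e a → C e ≡ false → Wt C y (ω [ e ]≔ a) ≡ Wt C y ω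
Wt-outside C (y ∷ ys) (b ∷ ω) zero a h rewrite h = refl
Wt-outside C (y ∷ ys) (b ∷ ω) (suc e) a h = cong (wt (C zero) y b ∷_) (Wt-outside (tl C) ys ω e a h)

wt-positive : ∀ c y a → 0ℚ < wt c y a → c ≡ true × is-just a ≡ true
wt-positive true y (just i) h = refl , refl
wt-positive true y nothing h = ⊥-elim (<-irrefl refl h)
wt-positive false y a h = ⊥-elim (<-irrefl refl h)

telescope : ∀ k (h : ℕ → ℚ) → ∑ {k} (λ i → h (suc (toℕ i))) + h 0 ≡ ∑ {k} (λ i → h (toℕ i)) + h k
telescope zero h = refl
telescope (suc k) h = trans (l (h 1) _ (h 0)) (trans (cong (h 0 +_) (telescope k (λ i → h (suc i)))) (sym (+-assoc (h 0) _ _)))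
  where
  l : ∀ a s b → a + s + b ≡ b + (s + a)
  l = solve-∀ ring

coins : ∀ {m} (p : Fin m → ℚ) → (∀ e → 0ℚ ≤ p e) → (∀ e → p e ≤ 1ℚ) → ℕ → Expect (Vec State m)
coins p p≥0 p≤1 l = prod (λ e → coin (p e) (p≥0 e) (p≤1 e) l)

-- A unit step of the weight moves the window of the `l + 1` equally likely noise values by one. The
-- two averages share all terms except one at either end, and these lie between 0 and 1.
shift-one : ∀ p (p≥0 : 0ℚ ≤ p) (p≤1 : p ≤ 1ℚ) l b x (ψ : ℚ → ℚ) → (∀ t → 0ℚ ≤ ψ t) → (∀ t → ψ t ≤ 1ℚ) →
  ∣ E (coin p p≥0 p≤1 l) (λ a → ψ (wt b (x + 1ℚ) a)) - E (coin p p≥0 p≤1 l) (λ a → ψ (wt b x a)) ∣ ≤ recip l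
shift-one p p≥0 p≤1 l false x ψ ψ≥0 ψ≤1 = ≤-trans (≤-reflexive (abs-0 (+-inverseʳ (E (coin p p≥0 p≤1 l) (λ a → ψ 0ℚ))))) (recip≥0 l)
shift-one p p≥0 p≤1 l true x ψ ψ≥0 ψ≤1 = ≤-trans (≤-reflexive (trans (cong ∣_∣ eq) (abs-* (h (suc l) - h 0) (p≥0 ⊗ recip≥0 l))))
    (≤-trans (*-mono (p≥0 ⊗ recip≥0 l) 0≤1 (≤-trans (*-mono p≥0 (recip≥0 l) p≤1 ≤-refl)
        (≤-reflexive (*-identityˡ (recip l)))) diff≤1) (≤-reflexive (*-identityʳ (recip l))))
  where
  h : ℕ → ℚ
  h i = ψ (x + nat i)
  S₀ = ∑ {suc l} (λ i → h (toℕ i))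
  S₁ = ∑ {suc l} (λ i → h (suc (toℕ i)))
  diff≤1 : ∣ h (suc l) - h 0 ∣ ≤ 1ℚ
  diff≤1 = abs-≤ (≤-by (ψ≥0 (x + nat 0) ⊕ ≤-diff (ψ≤1 (x + nat (suc l)))) (l₁ (h (suc l)) (h 0)))
                 (≤-by (ψ≥0 (x + nat (suc l)) ⊕ ≤-diff (ψ≤1 (x + nat 0))) (l₂ (h (suc l)) (h 0)))
    where
    l₁ : ∀ a b → 1ℚ - (a - b) ≡ b + (1ℚ - a)
    l₁ = solve-∀ ring
    l₂ : ∀ a b → 1ℚ - (- (a - b)) ≡ a + (1ℚ - b)
    l₂ = solve-∀ ring
  q : ℚ
  q = ψ 0ℚ
  eq : (1ℚ - p) * q + p * (recip l * ∑ {suc l} (λ i → ψ ((x + 1ℚ) + nat (toℕ i)))) -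
      ((1ℚ - p) * q + p * (recip l * S₀)) ≡ p * recip l * (h (suc l) - h 0)
  eq = trans (cong (λ s → (1ℚ - p) * q + p * (recip l * s) - ((1ℚ - p) * q + p * (recip l * S₀)))
      (∑-cong {suc l} (λ i → cong ψ (+-assoc x 1ℚ (nat (toℕ i))))))
     (≡-by ((p * recip l) ⊙ zer (telescope (suc l) h)) (l₁ p q (recip l) S₁ S₀ (h (suc l)) (h 0)))
    where
    l₁ : ∀ p q r s t a b → (1ℚ - p) * q + p * (r * s) - ((1ℚ - p) * q + p * (r * t)) - p * r * (a - b) ≡ p * r * (s + b - (t + a))
    l₁ = solve-∀ ring

shift : ∀ {m} (p : Fin m → ℚ) (p≥0 : ∀ e → 0ℚ ≤ p e) (p≤1 : ∀ e → p e ≤ 1ℚ) l (C : Fin m → Bool) y e (ψ : Vec ℚ m → ℚ) →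
  (∀ t → 0ℚ ≤ ψ t) → (∀ t → ψ t ≤ 1ℚ) →
  ∣ E (coins p p≥0 p≤1 l) (λ ω → ψ (Wt C (y [ e ]≔ (lookup y e + 1ℚ)) ω)) - E (coins p p≥0 p≤1 l) (λ ω → ψ (Wt C y ω)) ∣ ≤ recip l
shift {suc m} p p≥0 p≤1 l C (y ∷ ys) zero ψ ψ≥0 ψ≤1 = shift-one (p zero) (p≥0 zero) (p≤1 zero) l (C zero) y
    ψ₀ (λ t → E-≥0 ν (λ ω → ψ≥0 (t ∷ Wt (tl C) ys ω))) (λ t → E-≤c ν (λ ω → ψ≤1 (t ∷ Wt (tl C) ys ω)))
  where
  ν : Expect (Vec State m)
  ν = coins (λ e → p (suc e)) (λ e → p≥0 (suc e)) (λ e → p≤1 (suc e)) l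
  ψ₀ : ℚ → ℚ
  ψ₀ t = E ν (λ ω → ψ (t ∷ Wt (tl C) ys ω))
shift {suc m} p p≥0 p≤1 l C (y ∷ ys) (suc e) ψ ψ≥0 ψ≤1 =
  ≤-trans (≤-reflexive (cong ∣_∣ (sym (E-− μ₀ F⁺ F)))) (≤-trans (E-abs μ₀ (λ a → F⁺ a - F a)) (E-≤c μ₀ IH))
  where
  μ₀ : Expect State
  μ₀ = coin (p zero) (p≥0 zero) (p≤1 zero) l
  ν : Expect (Vec State m)
  ν = coins (λ e → p (suc e)) (λ e → p≥0 (suc e)) (λ e → p≤1 (suc e)) l
  F⁺ F : State → ℚ
  F⁺ a = E ν (λ ω → ψ (wt (C zero) y a ∷ Wt (tl C) (ys [ e ]≔ (lookup ys e + 1ℚ)) ω))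
  F a = E ν (λ ω → ψ (wt (C zero) y a ∷ Wt (tl C) ys ω))
  IH : ∀ a → ∣ F⁺ a - F a ∣ ≤ recip l
  IH a = shift (λ e → p (suc e)) (λ e → p≥0 (suc e)) (λ e → p≤1 (suc e)) l (tl C) ys e (λ w → ψ (wt (C zero) y a ∷ w))
      (λ t → ψ≥0 (wt (C zero) y a ∷ t)) (λ t → ψ≤1 (wt (C zero) y a ∷ t))

-- Archimedean property and approximate local minima

+/1-suc : ∀ k → ℤ.+ suc k / 1 ≡ 1ℚ + ℤ.+ k / 1
+/1-suc k = toℚᵘ-injective (ℚᵘ.≃-trans (toℚᵘ-fromℚᵘ (ℚᵘ.mkℚᵘ (ℤ.+ suc k) 0))
  (ℚᵘ.≃-trans (ℚᵘ.*≡* (cong (ℤ._* ℤ.+ 1) (sym (cong (λ z → ℤ.+ 1 ℤ.+ z) (ℤ.*-identityʳ (ℤ.+ k))))))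
   (ℚᵘ.≃-sym (ℚᵘ.≃-trans (toℚᵘ-homo-+ 1ℚ (ℤ.+ k / 1)) (ℚᵘ.+-congʳ (toℚᵘ 1ℚ) (toℚᵘ-fromℚᵘ (ℚᵘ.mkℚᵘ (ℤ.+ k) 0)))))))

nat-/1 : ∀ k → nat k ≡ ℤ.+ k / 1
nat-/1 zero = refl
nat-/1 (suc k) = trans (cong (1ℚ +_) (nat-/1 k)) (sym (+/1-suc k))

archimedean : ∀ r → Σ ℕ λ k → r ≤ nat k
archimedean r@(mkℚ n d _) = ℤ.∣ n ∣ , subst (r ≤_) (sym (nat-/1 ℤ.∣ n ∣))
  (toℚᵘ-cancel-≤ (ℚᵘ.≤-respʳ-≃ (ℚᵘ.≃-sym (toℚᵘ-fromℚᵘ (ℚᵘ.mkℚᵘ (ℤ.+ ℤ.∣ n ∣) 0))) (ℚᵘ.*≤* (int n))))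
  where
  int : ∀ n → n ℤ.* ℤ.+ 1 ℤ.≤ ℤ.+ ℤ.∣ n ∣ ℤ.* ℤ.+ suc d
  int n@(ℤ.+ k) = subst₂ ℤ._≤_ (sym (ℤ.*-identityʳ n)) (ℤ.pos-* k (suc d)) (ℤ.+≤+ (ℕ.m≤m*n k (suc d)))
  int n@(ℤ.-[1+ k ]) = subst (ℤ._≤ ℤ.+ suc k ℤ.* ℤ.+ suc d) (sym (ℤ.*-identityʳ n)) ℤ.-≤+

-- The number `j` is fuel. A move is made when it lowers `Φ` by more than `η`, which maintains
-- `Φ y ≤ nat j * η`; when the fuel is spent, nonnegativity of `Φ` rules out another such move.
descent : ∀ {Y : Set} {k} (Φ : Y → ℚ) → (∀ y → 0ℚ ≤ Φ y) → (up down : Y → Fin k → Y) (η : ℚ) → 0ℚ ≤ η →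
  ∀ j y → Φ y ≤ nat j * η → Σ Y λ y → ∀ i → Φ y - η ≤ Φ (up y i) × Φ y - η ≤ Φ (down y i)
descent Φ Φ≥0 up down η η≥0 zero y h = y , λ i → stuck (up y i) , stuck (down y i)
  where
  l : ∀ f η → 0ℚ - (f - η) ≡ η + (0ℚ * η - f)
  l = solve-∀ ring
  stuck : ∀ z → Φ y - η ≤ Φ z
  stuck z = ≤-trans (≤-by (η≥0 ⊕ ≤-diff h) (l (Φ y) η)) (Φ≥0 z)
descent {Y} {k} Φ Φ≥0 up down η η≥0 (suc j) y h = go (all? good?)
  where
  Good : Fin k → Set
  Good i = Φ y - η ≤ Φ (up y i) × Φ y - η ≤ Φ (down y i)
  good? : ∀ i → Dec (Good i)
  good? i = (Φ y - η ≤? Φ (up y i)) ×-dec (Φ y - η ≤? Φ (down y i))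
  l : ∀ f η k → k * η - (f - η) ≡ (1ℚ + k) * η - f
  l = solve-∀ ring
  continue : ∀ z → ¬ (Φ y - η ≤ Φ z) → Σ Y λ y → ∀ i → Φ y - η ≤ Φ (up y i) × Φ y - η ≤ Φ (down y i)
  continue z lt = descent Φ Φ≥0 up down η η≥0 j z (≤-trans (≰⇒≥ lt) (≤-by (≤-diff h) (l (Φ y) η (nat j))))
  go : Dec (∀ i → Good i) → Σ Y λ y → ∀ i → Φ y - η ≤ Φ (up y i) × Φ y - η ≤ Φ (down y i)
  go (yes good) = y , good
  go (no bad) with ¬∀⟶∃¬ _ Good good? bad
  ... | i , lt with Φ y - η ≤? Φ (up y i)
  ... | no lt′ = continue (up y i) lt′
  ... | yes le = continue (down y i) (λ q → lt (le , q))

-- Random maximum weight matchings with prescribed edge probabilities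

full : ∀ n → VSet n
full n = replicate n true

-- The subgradient inequality for the convex function `val`: the matching that is optimal for `w'`
-- competes for `w`.
val-diff : ∀ {n m} (ends : Fin m → Pair n) → Loopless ends → ∀ w w' U →
  val ends w' U ≤ val ends w U + ∑ (λ f → ⟦ sel ends w' U f ⟧ * (lookup w' f - lookup w f))
val-diff {m = m} ends ll w w' U = ≤-trans (≤-reflexive (val-sum ends w' U))
    (≤-by (≤-diff (val-max ends ll w U (sel ends w' U) (sel-fits ends ll w' U)))
    (trans (cong (λ z → val ends w U + z - S')
        (trans (∑-cong (λ f → l (⟦ sel ends w' U f ⟧) (lookup w' f) (lookup w f)))
        (∑-− {m} (λ f → ⟦ sel ends w' U f ⟧ * lookup w' f) (λ f → ⟦ sel ends w' U f ⟧ * lookup w f))))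
      (l' (val ends w U) S' (∑ (λ f → ⟦ sel ends w' U f ⟧ * lookup w f)))))
  where
  S' = ∑ (λ f → ⟦ sel ends w' U f ⟧ * lookup w' f)
  l : ∀ s a b → s * (a - b) ≡ s * a - s * b
  l = solve-∀ ring
  l' : ∀ v s t → v + (s - t) - s ≡ v - t
  l' = solve-∀ ring

∑-only : ∀ {m} (d : Fin m → ℚ) e {c} → (∀ f → f ≢ e → d f ≡ 0ℚ) → d e ≤ c → ∑ d ≤ c
∑-only d e {c} h le = ≤-trans (≤-reflexive (trans (∑-cong tm) (∑-δ e d))) le
  where
  tm : ∀ f → d f ≡ δ f e * d f
  tm f with f ≟F e
  ... | yes _ = sym (*-identityˡ (d f))
  ... | no ne = trans (h f ne) (sym (*-zeroˡ (d f)))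

∑-bump : ∀ {m} (a : Fin m → ℚ) y e s → ∑ (λ f → a f * lookup (y [ e ]≔ (lookup y e + s)) f) ≡ ∑ (λ f → a f * lookup y f) + a e * s
∑-bump a y e s = trans (∑-cong tm) (trans (∑-+ (λ f → a f * lookup y f) (λ f → δ f e * (a f * s)))
    (cong (∑ (λ f → a f * lookup y f) +_) (∑-δ e (λ f → a f * s))))
  where
  tm : ∀ f → a f * lookup (y [ e ]≔ (lookup y e + s)) f ≡ a f * lookup y f + δ f e * (a f * s)
  tm f with f ≟F e
  ... | yes refl = trans (cong (a f *_) (lookup∘update e y (lookup y e + s))) (l₀ (a f) (lookup y f) s)
    where
    l₀ : ∀ a b s → a * (b + s) ≡ a * b + 1ℚ * (a * s)
    l₀ = solve-∀ ring
  ... | no ne = trans (cong (a f *_) (lookup∘update′ ne y (lookup y e + s))) (l₀ (a f) (lookup y f) s)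
    where
    l₀ : ∀ a b s → a * b ≡ a * b + 0ℚ * (a * s)
    l₀ = solve-∀ ring

record Model (n m : ℕ) : Set where
  field
    edges     : Fin m → Pair n
    loop-free : Loopless edges
    distinct  : Distinct edges
    p         : Fin m → ℚ
    p>0       : ∀ e → 0ℚ < p e
    p≤1       : ∀ e → p e ≤ 1ℚ
    q         : ℚ
    q≥0       : 0ℚ ≤ q
    1≤qp      : ∀ e → 1ℚ ≤ q * p e
    noise     : ℕ

  p≥0 : ∀ e → 0ℚ ≤ p e
  p≥0 e = <⇒≤ (p>0 e)

  Ω : Expect (Vec State m)
  Ω = coins p p≥0 p≤1 noise

record Selection {n m : ℕ} (M : Model n m) : Set where
  open Model M
  field
    S        : Vec State m → Fin m → Bool
    fits     : ∀ ω → Fits edges (full n) (S ω)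
    realized : ∀ ω e → S ω e ≡ true → is-just (lookup ω e) ≡ true
    maximal  : ∀ ω T → Fits edges (full n) T → (∀ e → T e ≡ true → is-just (lookup ω e) ≡ true) →
      ∑ (λ e → ⟦ T e ⟧) ≤ ∑ (λ e → ⟦ S ω e ⟧)

  x : Fin m → ℚ
  x e = E Ω (λ ω → ⟦ S ω e ⟧)

  opt : ℚ
  opt = ∑ x

  x≥0 : ∀ e → 0ℚ ≤ x e
  x≥0 e = E-≥0 Ω (λ ω → ⟦⟧≥0 (S ω e))

module Prescribed {n m : ℕ} (M : Model n m) (A : Selection M) (C : Fin m → Bool) where
  open Model M
  open Selection A

  private
    U : VSet n
    U = full n

  selW : Vec ℚ m → Vec State m → Fin m → Bool
  selW y ω = sel edges (Wt C y ω) U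

  private
    V : Vec ℚ m → ℚ
    V y = E Ω (λ ω → val edges (Wt C y ω) U)
    xy : Vec ℚ m → ℚ
    xy y = ∑ (λ e → ⟦ C e ⟧ * x e * lookup y e)
    Φ : Vec ℚ m → ℚ
    Φ y = V y - xy y

    wt-S : ∀ c y a b → (b ≡ true → is-just a ≡ true) → ⟦ b ⟧ * (⟦ c ⟧ * y) ≤ ⟦ b ∧ c ⟧ * wt c y a
    wt-S c y a false h = ≤-reflexive (trans (*-zeroˡ (⟦ c ⟧ * y)) (sym (*-zeroˡ (wt c y a))))
    wt-S false y a true h = ≤-reflexive (trans (*-identityˡ (0ℚ * y)) (trans (*-zeroˡ y) (sym (*-zeroˡ 0ℚ))))
    wt-S true y nothing true h with h refl
    ... | ()
    wt-S true y (just i) true h = ≤-by (nat≥0 i) (l₀ y (nat i))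
      where
      l₀ : ∀ y k → 1ℚ * (y + k) - 1ℚ * (1ℚ * y) ≡ k
      l₀ = solve-∀ ring

    -- The critical part of the fixed maximum matching is a competitor whose expected weight is
    -- `xy y` plus nonnegative noise.
    Φ≥0 : ∀ y → 0ℚ ≤ Φ y
    Φ≥0 y = ≤-diff (≤-trans (≤-reflexive eq) (E-mono Ω pointwise))
      where
      eq : xy y ≡ E Ω (λ ω → ∑ (λ e → ⟦ S ω e ⟧ * (⟦ C e ⟧ * lookup y e)))
      eq = sym (trans (E-∑ Ω (λ e ω → ⟦ S ω e ⟧ * (⟦ C e ⟧ * lookup y e)))
         (∑-cong (λ e → trans (E-*ʳ Ω (λ ω → ⟦ S ω e ⟧) (⟦ C e ⟧ * lookup y e)) (l₀ (x e) ⟦ C e ⟧ (lookup y e)))))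
        where
        l₀ : ∀ a b c → a * (b * c) ≡ b * a * c
        l₀ = solve-∀ ring
      fits' : ∀ ω → Fits edges U (λ e → S ω e ∧ C e)
      fits' ω v = ≤-trans (∑-mono (λ e → *-monoʳ (ι≥0 v (edges e)) (⟦⟧-mono (∧-conicalˡ (S ω e) (C e))))) (fits ω v)
      pointwise : ∀ ω → ∑ (λ e → ⟦ S ω e ⟧ * (⟦ C e ⟧ * lookup y e)) ≤ val edges (Wt C y ω) U
      pointwise ω = ≤-trans (∑-mono (λ e → subst (λ z → ⟦ S ω e ⟧ * (⟦ C e ⟧ * lookup y e) ≤ ⟦ S ω e ∧ C e ⟧ * z) (sym (lookup-Wt C y ω e))
           (wt-S (C e) (lookup y e) (lookup ω e) (S ω e) (realized ω e))))
         (val-max edges loop-free (Wt C y ω) U (λ e → S ω e ∧ C e) (fits' ω))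

    bump : ℚ → Vec ℚ m → Fin m → Vec ℚ m
    bump s y e = y [ e ]≔ (lookup y e + s)

    bump-self : ∀ s y e → lookup (bump s y e) e ≡ lookup y e + s
    bump-self s y e = lookup∘update e y (lookup y e + s)

    bump-back : ∀ y e → bump 1ℚ (bump (- 1ℚ) y e) e ≡ y
    bump-back y e = trans (cong ((bump (- 1ℚ) y e) [ e ]≔_) (trans (cong (_+ 1ℚ) (bump-self (- 1ℚ) y e)) (l₀ (lookup y e))))
        (trans ([]≔-idempotent y e) ([]≔-lookup y e))
      where
      l₀ : ∀ a → a + (- 1ℚ) + 1ℚ ≡ a
      l₀ = solve-∀ ring

    xy-bump : ∀ s y e → xy (bump s y e) ≡ xy y + ⟦ C e ⟧ * x e * s
    xy-bump s y e = ∑-bump (λ f → ⟦ C f ⟧ * x f) y e s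

    selProb : Vec ℚ m → Fin m → ℚ
    selProb y e = E Ω (λ ω → ⟦ selW y ω e ⟧)

    -- The subgradient inequality with only coordinate `e` changed, so the slope is the probability
    -- of selecting `e` at the bumped weights. For a downward step it matters that a selected edge
    -- is critical and realized, since only then does its weight follow `y`.
    V-bump : ∀ s y e → (∀ b a → (b ≡ true → C e ≡ true × is-just a ≡ true) → ⟦ b ⟧ *
        (wt (C e) (lookup y e + s) a - wt (C e) (lookup y e) a) ≤ s * ⟦ b ⟧) →
      V (bump s y e) ≤ V y + s * selProb (bump s y e) e
    V-bump s y e h = ≤-trans (E-mono Ω pointwise)
        (≤-reflexive (trans (E-+ Ω (λ ω → val edges (Wt C y ω) U) (λ ω → s * ⟦ selW y' ω e ⟧))
        (cong (V y +_) (E-* Ω s (λ ω → ⟦ selW y' ω e ⟧)))))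
      where
      y' = bump s y e
      pointwise : ∀ ω → val edges (Wt C y' ω) U ≤ val edges (Wt C y ω) U + s * ⟦ selW y' ω e ⟧
      pointwise ω = ≤-trans (val-diff edges loop-free (Wt C y ω) (Wt C y' ω) U) (+-monoʳ-≤ (val edges (Wt C y ω) U)
          (∑-only (λ f → ⟦ selW y' ω f ⟧ * (lookup (Wt C y' ω) f - lookup (Wt C y ω) f)) e other self))
        where
        need : ∀ f → selW y' ω f ≡ true → C f ≡ true × is-just (lookup ω f) ≡ true
        need f b = wt-positive (C f) (lookup y' f) (lookup ω f)
            (subst (0ℚ <_) (lookup-Wt C y' ω f) (positive (selected edges (Wt C y' ω) U f b)))
        other : ∀ f → f ≢ e → ⟦ selW y' ω f ⟧ * (lookup (Wt C y' ω) f - lookup (Wt C y ω) f) ≡ 0ℚ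
        other f ne = trans (cong (⟦ selW y' ω f ⟧ *_)
            (trans (cong₂ _-_ (trans (lookup-Wt C y' ω f)
            (cong (λ z → wt (C f) z (lookup ω f)) (lookup∘update′ ne y (lookup y e + s)))) (lookup-Wt C y ω f))
            (+-inverseʳ (wt (C f) (lookup y f) (lookup ω f)))))
                 (*-zeroʳ ⟦ selW y' ω f ⟧)
        self : ⟦ selW y' ω e ⟧ * (lookup (Wt C y' ω) e - lookup (Wt C y ω) e) ≤ s * ⟦ selW y' ω e ⟧
        self = subst (_≤ s * ⟦ selW y' ω e ⟧) (cong (⟦ selW y' ω e ⟧ *_)
            (cong₂ _-_ (trans (cong (λ z → wt (C e) z (lookup ω e)) (sym (bump-self s y e))) (sym (lookup-Wt C y' ω e)))
            (sym (lookup-Wt C y ω e))))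
                 (h (selW y' ω e) (lookup ω e) (need e))

    up-wt : ∀ c y b a → ⟦ b ⟧ * (wt c (y + 1ℚ) a - wt c y a) ≤ 1ℚ * ⟦ b ⟧
    up-wt c y b a = ≤-trans (*-monoʳ (⟦⟧≥0 b) (diff c a)) (≤-reflexive (*-comm ⟦ b ⟧ 1ℚ))
      where
      l₀ : ∀ y k → 1ℚ - (y + 1ℚ + k - (y + k)) ≡ 0ℚ
      l₀ = solve-∀ ring
      diff : ∀ c a → wt c (y + 1ℚ) a - wt c y a ≤ 1ℚ
      diff false a = 0≤1
      diff true nothing = 0≤1
      diff true (just i) = ≤-by ≤-refl (l₀ y (nat i))

    down-wt : ∀ c y b a → (b ≡ true → c ≡ true × is-just a ≡ true) → ⟦ b ⟧ * (wt c (y + (- 1ℚ)) a - wt c y a) ≤ (- 1ℚ) * ⟦ b ⟧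
    down-wt c y false a h = ≤-reflexive (trans (*-zeroˡ (wt c (y + (- 1ℚ)) a - wt c y a)) (sym (*-zeroʳ (- 1ℚ))))
    down-wt c y true a h with h refl
    down-wt true y true (just i) h | refl , j = ≤-by ≤-refl (l₀ y (nat i))
      where
      l₀ : ∀ y k → (- 1ℚ) * 1ℚ - 1ℚ * (y + (- 1ℚ) + k - (y + k)) ≡ 0ℚ
      l₀ = solve-∀ ring
    down-wt true y true nothing h | refl , ()

    η = recip noise

    start : Vec ℚ m
    start = replicate m 0ℚ

    -- Fuel for `descent`: at least `Φ start` divided by `η`.
    steps : Σ ℕ λ j → Φ start * nat (suc noise) ≤ nat j
    steps = archimedean (Φ start * nat (suc noise))

    start≤ : Φ start ≤ nat (proj₁ steps) * η
    start≤ = ≤-trans (≤-reflexive (sym (trans (*-assoc (Φ start) (nat (suc noise)) η)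
        (trans (cong (Φ start *_) (inv-* (nat-suc>0 noise))) (*-identityʳ (Φ start))))))
                       (*-mono (Φ≥0 start ⊗ nat≥0 (suc noise)) (recip≥0 noise) (proj₂ steps) ≤-refl)

    found : Σ (Vec ℚ m) λ y → ∀ e → Φ y - η ≤ Φ (bump 1ℚ y e) × Φ y - η ≤ Φ (bump (- 1ℚ) y e)
    found = descent Φ Φ≥0 (bump 1ℚ) (bump (- 1ℚ)) η (recip≥0 noise) (proj₁ steps) start start≤

  weights : Vec ℚ m
  weights = proj₁ found

  -- At an approximate local minimum of y ↦ E val - ∑ x y, moving the weight of e by one unit
  -- shows that e is selected with probability about x e, up to the shift of the noise.
  prescribed : ∀ e → C e ≡ true → ∣ E Ω (λ ω → ⟦ selW weights ω e ⟧) - x e ∣ ≤ 2ℚ * η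
  prescribed e Ce = abs-≤
     (≤-by (≤-diff vd ⊕ ≤-diff (proj₂ (proj₂ found e)) ⊕ ≤-diff sh-) (eq- (xy-bump (- 1ℚ) y e)))
     (≤-by (≤-diff vu ⊕ ≤-diff (proj₁ (proj₂ found e)) ⊕ ≤-diff sh+) (eq+ (xy-bump 1ℚ y e)))
    where
    y = weights
    y⁺ = bump 1ℚ y e
    y⁻ = bump (- 1ℚ) y e
    P = selProb y e
    P⁺ = selProb y⁺ e
    P⁻ = selProb y⁻ e
    -- With local minimality the upward step gives `x e ≤ P⁺ + η` and the downward step
    -- `P⁻ ≤ x e + η`. The noise replaces `P⁺` and `P⁻` by `P` at a further cost of `η` each.
    vu : V y⁺ ≤ V y + 1ℚ * P⁺
    vu = V-bump 1ℚ y e (λ b a _ → up-wt (C e) (lookup y e) b a)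
    vd : V y⁻ ≤ V y + (- 1ℚ) * P⁻
    vd = V-bump (- 1ℚ) y e (λ b a h → down-wt (C e) (lookup y e) b a h)
    ψ : Vec ℚ m → ℚ
    ψ w = ⟦ sel edges w U e ⟧
    sh+ : P⁺ - P ≤ η
    sh+ = ≤-trans (≤-abs (P⁺ - P)) (shift p p≥0 p≤1 noise C y e ψ (λ w → ⟦⟧≥0 (sel edges w U e)) (λ w → ⟦⟧≤1 (sel edges w U e)))
    sh- : P - P⁻ ≤ η
    sh- = ≤-trans (≤-abs (P - P⁻)) (subst (λ z → ∣ selProb z e - P⁻ ∣ ≤ η) (bump-back y e)
        (shift p p≥0 p≤1 noise C y⁻ e ψ (λ w → ⟦⟧≥0 (sel edges w U e)) (λ w → ⟦⟧≤1 (sel edges w U e))))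
    eq+ : xy y⁺ ≡ xy y + ⟦ C e ⟧ * x e * 1ℚ → 2ℚ * η - (- (P - x e)) ≡ (V y + 1ℚ * P⁺ - V y⁺) + ((Φ y⁺ - (Φ y - η)) + (η - (P⁺ - P)))
    eq+ h = ≡-by (zer h ⊞ x e ⊙ zer (cong ⟦_⟧ Ce)) (l₀ P (x e) η (V y) P⁺ (V y⁺) (xy y⁺) (xy y) ⟦ C e ⟧)
      where
      l₀ : ∀ P x η v P⁺ v⁺ a b c → 2ℚ * η - (- (P - x)) - ((v + 1ℚ * P⁺ - v⁺) + ((v⁺ - a - (v - b - η)) + (η - (P⁺ - P))))
         ≡ (a - (b + c * x * 1ℚ)) + x * (c - 1ℚ)
      l₀ = solve-∀ ring
    eq- : xy y⁻ ≡ xy y + ⟦ C e ⟧ * x e * (- 1ℚ) → 2ℚ * η - (P - x e) ≡ (V y + (- 1ℚ) * P⁻ - V y⁻) + ((Φ y⁻ - (Φ y - η)) + (η - (P - P⁻)))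
    eq- h = ≡-by (zer h ⊞ (- x e) ⊙ zer (cong ⟦_⟧ Ce)) (l₀ P (x e) η (V y) P⁻ (V y⁻) (xy y⁻) (xy y) ⟦ C e ⟧)
      where
      l₀ : ∀ P x η v P⁺ v⁺ a b c → 2ℚ * η - (P - x) - ((v + (- 1ℚ) * P⁺ - v⁺) + ((v⁺ - a - (v - b - η)) + (η - (P - P⁺))))
         ≡ (a - (b + c * x * (- 1ℚ))) + (- x) * (c - 1ℚ)
      l₀ = solve-∀ ring

-- Gibbs matchings on the vertices left uncovered

kt : ℚ → State → ℚ
kt κ nothing = 0ℚ
kt κ (just _) = κ

Kt : ∀ {m} → (Fin m → ℚ) → Vec State m → Vec ℚ m
Kt κ [] = []
Kt κ (a ∷ ω) = kt (κ zero) a ∷ Kt (tl κ) ω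

lookup-Kt : ∀ {m} (κ : Fin m → ℚ) ω e → lookup (Kt κ ω) e ≡ kt (κ e) (lookup ω e)
lookup-Kt κ (a ∷ ω) zero = refl
lookup-Kt κ (a ∷ ω) (suc e) = lookup-Kt (tl κ) ω e

Kt-update : ∀ {m} (κ : Fin m → ℚ) ω e a → Kt κ (ω [ e ]≔ a) [ e ]≔ 0ℚ ≡ Kt κ ω [ e ]≔ 0ℚ
Kt-update κ (b ∷ ω) zero a = refl
Kt-update κ (b ∷ ω) (suc e) a = cong (kt (κ zero) b ∷_) (Kt-update (tl κ) ω e a)

kt-0 : ∀ {κ} a → κ ≡ 0ℚ → kt κ a ≡ 0ℚ
kt-0 nothing h = refl
kt-0 (just _) h = h

Kt-outside : ∀ {m} (κ : Fin m → ℚ) ω e a → κ e ≡ 0ℚ → Kt κ (ω [ e ]≔ a) ≡ Kt κ ω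
Kt-outside κ (b ∷ ω) zero a h = cong (_∷ Kt (tl κ) ω) (trans (kt-0 a h) (sym (kt-0 b h)))
Kt-outside κ (b ∷ ω) (suc e) a h = cong (kt (κ zero) b ∷_) (Kt-outside (tl κ) ω e a h)

kt-split : ∀ κ a → kt κ a ≡ κ * ⟦ is-just a ⟧
kt-split κ nothing = sym (*-zeroʳ κ)
kt-split κ (just _) = sym (*-identityʳ κ)

E-coin : ∀ p p≥0 p≤1 l → E (coin p p≥0 p≤1 l) (λ a → ⟦ is-just a ⟧) ≡ p
E-coin p p≥0 p≤1 l = trans (cong (λ z → (1ℚ - p) * 0ℚ + p * z) (E-one (uniform l just))) (l₀ p)
  where
  l₀ : ∀ p → (1ℚ - p) * 0ℚ + p * 1ℚ ≡ p
  l₀ = solve-∀ ring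

∑-ι : ∀ {n} (p : Pair n) (f : Fin n → ℚ) → ∑ (λ v → ι v p * f v) ≡ f (proj₁ p) + f (proj₂ p)
∑-ι (a , b) f = trans (∑-cong (λ v → *-distribʳ-+ (f v) (δ v a) (δ v b)))
  (trans (∑-+ (λ v → δ v a * f v) (λ v → δ v b * f v)) (cong₂ _+_ (∑-δ a f) (∑-δ b f)))

∑∑-ι : ∀ {n m} (ends : Fin m → Pair n) (f : Fin n → ℚ) (c : Fin m → ℚ) →
  ∑ (λ v → f v * ∑ (λ e → ι v (ends e) * c e)) ≡ ∑ (λ e → (f (proj₁ (ends e)) + f (proj₂ (ends e))) * c e)
∑∑-ι {n} {m} ends f c = trans (∑-cong (λ v → trans (sym (∑-* (f v) (λ e → ι v (ends e) * c e)))
    (∑-cong (λ e → l₀ (f v) (ι v (ends e)) (c e)))))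
   (trans (∑-swap {n} {m} (λ v e → ι v (ends e) * f v * c e))
       (∑-cong (λ e → trans (∑-*ʳ (λ v → ι v (ends e) * f v) (c e)) (cong (_* c e) (∑-ι (ends e) f)))))
  where
  l₀ : ∀ f i c → f * (i * c) ≡ i * f * c
  l₀ = solve-∀ ring

E-realized : ∀ {n m} (M : Model n m) e → E (Model.Ω M) (λ ω → ⟦ is-just (lookup ω e) ⟧) ≡ Model.p M e
E-realized M e = trans (E-coordinate (λ e → coin (p e) (p≥0 e) (p≤1 e) noise) (λ a → ⟦ is-just a ⟧) e) (E-coin (p e) (p≥0 e) (p≤1 e) noise)
  where open Model M

-- `C` holds the critical edges and `H` the sampled ones; `r` stands for 1/K, and `σ` is the
-- tightness threshold 1/s. The bound `2σ≤1` makes a tight vertex matched with probability at least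
-- one half.
record Scheme (m : ℕ) : Set where
  field
    C H       : Fin m → Bool
    disj      : ∀ e → C e ≡ true → H e ≡ false
    y         : Vec ℚ m
    r s σ     : ℚ
    r≥0       : 0ℚ ≤ r
    s≥0       : 0ℚ ≤ s
    σ≥0       : 0ℚ ≤ σ
    sσ        : s * σ ≡ 1ℚ
    2σ≤1      : 2ℚ * σ ≤ 1ℚ

-- Edge probabilities of the two-step matching

module Rounding {n m : ℕ} (M : Model n m) (A : Scheme m) where
  open Model M
  open Scheme A
  open Gibbs edges loop-free

  W : Vec State m → Vec ℚ m
  W ω = Wt C y ω

  selC : Vec State m → Fin m → Bool
  selC ω = sel edges (W ω) (full n)

  U : Vec State m → VSet n
  U ω = unc edges (W ω) (full n)

  -- Dividing by `p e` compensates for unrealized edges, so that the mean weight is the same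
  -- `s * s * r` on every sampled edge (`κp`).
  κ : Fin m → ℚ
  κ e = s * s * r * inv (p e) * ⟦ H e ⟧

  κ̂ : ℚ
  κ̂ = s * s * r * q

  x' : Fin m → ℚ
  x' e = r * ⟦ H e ⟧

  κ≥0 : ∀ e → 0ℚ ≤ κ e
  κ≥0 e = (((s≥0 ⊗ s≥0) ⊗ r≥0) ⊗ inv-≥0 (p>0 e)) ⊗ ⟦⟧≥0 (H e)

  κ̂≥0 : 0ℚ ≤ κ̂
  κ̂≥0 = ((s≥0 ⊗ s≥0) ⊗ r≥0) ⊗ q≥0

  κ≤ : ∀ e → κ e ≤ κ̂ * ⟦ H e ⟧
  κ≤ e = *-mono (((s≥0 ⊗ s≥0) ⊗ r≥0) ⊗ inv-≥0 (p>0 e)) (⟦⟧≥0 (H e)) (*-monoʳ ((s≥0 ⊗ s≥0) ⊗ r≥0) (inv-≤ (p>0 e) (1≤qp e))) ≤-refl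

  κ≤κ̂ : ∀ e → κ e ≤ κ̂
  κ≤κ̂ e = ≤-trans (κ≤ e) (≤-trans (*-monoʳ κ̂≥0 (⟦⟧≤1 (H e))) (≤-reflexive (*-identityʳ κ̂)))

  κp : ∀ e → κ e * p e ≡ s * s * x' e
  κp e = ≡-by ((s * s * r * ⟦ H e ⟧) ⊙ zer (inv-* (p>0 e))) (l₀ s r (inv (p e)) ⟦ H e ⟧ (p e))
    where
    l₀ : ∀ s r i h p → s * s * r * i * h * p - s * s * (r * h) ≡ s * s * r * h * (p * i - 1ℚ)
    l₀ = solve-∀ ring

  κ-off : ∀ e → H e ≡ false → κ e ≡ 0ℚ
  κ-off e h = trans (cong (λ b → s * s * r * inv (p e) * ⟦ b ⟧) h) (*-zeroʳ (s * s * r * inv (p e)))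

  k : Vec State m → Vec ℚ m
  k ω = Kt κ ω

  k≥0 : ∀ ω → Nonneg (k ω)
  k≥0 ω e = subst (0ℚ ≤_) (sym (lookup-Kt κ ω e)) (go (lookup ω e))
    where
    go : ∀ a → 0ℚ ≤ kt (κ e) a
    go nothing = ≤-refl
    go (just _) = κ≥0 e

  k≤κ : ∀ ω e → lookup (k ω) e ≤ κ e
  k≤κ ω e = subst (_≤ κ e) (sym (lookup-Kt κ ω e)) (go (lookup ω e))
    where
    go : ∀ a → kt (κ e) a ≤ κ e
    go nothing = κ≥0 e
    go (just _) = ≤-refl

  gω : Vec State m → Fin n → ℚ
  gω ω v = g (k ω) (U ω) v

  Jω : Vec State m → Fin m → ℚ
  Jω ω e = J (k ω) (U ω) (edges e)

  R : Vec State m → Fin m → ℚ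
  R ω e = ⟦ is-just (lookup ω e) ⟧

  b rr : Fin n → ℚ
  b v = E Ω (λ ω → u (U ω) v)
  rr v = E Ω (λ ω → gω ω v)

  Pω : Vec State m → Fin m → ℚ
  Pω ω e = lookup (k ω) e * Jω ω e

  Pe : Fin m → ℚ
  Pe e = E Ω (λ ω → Pω ω e)

  -- A bound on the influence of the state of `e` on all survival probabilities together. A change
  -- of state passes through weight 0, in two moves; each costs 2 if `e` is critical (`dist-unc`)
  -- and `2ℚ * κ e` otherwise (`g-change`).
  d : Fin m → ℚ
  d e = 2ℚ * 2ℚ * (⟦ C e ⟧ + κ e)

  2≥0 : 0ℚ ≤ 2ℚ
  2≥0 = 0≤1 ⊕ 0≤1

  d≥0 : ∀ e → 0ℚ ≤ d e
  d≥0 e = (2≥0 ⊗ 2≥0) ⊗ (⟦⟧≥0 (C e) ⊕ κ≥0 e)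

  lip : ∀ ω e a → ∑ (λ v → ∣ gω ω v - gω (ω [ e ]≔ a) v ∣) ≤ d e
  lip ω e a = go (C e) refl
    where
    ω' = ω [ e ]≔ a
    go : ∀ c → C e ≡ c → ∑ (λ v → ∣ gω ω v - gω ω' v ∣) ≤ d e
    go true h = ≤-trans (≤-reflexive (∑-cong (λ v → cong (λ K → ∣ gω ω v - g K (U ω') v ∣) (Kt-outside κ ω e a κ0))))
       (≤-trans (dist-tri (k ω) (k≥0 ω) (U ω) X (U ω')) (≤-trans (+-mono-≤
         (subst (_≤ 2ℚ) (dist-sym (k ω) (k≥0 ω) X (U ω)) (dist-unc edges loop-free (k ω) (k≥0 ω) edges loop-free (W ω) e (full n)))
         (subst (λ Y → dist (k ω) (k≥0 ω) (unc edges Y (full n)) (U ω') ≤ 2ℚ) (Wt-update C y ω e a)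
             (dist-unc edges loop-free (k ω) (k≥0 ω) edges loop-free (W ω') e (full n))))
        (≤-reflexive (trans (l₀ (κ e)) (trans (cong₂ (λ c z → 2ℚ * 2ℚ * (⟦ c ⟧ + κ e - z)) (sym h) κ0) (l₁ ⟦ C e ⟧ (κ e)))))))
      where
      X = unc edges (W ω [ e ]≔ 0ℚ) (full n)
      κ0 : κ e ≡ 0ℚ
      κ0 = κ-off e (disj e h)
      l₀ : ∀ z → 2ℚ + 2ℚ ≡ 2ℚ * 2ℚ * (1ℚ + z - z)
      l₀ = solve-∀ ring
      l₁ : ∀ c z → 2ℚ * 2ℚ * (c + z - 0ℚ) ≡ 2ℚ * 2ℚ * (c + z)
      l₁ = solve-∀ ring
    go false h = ≤-trans (≤-reflexive (∑-cong (λ v → cong (λ w → ∣ gω ω v - g (k ω') (unc edges w (full n)) v ∣) (Wt-outside C y ω e a h))))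
       (≤-trans (∑-mono (λ v → abs-tri (g (k ω) (U ω) v) (g k° (U ω) v) (g (k ω') (U ω) v)))
       (≤-trans (≤-reflexive (∑-+ (λ v → ∣ g (k ω) (U ω) v - g k° (U ω) v ∣) (λ v → ∣ g k° (U ω) v - g (k ω') (U ω) v ∣)))
       (≤-trans (+-mono-≤ (≤-trans (GibbsChange.g-change edges loop-free (k ω) (k≥0 ω) e (U ω)) (*-monoʳ 2≥0 (k≤κ ω e)))
           (≤-trans (≤-reflexive (∑-cong (λ v → trans (cong (λ K → ∣ g K (U ω) v - g (k ω') (U ω) v ∣) (sym (Kt-update κ ω e a)))
               (abs-sym (g (k ω' [ e ]≔ 0ℚ) (U ω) v) (g (k ω') (U ω) v)))))
              (≤-trans (GibbsChange.g-change edges loop-free (k ω') (k≥0 ω') e (U ω)) (*-monoʳ 2≥0 (k≤κ ω' e)))))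
        (≤-reflexive (trans (l₀ (κ e)) (cong (λ c → 2ℚ * 2ℚ * (⟦ c ⟧ + κ e)) (sym h)))))))
      where
      k° = k ω [ e ]≔ 0ℚ
      l₀ : ∀ z → 2ℚ * z + 2ℚ * z ≡ 2ℚ * 2ℚ * (0ℚ + z)
      l₀ = solve-∀ ring

  lip-J : ∀ ω e a → C e ≡ false → ∣ Jω ω e - Jω (ω [ e ]≔ a) e ∣ ≤ 2ℚ * κ e
  lip-J ω e a h = ≤-trans (≤-reflexive (cong (λ w → ∣ Jω ω e - J (k ω') (unc edges w (full n)) (edges e) ∣) (Wt-outside C y ω e a h)))
     (≤-trans (abs-tri (Jω ω e) (J k° (U ω) (edges e)) (J (k ω') (U ω) (edges e)))
      (≤-trans (+-mono-≤ (≤-trans (≤-reflexive (abs-sym (Jω ω e) (J k° (U ω) (edges e))))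
          (≤-trans (GibbsChange.J-change edges loop-free (k ω) (k≥0 ω) e (U ω)) (k≤κ ω e)))
         (≤-trans (≤-reflexive (cong (λ K → ∣ J K (U ω) (edges e) - J (k ω') (U ω) (edges e) ∣) (sym (Kt-update κ ω e a))))
            (≤-trans (GibbsChange.J-change edges loop-free (k ω') (k≥0 ω') e (U ω)) (k≤κ ω' e)))) (≤-reflexive (l₀ (κ e)))))
    where
    ω' = ω [ e ]≔ a
    k° = k ω [ e ]≔ 0ℚ
    l₀ : ∀ z → z + z ≡ 2ℚ * z
    l₀ = solve-∀ ring

  cardC cardH : ℚ
  cardC = ∑ (λ e → ⟦ C e ⟧)
  cardH = ∑ (λ e → ⟦ H e ⟧)

  EJ ERJ Egg : Fin m → ℚ
  EJ e = E Ω (λ ω → Jω ω e)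
  ERJ e = E Ω (λ ω → R ω e * Jω ω e)
  Egg e = E Ω (λ ω → gω ω (proj₁ (edges e)) * gω ω (proj₂ (edges e)))

  rru rrv : Fin m → ℚ
  rru e = rr (proj₁ (edges e))
  rrv e = rr (proj₂ (edges e))

  -- Three decouplings lead from `Pe` to its mean field value: the realization of `e` from the
  -- survival of its ends, the two ends from each other in a fixed state, and their survival
  -- probabilities across the random states.
  err₁ err₂ err₃ err : Fin m → ℚ
  err₁ e = κ e * ∣ ERJ e - p e * EJ e ∣
  err₂ e = κ e * p e * ∣ EJ e - Egg e ∣
  err₃ e = κ e * p e * ∣ Egg e - rru e * rrv e ∣
  err e = err₁ e + (err₂ e + err₃ e)

  Pe-split : ∀ e → Pe e ≡ κ e * ERJ e
  Pe-split e = trans (E-cong Ω (λ ω → trans (cong (_* Jω ω e) (trans (lookup-Kt κ ω e) (kt-split (κ e) (lookup ω e))))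
      (*-assoc (κ e) (R ω e) (Jω ω e))))
     (E-* Ω (κ e) (λ ω → R ω e * Jω ω e))

  mean-field : ∀ e → ∣ Pe e - s * s * x' e * (rru e * rrv e) ∣ ≤ err e
  mean-field e = ≤-trans (≤-reflexive (cong ∣_∣ eq)) (≤-trans (∣p+q∣≤∣p∣+∣q∣ (κ e * (ERJ e - p e * EJ e)) _)
     (+-mono-≤ (≤-reflexive (abs-* (ERJ e - p e * EJ e) (κ≥0 e))) (≤-trans (∣p+q∣≤∣p∣+∣q∣ (κ e * p e * (EJ e - Egg e)) _)
       (+-mono-≤ (≤-reflexive (abs-* (EJ e - Egg e) (κ≥0 e ⊗ p≥0 e))) (≤-reflexive (abs-* (Egg e - rru e * rrv e) (κ≥0 e ⊗ p≥0 e)))))))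
    where
    l₀ : ∀ κ p a j g t → κ * a - κ * p * t ≡ κ * (a - p * j) + (κ * p * (j - g) + κ * p * (g - t))
    l₀ = solve-∀ ring
    eq : Pe e - s * s * x' e * (rru e * rrv e) ≡ κ e * (ERJ e - p e * EJ e) +
        (κ e * p e * (EJ e - Egg e) + κ e * p e * (Egg e - rru e * rrv e))
    eq = trans (cong₂ (λ a c → a - c * (rru e * rrv e)) (Pe-split e) (sym (κp e))) (l₀ (κ e) (p e) (ERJ e) (EJ e) (Egg e) (rru e * rrv e))

  κ² : ∀ e → κ e * κ e ≤ κ̂ * κ̂ * ⟦ H e ⟧
  κ² e = ≤-trans (*-mono (κ≥0 e) (κ̂≥0 ⊗ ⟦⟧≥0 (H e)) (κ≤κ̂ e) (κ≤ e)) (≤-reflexive (sym (*-assoc κ̂ κ̂ ⟦ H e ⟧)))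

  err₁≤ : ∑ err₁ ≤ 2ℚ * (κ̂ * κ̂ * cardH)
  err₁≤ = ≤-trans (∑-mono (λ e → ≤-trans (one e) (*-monoʳ 2≥0 (κ² e))))
      (≤-reflexive (trans (∑-* 2ℚ (λ e → κ̂ * κ̂ * ⟦ H e ⟧)) (cong (2ℚ *_) (∑-* (κ̂ * κ̂) (λ e → ⟦ H e ⟧)))))
    where
    l₀ : ∀ z → z * (2ℚ * z) ≡ 2ℚ * (z * z)
    l₀ = solve-∀ ring
    one : ∀ e → err₁ e ≤ 2ℚ * (κ e * κ e)
    one e = go (H e) (C e) refl refl
      where
      go : ∀ h c → H e ≡ h → C e ≡ c → err₁ e ≤ 2ℚ * (κ e * κ e)
      go false c hH hC = ≤-trans (≤-reflexive (trans (cong (_* ∣ ERJ e - p e * EJ e ∣) (κ-off e hH))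
          (*-zeroˡ ∣ ERJ e - p e * EJ e ∣))) (2≥0 ⊗ κ≥0 e ⊗ κ≥0 e)
      go true true hH hC = ⊥-elim (false≢true (trans (sym (disj e hC)) hH))
      go true false hH hC = ≤-trans (*-monoʳ (κ≥0 e)
          (≤-trans (≤-reflexive (cong (λ z → ∣ ERJ e - z * EJ e ∣) (sym (E-coin (p e) (p≥0 e) (p≤1 e) noise))))
           (cov-coordinate (λ e → coin (p e) (p≥0 e) (p≤1 e) noise) (λ a → ⟦ is-just a ⟧) (λ a → ⟦⟧≥0 (is-just a))
               (λ a → ⟦⟧≤1 (is-just a)) (λ ω → Jω ω e) e (2ℚ * κ e) (λ ω a → lip-J ω e a hC))))
         (≤-reflexive (l₀ (κ e)))

  err₂≤ : ∑ err₂ ≤ κ̂ * ∑ (λ v → b v - rr v)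
  err₂≤ = ≤-trans (∑-mono (λ e → *-mono (κ≥0 e ⊗ p≥0 e) (E-≥0 Ω (λ ω → 0≤∣p∣ (D ω e))) (κp≤ e)
      (≤-trans (≤-reflexive (cong ∣_∣ (sym (E-− Ω (λ ω → Jω ω e) (λ ω → gω ω (proj₁ (edges e)) * gω ω (proj₂ (edges e)))))))
      (E-abs Ω (λ ω → D ω e)))))
    (≤-trans (≤-reflexive (trans (∑-* κ̂ (λ e → E Ω (λ ω → ∣ D ω e ∣))) (cong (κ̂ *_) (sym (E-∑ Ω (λ e ω → ∣ D ω e ∣))))))
     (*-monoʳ κ̂≥0 (≤-trans (E-mono Ω (λ ω → pair-correlation (k ω) (k≥0 ω) distinct (U ω)))
       (≤-reflexive (trans (E-∑ Ω (λ v ω → u (U ω) v - gω ω v)) (∑-cong (λ v → E-− Ω (λ ω → u (U ω) v) (λ ω → gω ω v))))))))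
    where
    D : Vec State m → Fin m → ℚ
    D ω e = Jω ω e - gω ω (proj₁ (edges e)) * gω ω (proj₂ (edges e))
    κp≤ : ∀ e → κ e * p e ≤ κ̂
    κp≤ e = ≤-trans (*-mono (κ≥0 e) 0≤1 (κ≤κ̂ e) (p≤1 e)) (≤-reflexive (*-identityʳ κ̂))

  -- This is `cov-bound` with the influences `d`. Since no edge is both critical and sampled, the
  -- square of `d e` has no cross term.
  err₃≤ : ∑ err₃ ≤ κ̂ * (2ℚ * 2ℚ * (2ℚ * 2ℚ) * (cardC + κ̂ * κ̂ * cardH))
  err₃≤ = ≤-trans (cov-bound edges distinct (λ e → κ e * p e) (λ e → κ≥0 e ⊗ p≥0 e) κ̂ κ̂≥0 κp≤
      (λ e → coin (p e) (p≥0 e) (p≤1 e) noise) gω d d≥0 lip)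
      (*-monoʳ κ̂≥0 (≤-trans (∑-mono sq) (≤-reflexive (trans (∑-* (2ℚ * 2ℚ * (2ℚ * 2ℚ)) (λ e → ⟦ C e ⟧ + κ̂ * κ̂ * ⟦ H e ⟧))
        (cong (2ℚ * 2ℚ * (2ℚ * 2ℚ) *_) (trans (∑-+ (λ e → ⟦ C e ⟧) (λ e → κ̂ * κ̂ * ⟦ H e ⟧))
            (cong (cardC +_) (∑-* (κ̂ * κ̂) (λ e → ⟦ H e ⟧)))))))))
    where
    κp≤ : ∀ e → κ e * p e ≤ κ̂
    κp≤ e = ≤-trans (*-mono (κ≥0 e) 0≤1 (κ≤κ̂ e) (p≤1 e)) (≤-reflexive (*-identityʳ κ̂))
    cκ : ∀ e → ⟦ C e ⟧ * κ e ≡ 0ℚ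
    cκ e = go (C e) refl
      where
      go : ∀ c → C e ≡ c → ⟦ c ⟧ * κ e ≡ 0ℚ
      go true h = trans (*-identityˡ (κ e)) (κ-off e (disj e h))
      go false h = *-zeroˡ (κ e)
    sq : ∀ e → d e * d e ≤ 2ℚ * 2ℚ * (2ℚ * 2ℚ) * (⟦ C e ⟧ + κ̂ * κ̂ * ⟦ H e ⟧)
    sq e = ≤-by (((2≥0 ⊗ 2≥0) ⊗ (2≥0 ⊗ 2≥0)) ⊗ ≤-diff (κ² e))
       (≡-by ((- (2ℚ * 2ℚ * (2ℚ * 2ℚ) * 2ℚ)) ⊙ cκ e ⊞ (- (2ℚ * 2ℚ * (2ℚ * 2ℚ))) ⊙ zer (⟦⟧-idem (C e)))
           (l₀ ⟦ C e ⟧ (κ e) (κ̂ * κ̂ * ⟦ H e ⟧)))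
      where
      l₀ : ∀ c k h → 2ℚ * 2ℚ * (2ℚ * 2ℚ) * (c + h) - 2ℚ * 2ℚ * (c + k) * (2ℚ * 2ℚ * (c + k)) - 2ℚ * 2ℚ * (2ℚ * 2ℚ) * (h - k * k)
         ≡ (- (2ℚ * 2ℚ * (2ℚ * 2ℚ) * 2ℚ)) * (c * k) + (- (2ℚ * 2ℚ * (2ℚ * 2ℚ))) * (c * c - c)
      l₀ = solve-∀ ring

  flow : ∀ v → b v - rr v ≡ ∑ (λ e → ι v (edges e) * Pe e)
  flow v = trans (sym (E-− Ω (λ ω → u (U ω) v) (λ ω → gω ω v)))
      (trans (E-cong Ω (λ ω → trans (cong (_- gω ω v) (unmatched-or-matched (k ω) (k≥0 ω) (U ω) v)) (cancelˡ (gω ω v) _)))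
      (trans (E-∑ Ω (λ e ω → ι v (edges e) * Pω ω e)) (∑-cong (λ e → E-* Ω (ι v (edges e)) (λ ω → Pω ω e)))))

  sC : Fin m → ℚ
  sC e = E Ω (λ ω → ⟦ selC ω e ⟧)

  u-full : ∀ v → u (full n) v ≡ 1ℚ
  u-full v = cong ⟦_⟧ (lookup-replicate v true)

  flowC : ∀ v → 1ℚ - b v ≡ ∑ (λ e → ι v (edges e) * sC e)
  flowC v = (trans (sym (trans (E-− Ω (λ _ → 1ℚ) (λ ω → u (U ω) v)) (cong (λ z → z - b v) (E-one Ω))))
     (trans (E-cong Ω (λ ω → trans (cong (λ z → 1ℚ - z)
         (trans (unc-incidence edges loop-free (W ω) (full n) v)
         (cong (λ z → z - ∑ (λ e → ι v (edges e) * ⟦ selC ω e ⟧)) (u-full v)))) (l₀ (∑ (λ e → ι v (edges e) * ⟦ selC ω e ⟧)))))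
      (trans (E-∑ Ω (λ e ω → ι v (edges e) * ⟦ selC ω e ⟧)) (∑-cong (λ e → E-* Ω (ι v (edges e)) (λ ω → ⟦ selC ω e ⟧))))))
    where
    l₀ : ∀ a → 1ℚ - (1ℚ - a) ≡ a
    l₀ = solve-∀ ring

  load : Fin n → ℚ
  load v = ∑ (λ e → ι v (edges e) * x' e)

  -- `X v` bounds the overload of `v`: the sampled edges ask for `load v`, while `v` reaches the
  -- second step with probability `b v`. The number `opt` turns counts of matched vertices into
  -- multiples of the optimum.
  module _ (X : Fin n → ℚ) (X≥0 : ∀ v → 0ℚ ≤ X v) (X≥ : ∀ v → load v - b v ≤ X v)
           (opt : ℚ) (opt≥ : ∑ sC + ∑ Pe ≤ opt) where

    twice : ∀ (c : Fin m → ℚ) → ∑ (λ v → ∑ (λ e → ι v (edges e) * c e)) ≡ 2ℚ * ∑ c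
    twice c = trans (∑-cong (λ v → sym (*-identityˡ (∑ (λ e → ι v (edges e) * c e))))) (trans (∑∑-ι edges (λ _ → 1ℚ) c) (∑-* 2ℚ c))

    ∑-err : ∑ err ≤ 2ℚ * (κ̂ * κ̂ * cardH) + (κ̂ * (2ℚ * opt) + κ̂ * (2ℚ * 2ℚ * (2ℚ * 2ℚ) * (cardC + κ̂ * κ̂ * cardH)))
    ∑-err = ≤-trans (≤-reflexive (trans (∑-+ err₁ (λ e → err₂ e + err₃ e)) (cong (∑ err₁ +_) (∑-+ err₂ err₃))))
      (+-mono-≤ err₁≤ (+-mono-≤ (≤-trans err₂≤ (*-monoʳ κ̂≥0 (≤-trans (≤-reflexive (trans (∑-cong flow) (twice Pe))) (*-monoʳ 2≥0
        (≤-trans (≤-by (∑-≥0 {f = sC} (λ e → E-≥0 Ω (λ ω → ⟦⟧≥0 (selC ω e)))) (cancelʳ (∑ sC) (∑ Pe))) opt≥))))) err₃≤))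

    private
      tight : Fin n → Bool
      tight v = isYes (rr v ≤? σ)

      tt : Fin n → ℚ
      tt v = ⟦ tight v ⟧

      D : Fin m → ℚ
      D e = Pe e - x' e

      rr≥0 : ∀ v → 0ℚ ≤ rr v
      rr≥0 v = E-≥0 Ω (λ ω → g≥0 (k ω) (k≥0 ω) (U ω) v)

      rr≤1 : ∀ v → rr v ≤ 1ℚ
      rr≤1 v = E-≤c Ω (λ ω → ≤-trans (g≤u (k ω) (k≥0 ω) (U ω) v) (⟦⟧≤1 (lookup (U ω) v)))

      few-tight : ∀ v → tt v ≤ 2ℚ * (1ℚ - rr v)
      few-tight v = go (rr v ≤? σ)
        where
        l₀ : ∀ r σ → 2ℚ * (1ℚ - r) - 1ℚ ≡ 1ℚ - 2ℚ * σ + 2ℚ * (σ - r)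
        l₀ = solve-∀ ring
        go : (x : Dec (rr v ≤ σ)) → ⟦ isYes x ⟧ ≤ 2ℚ * (1ℚ - rr v)
        go (yes h) = ≤-by (≤-diff 2σ≤1 ⊕ 2≥0 ⊗ ≤-diff h) (l₀ (rr v) σ)
        go (no _) = 2≥0 ⊗ ≤-diff (rr≤1 v)

      -- One factor 2 comes from `few-tight`, the other from the two ends of each matched edge.
      ∑tt : ∑ tt ≤ 2ℚ * 2ℚ * opt
      ∑tt = ≤-trans (∑-mono few-tight) (≤-trans (≤-reflexive eq) (≤-trans (*-monoʳ (2≥0 ⊗ 2≥0) opt≥) ≤-refl))
        where
        l₀ : ∀ b r → 1ℚ - r ≡ (1ℚ - b) + (b - r)
        l₀ = solve-∀ ring
        l₁ : ∀ a c → 2ℚ * a + 2ℚ * c ≡ 2ℚ * (a + c)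
        l₁ = solve-∀ ring
        l₂ : ∀ z → 2ℚ * (2ℚ * z) ≡ 2ℚ * 2ℚ * z
        l₂ = solve-∀ ring
        eq : ∑ (λ v → 2ℚ * (1ℚ - rr v)) ≡ 2ℚ * 2ℚ * (∑ sC + ∑ Pe)
        eq = trans (∑-* 2ℚ (λ v → 1ℚ - rr v)) (trans
            (cong (2ℚ *_) (trans (∑-cong (λ v → trans (l₀ (b v) (rr v)) (cong₂ _+_ (flowC v) (flow v))))
             (trans (∑-+ (λ v → ∑ (λ e → ι v (edges e) * sC e)) (λ v → ∑ (λ e → ι v (edges e) * Pe e)))
                 (trans (cong₂ _+_ (twice sC) (twice Pe)) (l₁ (∑ sC) (∑ Pe))))))
             (l₂ (∑ sC + ∑ Pe)))

      vertex-part : ∀ v → - (σ * tt v) - X v ≤ tt v * ∑ (λ e → ι v (edges e) * D e)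
      vertex-part v = subst (λ z → - (σ * tt v) - X v ≤ tt v * z) (sym eq) (go (rr v ≤? σ))
        where
        l₁ : ∀ i a b → i * (a - b) ≡ i * a - i * b
        l₁ = solve-∀ ring
        eq : ∑ (λ e → ι v (edges e) * D e) ≡ b v - rr v - load v
        eq = trans (∑-cong (λ e → l₁ (ι v (edges e)) (Pe e) (x' e)))
            (trans (∑-− (λ e → ι v (edges e) * Pe e) (λ e → ι v (edges e) * x' e)) (cong (λ z → z - load v) (sym (flow v))))
        l₂ : ∀ σ X b r L → 1ℚ * (b - r - L) - (- (σ * 1ℚ) - X) ≡ (σ - r) + (X - (L - b))
        l₂ = solve-∀ ring
        l₃ : ∀ σ X z → 0ℚ * z - (- (σ * 0ℚ) - X) ≡ X
        l₃ = solve-∀ ring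
        go : (x : Dec (rr v ≤ σ)) → - (σ * ⟦ isYes x ⟧) - X v ≤ ⟦ isYes x ⟧ * (b v - rr v - load v)
        go (yes h) = ≤-by (≤-diff h ⊕ ≤-diff (X≥ v)) (l₂ σ (X v) (b v) (rr v) (load v))
        go (no _) = ≤-by (X≥0 v) (l₃ σ (X v) (b v - rr v - load v))

      -- With both ends tight the mean field value is at most x', with no tight end it is at least x'.
      sign : ∀ x z → 0ℚ ≤ x → 0ℚ ≤ z → (dx : Dec (x ≤ σ)) (dz : Dec (z ≤ σ)) → 0ℚ ≤ (1ℚ - (⟦ isYes dx ⟧ + ⟦ isYes dz ⟧)) *
          (s * s * (x * z) - 1ℚ)
      sign x z x≥0 z≥0 (yes hx) (yes hz) = subst (0ℚ ≤_) (≡-by ((1ℚ + s * σ) ⊙ zer sσ) (l₀ s σ x z))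
          ((s≥0 ⊗ s≥0) ⊗ (σ≥0 ⊗ ≤-diff hz ⊕ ≤-diff hx ⊗ z≥0))
        where
        l₀ : ∀ s σ x z → s * s * (σ * (σ - z) + (σ - x) * z) - (1ℚ - (1ℚ + 1ℚ)) * (s * s * (x * z) - 1ℚ) ≡ (1ℚ + s * σ) * (s * σ - 1ℚ)
        l₀ = solve-∀ ring
      sign x z x≥0 z≥0 (yes hx) (no hz) = ≤-reflexive (sym (l₀ (s * s * (x * z) - 1ℚ)))
        where
        l₀ : ∀ a → (1ℚ - (1ℚ + 0ℚ)) * a ≡ 0ℚ
        l₀ = solve-∀ ring
      sign x z x≥0 z≥0 (no hx) (yes hz) = ≤-reflexive (sym (l₀ (s * s * (x * z) - 1ℚ)))
        where
        l₀ : ∀ a → (1ℚ - (0ℚ + 1ℚ)) * a ≡ 0ℚ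
        l₀ = solve-∀ ring
      sign x z x≥0 z≥0 (no hx) (no hz) = subst (0ℚ ≤_) (≡-by ((- (1ℚ + s * σ)) ⊙ zer sσ) (l₀ s σ x z))
          ((s≥0 ⊗ s≥0) ⊗ (σ≥0 ⊗ ≤-diff (≰⇒≥ hz) ⊕ ≤-diff (≰⇒≥ hx) ⊗ z≥0))
        where
        l₀ : ∀ s σ x z → s * s * (σ * (z - σ) + (x - σ) * z) - (1ℚ - (0ℚ + 0ℚ)) * (s * s * (x * z) - 1ℚ) ≡ (- (1ℚ + s * σ)) * (s * σ - 1ℚ)
        l₀ = solve-∀ ring

      coef : Fin m → ℚ
      coef e = 1ℚ - (tt (proj₁ (edges e)) + tt (proj₂ (edges e)))

      edge-part : ∀ e → - err e ≤ coef e * D e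
      edge-part e = ≤-by (x'≥0 ⊗ sign (rru e) (rrv e) (rr≥0 (proj₁ (edges e))) (rr≥0 (proj₂ (edges e))) (rr (proj₁ (edges e)) ≤? σ)
          (rr (proj₂ (edges e)) ≤? σ) ⊕ near)
           (l₀ (coef e) (Pe e) (x' e) (s * s) (rru e * rrv e) (err e))
        where
        x'≥0 : 0ℚ ≤ x' e
        x'≥0 = r≥0 ⊗ ⟦⟧≥0 (H e)
        Δ = Pe e - s * s * x' e * (rru e * rrv e)
        l₀ : ∀ c P x s r E → c * (P - x) - (- E) ≡ x * (c * (s * r - 1ℚ)) + (c * (P - s * x * r) + E)
        l₀ = solve-∀ ring
        l₁ : ∀ a E → 1ℚ * a + E ≡ E - (- a)
        l₁ = solve-∀ ring
        l₂ : ∀ a E → (- 1ℚ) * a + E ≡ E - a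
        l₂ = solve-∀ ring
        l₃ : ∀ a E → 0ℚ * a + E ≡ E
        l₃ = solve-∀ ring
        pos : 0ℚ ≤ 1ℚ * Δ + err e
        pos = subst (0ℚ ≤_) (sym (l₁ Δ (err e))) (≤-diff (≤-trans (-≤-abs Δ) (mean-field e)))
        near : 0ℚ ≤ coef e * Δ + err e
        near = go (tight (proj₁ (edges e))) (tight (proj₂ (edges e)))
          where
          err≥0 : 0ℚ ≤ err e
          err≥0 = ≤-trans (0≤∣p∣ Δ) (mean-field e)
          go : ∀ a c → 0ℚ ≤ (1ℚ - (⟦ a ⟧ + ⟦ c ⟧)) * Δ + err e
          go true true = subst (0ℚ ≤_) (sym (l₂ Δ (err e))) (≤-diff (≤-trans (≤-abs Δ) (mean-field e)))
          go true false = subst (0ℚ ≤_) (sym (l₃ Δ (err e))) err≥0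
          go false true = subst (0ℚ ≤_) (sym (l₃ Δ (err e))) err≥0
          go false false = pos

    -- On each edge 1 is the number of tight ends plus `coef e`. The first part of `∑ D` regroups
    -- into net flows at tight vertices (`vertex-part`); `coef e` is 1, 0 or -1 and agrees in sign
    -- with the mean field deviation (`edge-part`). An edge with one tight end has coefficient 0, so
    -- its unknown deviation does no harm.
    rounding : ∑ x' - 2ℚ * 2ℚ * (σ * opt) - ∑ X - ∑ err ≤ ∑ Pe
    rounding = ≤-by (σ≥0 ⊗ ≤-diff ∑tt ⊕ ≤-diff vsum ⊕ ≤-diff esum) (≡-by (zer split) (l₀ (∑ x') (∑ Pe) σ opt (∑ X) (∑ err) (∑ tt) SV SE))
      where
      SV = ∑ (λ v → tt v * ∑ (λ e → ι v (edges e) * D e))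
      SE = ∑ (λ e → coef e * D e)
      vsum : - (σ * ∑ tt) - ∑ X ≤ SV
      vsum = ≤-trans (≤-reflexive (sym (trans (∑-− (λ v → - (σ * tt v)) X)
          (cong (λ z → z - ∑ X) (trans (∑-cong (λ v → l₁ σ (tt v))) (trans (∑-* (- σ) tt) (l₂ σ (∑ tt))))))))
           (∑-mono vertex-part)
        where
        l₁ : ∀ s t → - (s * t) ≡ (- s) * t
        l₁ = solve-∀ ring
        l₂ : ∀ s t → (- s) * t ≡ - (s * t)
        l₂ = solve-∀ ring
      esum : - ∑ err ≤ SE
      esum = ≤-trans (≤-reflexive (trans (neg-as-* (∑ err)) (sym (trans (∑-cong (λ e → neg-as-* (err e))) (∑-* (- 1ℚ) err)))))
          (∑-mono edge-part)
      split : ∑ Pe - ∑ x' ≡ SV + SE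
      split = trans (sym (∑-− Pe x')) (trans (∑-cong (λ e → l₁ (tt (proj₁ (edges e)) + tt (proj₂ (edges e))) (D e)))
         (trans (∑-+ (λ e → (tt (proj₁ (edges e)) + tt (proj₂ (edges e))) * D e) (λ e → coef e * D e))
             (cong (_+ SE) (sym (∑∑-ι edges tt D)))))
        where
        l₁ : ∀ a d → d ≡ a * d + (1ℚ - a) * d
        l₁ = solve-∀ ring
      l₀ : ∀ x P σ o X E t V S → P - (x - 2ℚ * 2ℚ * (σ * o) - X - E) -
          (σ * (2ℚ * 2ℚ * o - t) + ((V - (- (σ * t) - X)) + (S - (- E)))) ≡ (P - x) - (V + S)
      l₀ = solve-∀ ring

-- Sparsification by sampled matchings

total-≤ : ∀ {A : Set} {k} (φ : A → ℚ) c (as : Vec A k) → (∀ a → φ a ≤ c) → total φ as ≤ nat k * c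
total-≤ φ c [] h = ≤-reflexive (sym (*-zeroˡ c))
total-≤ {k = suc k} φ c (a ∷ as) h = ≤-trans (+-mono-≤ (h a) (total-≤ φ c as h)) (≤-reflexive (l₀ c (nat k)))
  where
  l₀ : ∀ c k → c + k * c ≡ (1ℚ + k) * c
  l₀ = solve-∀ ring

total-≥0 : ∀ {A : Set} {k} (φ : A → ℚ) (as : Vec A k) → (∀ a → 0ℚ ≤ φ a) → 0ℚ ≤ total φ as
total-≥0 φ [] h = ≤-refl
total-≥0 φ (a ∷ as) h = h a ⊕ total-≥0 φ as h

total-∑ : ∀ {A : Set} {k m} (c : Fin m → ℚ) (φ : Fin m → A → ℚ) (as : Vec A k) →
  ∑ (λ e → c e * total (φ e) as) ≡ total (λ a → ∑ (λ e → c e * φ e a)) as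
total-∑ c φ [] = ∑-0 (λ e → *-zeroʳ (c e))
total-∑ c φ (a ∷ as) = trans (∑-cong (λ e → *-distribˡ-+ (c e) (φ e a) (total (φ e) as)))
  (trans (∑-+ (λ e → c e * φ e a) (λ e → c e * total (φ e) as)) (cong (∑ (λ e → c e * φ e a) +_) (total-∑ c φ as)))

hit : ∀ {A : Set} {k m} → (A → Fin m → Bool) → Vec A k → Fin m → Bool
hit S [] e = false
hit S (a ∷ as) e = S a e ∨ hit S as e

hit-none : ∀ {A : Set} {k m} (S : A → Fin m → Bool) (as : Vec A k) e → hit S as e ≡ false → total (λ a → ⟦ S a e ⟧) as ≡ 0ℚ
hit-none S [] e h = refl
hit-none S (a ∷ as) e h with S a e
hit-none S (a ∷ as) e h | false = trans (+-identityˡ _) (hit-none S as e h)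

hit≤ : ∀ {A : Set} {k m} (S : A → Fin m → Bool) (as : Vec A k) e (N : Bool) → ⟦ N ∧ hit S as e ⟧ ≤ total (λ a → ⟦ N ∧ S a e ⟧) as
hit≤ S as e false = total-≥0 (λ a → 0ℚ) as (λ _ → ≤-refl)
hit≤ S [] e true = ≤-refl
hit≤ S (a ∷ as) e true with S a e
... | true = ≤-by (total-≥0 (λ a → ⟦ S a e ⟧) as (λ a → ⟦⟧≥0 (S a e))) (l₀ _)
  where
  l₀ : ∀ t → 1ℚ + t - 1ℚ ≡ t
  l₀ = solve-∀ ring
... | false = ≤-trans (hit≤ S as e true) (≤-reflexive (sym (+-identityˡ _)))

-- Bonferroni inequality; J counts the hits.
hit≥ : ∀ {A : Set} {k m} (S : A → Fin m → Bool) (as : Vec A k) e (N : Bool) → let J = total (λ a → ⟦ S a e ⟧) as in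
  ⟦ N ⟧ * (2ℚ * J - J * J) ≤ ⟦ N ∧ hit S as e ⟧
hit≥ S as e false = ≤-reflexive (*-zeroˡ (2ℚ * J - J * J))
  where
  J = total (λ a → ⟦ S a e ⟧) as
hit≥ S as e true = go (hit S as e) refl
  where
  J = total (λ a → ⟦ S a e ⟧) as
  l₀ : ∀ J → 1ℚ - 1ℚ * (2ℚ * J - J * J) ≡ (J - 1ℚ) * (J - 1ℚ)
  l₀ = solve-∀ ring
  l₁ : 1ℚ * (2ℚ * 0ℚ - 0ℚ * 0ℚ) ≡ 0ℚ
  l₁ = refl
  go : ∀ b → hit S as e ≡ b → 1ℚ * (2ℚ * J - J * J) ≤ ⟦ b ⟧
  go true h = ≤-by (sq≥0 (J - 1ℚ)) (l₀ J)
  go false h = ≤-reflexive (cong (λ J → 1ℚ * (2ℚ * J - J * J)) (hit-none S as e h))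

-- A substitute for integrality: applied to `cC v`, it separates vertices without critical edges
-- from those with at least one.
zero-or-one : ∀ {m} (f : Fin m → ℚ) → (∀ e → f e ≡ 0ℚ ⊎ 1ℚ ≤ f e) → ∑ f ≡ 0ℚ ⊎ 1ℚ ≤ ∑ f
zero-or-one {zero} f h = inj₁ refl
zero-or-one {suc m} f h with h zero | zero-or-one (λ e → f (suc e)) (λ e → h (suc e))
... | inj₁ p | inj₁ q = inj₁ (cong₂ _+_ p q)
... | inj₁ p | inj₂ q = inj₂ (≤-trans q (≤-reflexive (sym (trans (cong (_+ ∑ (λ e → f (suc e))) p) (+-identityˡ _)))))
... | inj₂ p | inj₁ q = inj₂ (≤-trans p (≤-reflexive (sym (trans (cong (f zero +_) q) (+-identityʳ _)))))
... | inj₂ p | inj₂ q = inj₂ (≤-trans p (≤-by (≤-trans 0≤1 q) (cancelˡ (f zero) _)))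

ι-bool : ∀ {n} v (p : Pair n) c → ι v p * ⟦ c ⟧ ≡ 0ℚ ⊎ 1ℚ ≤ ι v p * ⟦ c ⟧
ι-bool v p false = inj₁ (*-zeroʳ (ι v p))
ι-bool v (a , b) true with v ≟F a | v ≟F b
... | yes _ | yes _ = inj₂ (≤-by (0≤1) refl)
... | yes _ | no _ = inj₂ ≤-refl
... | no _ | yes _ = inj₂ ≤-refl
... | no _ | no _ = inj₁ refl

-- `amgm` plays the role of the Cauchy-Schwarz inequality: for small `θ`, with `Θ` its inverse, it
-- bounds a mean deviation by a variance without square roots.
record Plan (m : ℕ) : Set where
  field
    C N       : Fin m → Bool
    disj      : ∀ e → C e ≡ true → N e ≡ false
    K'        : ℕ
    s σ       : ℚ
    s≥0       : 0ℚ ≤ s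
    σ≥0       : 0ℚ ≤ σ
    sσ        : s * σ ≡ 1ℚ
    2σ≤1      : 2ℚ * σ ≤ 1ℚ
    θ Θ       : ℚ
    θ≥0       : 0ℚ ≤ θ
    Θ≥0       : 0ℚ ≤ Θ
    amgm      : ∀ t → t ≤ θ + Θ * (t * t)

module Sparsify {n m : ℕ} (M : Model n m) (A : Selection M) (L : Plan m) where
  open Model M
  open Selection A
  open Plan L

  η : ℚ
  η = recip noise

  K : ℕ
  K = suc K'

  r : ℚ
  r = recip K'

  rK : nat K * r ≡ 1ℚ
  rK = inv-* (nat-suc>0 K')

  y : Vec ℚ m
  y = Prescribed.weights M A C

  H : Vec (Vec State m) K → Fin m → Bool
  H ωs e = N e ∧ hit S ωs e

  disjH : ∀ ωs e → C e ≡ true → H ωs e ≡ false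
  disjH ωs e h = cong (_∧ hit S ωs e) (disj e h)

  cC : Fin n → ℚ
  cC v = ∑ (λ e → ι v (edges e) * ⟦ C e ⟧)

  ψ : Fin n → Vec State m → ℚ
  ψ v ω = ∑ (λ e → ι v (edges e) * ⟦ N e ∧ S ω e ⟧)

  nv : Fin n → ℚ
  nv v = E Ω (ψ v)

  z : Fin n → Vec (Vec State m) K → ℚ
  z v ωs = r * total (ψ v) ωs

  cC≥0 : ∀ v → 0ℚ ≤ cC v
  cC≥0 v = ∑-≥0 (λ e → ι≥0 v (edges e) ⊗ ⟦⟧≥0 (C e))

  ψ≥0 : ∀ v ω → 0ℚ ≤ ψ v ω
  ψ≥0 v ω = ∑-≥0 (λ e → ι≥0 v (edges e) ⊗ ⟦⟧≥0 (N e ∧ S ω e))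

  fits1 : ∀ ω v → ∑ (λ e → ι v (edges e) * ⟦ S ω e ⟧) ≤ 1ℚ
  fits1 ω v = ≤-trans (fits ω v) (⟦⟧≤1 (lookup (full n) v))

  ψ≤1 : ∀ v ω → ψ v ω ≤ 1ℚ
  ψ≤1 v ω = ≤-trans (∑-mono (λ e → *-monoʳ (ι≥0 v (edges e)) (⟦⟧-mono (∧-conicalʳ (N e) (S ω e))))) (fits1 ω v)

  cardC : ℚ
  cardC = ∑ (λ e → ⟦ C e ⟧)

  scheme : Vec (Vec State m) K → Scheme m
  scheme ωs = record { C = C ; H = H ωs ; disj = disjH ωs ; y = y ; r = r ; s = s ; σ = σ ; r≥0 = recip≥0 K' ; s≥0 = s≥0 ; σ≥0 = σ≥0 ; sσ = sσ ; 2σ≤1 = 2σ≤1 }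

  module Sample (ωs : Vec (Vec State m) K) where

    module Rd = Rounding M (scheme ωs)

    -- The factor `cC v` vanishes at vertices without critical edges and sums to `2ℚ * cardC`; an
    -- error at every vertex could not be paid by the optimum. The bracket is the sampling error of
    -- the load plus the error of the prescribed probabilities.
    X : Fin n → ℚ
    X v = cC v * (θ + Θ * ((z v ωs - nv v) * (z v ωs - nv v)) + 2ℚ * η)

    2η≥0 : 0ℚ ≤ 2ℚ * η
    2η≥0 = Rd.2≥0 ⊗ recip≥0 noise

    X≥0 : ∀ v → 0ℚ ≤ X v
    X≥0 v = cC≥0 v ⊗ ((θ≥0 ⊕ Θ≥0 ⊗ sq≥0 (z v ωs - nv v)) ⊕ 2η≥0)

    sC≤ : ∀ e → Rd.sC e ≤ ⟦ C e ⟧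
    sC≤ e = E-≤c Ω (λ ω → ⟦⟧-mono (λ h → proj₁ (wt-positive (C e) (lookup y e) (lookup ω e)
      (subst (0ℚ <_) (lookup-Wt C y ω e) (positive (selected edges (Wt C y ω) (full n) e h))))))

    sC-near : ∀ e → C e ≡ true → ∣ Rd.sC e - x e ∣ ≤ 2ℚ * η
    sC-near = Prescribed.prescribed M A C

    sC-upper : ∀ e → Rd.sC e ≤ ⟦ C e ⟧ * x e + 2ℚ * η * ⟦ C e ⟧
    sC-upper e = go (C e) refl
      where
      l₀ : ∀ a x h → 1ℚ * x + h * 1ℚ - a ≡ h - (a - x)
      l₀ = solve-∀ ring
      l₁ : ∀ x h → 0ℚ ≡ 0ℚ * x + h * 0ℚ
      l₁ = solve-∀ ring
      go : ∀ c → C e ≡ c → Rd.sC e ≤ ⟦ c ⟧ * x e + 2ℚ * η * ⟦ c ⟧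
      go true h = ≤-by (≤-diff (≤-trans (≤-abs (Rd.sC e - x e)) (sC-near e h))) (l₀ (Rd.sC e) (x e) (2ℚ * η))
      go false h = ≤-trans (sC≤ e) (≤-reflexive (trans (cong ⟦_⟧ h) (l₁ (x e) (2ℚ * η))))

    sC-lower : ∀ e → ⟦ C e ⟧ * x e - 2ℚ * η * ⟦ C e ⟧ ≤ Rd.sC e
    sC-lower e = go (C e) refl
      where
      l₀ : ∀ a x h → a - (1ℚ * x - h * 1ℚ) ≡ h - (- (a - x))
      l₀ = solve-∀ ring
      l₁ : ∀ x h → 0ℚ * x - h * 0ℚ ≡ 0ℚ
      l₁ = solve-∀ ring
      go : ∀ c → C e ≡ c → ⟦ c ⟧ * x e - 2ℚ * η * ⟦ c ⟧ ≤ Rd.sC e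
      go true h = ≤-by (≤-diff (≤-trans (-≤-abs (Rd.sC e - x e)) (sC-near e h))) (l₀ (Rd.sC e) (x e) (2ℚ * η))
      go false h = ≤-trans (≤-reflexive (l₁ (x e) (2ℚ * η))) (E-≥0 Ω (λ ω → ⟦⟧≥0 (Rd.selC ω e)))

    load≤z : ∀ v → Rd.load v ≤ z v ωs
    load≤z v = ≤-trans (≤-reflexive (trans (∑-cong (λ e → l₀ (ι v (edges e)) r ⟦ H ωs e ⟧)) (∑-* r (λ e → ι v (edges e) * ⟦ H ωs e ⟧))))
       (*-monoʳ (recip≥0 K') (≤-trans (∑-mono (λ e → *-monoʳ (ι≥0 v (edges e)) (hit≤ S ωs e (N e))))
         (≤-reflexive (total-∑ (λ e → ι v (edges e)) (λ e ω → ⟦ N e ∧ S ω e ⟧) ωs))))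
      where
      l₀ : ∀ i r h → i * (r * h) ≡ r * (i * h)
      l₀ = solve-∀ ring

    n+c≤1 : ∀ v → nv v + ∑ (λ e → ι v (edges e) * (⟦ C e ⟧ * x e)) ≤ 1ℚ
    n+c≤1 v = ≤-trans (≤-reflexive (trans (cong (nv v +_) eq) (sym (E-+ Ω (ψ v) (λ ω → ∑ (λ e → ι v (edges e) * (⟦ C e ⟧ * ⟦ S ω e ⟧)))))))
        (E-≤c Ω (λ ω → ≤-trans (≤-reflexive (sym (∑-+ (λ e → ι v (edges e) * ⟦ N e ∧ S ω e ⟧)
            (λ e → ι v (edges e) * (⟦ C e ⟧ * ⟦ S ω e ⟧)))))
           (≤-trans (∑-mono (λ e → ≤-trans (≤-reflexive (sym (*-distribˡ-+ (ι v (edges e)) ⟦ N e ∧ S ω e ⟧ (⟦ C e ⟧ * ⟦ S ω e ⟧))))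
              (*-monoʳ (ι≥0 v (edges e)) (excl (C e) (N e) (S ω e) (disj e))))) (fits1 ω v))))
      where
      excl : ∀ c n s → (c ≡ true → n ≡ false) → ⟦ n ∧ s ⟧ + ⟦ c ⟧ * ⟦ s ⟧ ≤ ⟦ s ⟧
      excl false n s h = ≤-trans (≤-reflexive (trans (cong (⟦ n ∧ s ⟧ +_) (*-zeroˡ ⟦ s ⟧)) (+-identityʳ _))) (⟦⟧-mono (∧-conicalʳ n s))
      excl true n s h rewrite h refl = ≤-reflexive (trans (+-identityˡ _) (*-identityˡ ⟦ s ⟧))
      eq : ∑ (λ e → ι v (edges e) * (⟦ C e ⟧ * x e)) ≡ E Ω (λ ω → ∑ (λ e → ι v (edges e) * (⟦ C e ⟧ * ⟦ S ω e ⟧)))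
      eq = sym (trans (E-∑ Ω (λ e ω → ι v (edges e) * (⟦ C e ⟧ * ⟦ S ω e ⟧)))
          (∑-cong (λ e → trans (E-* Ω (ι v (edges e)) (λ ω → ⟦ C e ⟧ * ⟦ S ω e ⟧))
          (cong (ι v (edges e) *_) (E-* Ω ⟦ C e ⟧ (λ ω → ⟦ S ω e ⟧))))))

    -- Without a critical edge `v` surely stays uncovered, and its load is at most 1. Otherwise the
    -- overload is at most `z v ωs - nv v` plus `2ℚ * η * cC v`, because the critical and the
    -- negligible share of `v` sum to at most 1; `amgm` and `1ℚ ≤ cC v` finish the bound.
    X≥ : ∀ v → Rd.load v - Rd.b v ≤ X v
    X≥ v = go (zero-or-one (λ e → ι v (edges e) * ⟦ C e ⟧) (λ e → ι-bool v (edges e) (C e)))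
      where
      D = z v ωs - nv v
      c = cC v
      cx = ∑ (λ e → ι v (edges e) * (⟦ C e ⟧ * x e))
      z≤1 : z v ωs ≤ 1ℚ
      z≤1 = ≤-trans (*-monoʳ (recip≥0 K') (total-≤ (ψ v) 1ℚ ωs (ψ≤1 v))) (≤-reflexive (trans (l₀ r (nat K)) rK))
        where
        l₀ : ∀ r k → r * (k * 1ℚ) ≡ k * r
        l₀ = solve-∀ ring
      1-b≤ : 1ℚ - Rd.b v ≤ cx + 2ℚ * η * c
      1-b≤ = ≤-trans (≤-reflexive (Rd.flowC v))
          (≤-trans (∑-mono (λ e → ≤-trans (*-monoʳ (ι≥0 v (edges e)) (sC-upper e))
          (≤-reflexive (l₀ (ι v (edges e)) (⟦ C e ⟧ * x e) (2ℚ * η) ⟦ C e ⟧))))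
         (≤-reflexive (trans (∑-+ (λ e → ι v (edges e) * (⟦ C e ⟧ * x e)) (λ e → 2ℚ * η * (ι v (edges e) * ⟦ C e ⟧)))
             (cong (cx +_) (∑-* (2ℚ * η) (λ e → ι v (edges e) * ⟦ C e ⟧))))))
        where
        l₀ : ∀ i a h c → i * (a + h * c) ≡ i * a + h * (i * c)
        l₀ = solve-∀ ring
      1-b≤c : 1ℚ - Rd.b v ≤ c
      1-b≤c = ≤-trans (≤-reflexive (Rd.flowC v)) (∑-mono (λ e → *-monoʳ (ι≥0 v (edges e)) (sC≤ e)))
      l₁ : ∀ L b z n cx h c θ Q → c * (θ + Q + h) - (L - b) ≡ (z - L) +
          ((1ℚ - (n + cx)) + ((cx + h * c - (1ℚ - b)) + ((θ + Q - (z - n)) + (c - 1ℚ) * (θ + Q))))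
      l₁ = solve-∀ ring
      l₂ : ∀ L b z → 0ℚ - (L - b) ≡ (z - L) + ((1ℚ - z) + (0ℚ - (1ℚ - b)))
      l₂ = solve-∀ ring
      go : c ≡ 0ℚ ⊎ 1ℚ ≤ c → Rd.load v - Rd.b v ≤ X v
      go (inj₂ h) = ≤-by (≤-diff (load≤z v) ⊕ ≤-diff (n+c≤1 v) ⊕ ≤-diff 1-b≤ ⊕ ≤-diff (amgm D) ⊕ ≤-diff h ⊗ (θ≥0 ⊕ Θ≥0 ⊗ sq≥0 D))
           (l₁ (Rd.load v) (Rd.b v) (z v ωs) (nv v) cx (2ℚ * η) c θ (Θ * (D * D)))
      go (inj₁ h) = ≤-trans (≤-by (≤-diff (load≤z v) ⊕ ≤-diff z≤1 ⊕ ≤-diff (subst (1ℚ - Rd.b v ≤_) h 1-b≤c))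
          (l₂ (Rd.load v) (Rd.b v) (z v ωs)))
           (X≥0 v)

    -- A maximum matching of the realized sampled edges stands in for the random Gibbs matching,
    -- whose mean size it dominates (`size-bound`). The final matching thereby becomes a function of
    -- the state.
    sel₂ : Vec State m → Fin m → Bool
    sel₂ ω = sel edges (support (Rd.k ω)) (Rd.U ω)

    T' : Vec State m → Fin m → Bool
    T' ω e = Rd.selC ω e ∨ sel₂ ω e

    selC-ok : ∀ ω e → Rd.selC ω e ≡ true → C e ≡ true × is-just (lookup ω e) ≡ true
    selC-ok ω e h = wt-positive (C e) (lookup y e) (lookup ω e)
        (subst (0ℚ <_) (lookup-Wt C y ω e) (positive (selected edges (Wt C y ω) (full n) e h)))

    sel₂-ok : ∀ ω e → sel₂ ω e ≡ true → H ωs e ≡ true × is-just (lookup ω e) ≡ true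
    sel₂-ok ω e h = go (lookup ω e) (H ωs e) refl (subst (0ℚ <_) (lookup-Kt Rd.κ ω e)
         (positive?-< (lookup (Rd.k ω) e) (subst (0ℚ <_) (lookup-map e positive? (Rd.k ω))
             (positive (selected edges (support (Rd.k ω)) (Rd.U ω) e h)))))
      where
      go : ∀ a b → H ωs e ≡ b → 0ℚ < kt (Rd.κ e) a → b ≡ true × is-just a ≡ true
      go nothing b hb lt = ⊥-elim (<-irrefl refl lt)
      go (just i) true hb lt = refl , refl
      go (just i) false hb lt = ⊥-elim (<-irrefl (sym (Rd.κ-off e hb)) lt)

    T'-ok : ∀ ω e → T' ω e ≡ true → (C e ∨ H ωs e) ≡ true × is-just (lookup ω e) ≡ true
    T'-ok ω e = go (Rd.selC ω e) (sel₂ ω e) refl refl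
      where
      ∨-r : ∀ a {b} → b ≡ true → a ∨ b ≡ true
      ∨-r true h = refl
      ∨-r false h = h
      go : ∀ a b → Rd.selC ω e ≡ a → sel₂ ω e ≡ b → a ∨ b ≡ true → (C e ∨ H ωs e) ≡ true × is-just (lookup ω e) ≡ true
      go true b ha hb h = cong (_∨ H ωs e) (proj₁ (selC-ok ω e ha)) , proj₂ (selC-ok ω e ha)
      go false true ha hb h = ∨-r (C e) (proj₁ (sel₂-ok ω e hb)) , proj₂ (sel₂-ok ω e hb)

    T'-sum : ∀ ω e → ⟦ T' ω e ⟧ ≡ ⟦ Rd.selC ω e ⟧ + ⟦ sel₂ ω e ⟧
    T'-sum ω e = go (Rd.selC ω e) (sel₂ ω e) refl refl
      where
      go : ∀ a b → Rd.selC ω e ≡ a → sel₂ ω e ≡ b → ⟦ a ∨ b ⟧ ≡ ⟦ a ⟧ + ⟦ b ⟧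
      go false b ha hb = sym (+-identityˡ ⟦ b ⟧)
      go true false ha hb = refl
      go true true ha hb = ⊥-elim (false≢true (trans (sym (disjH ωs e (proj₁ (selC-ok ω e ha)))) (proj₁ (sel₂-ok ω e hb))))

    T'-fits : ∀ ω → Fits edges (full n) (T' ω)
    T'-fits ω v = ≤-trans (≤-reflexive (trans
        (∑-cong (λ e → trans (cong (ι v (edges e) *_) (T'-sum ω e)) (*-distribˡ-+ (ι v (edges e)) ⟦ Rd.selC ω e ⟧ ⟦ sel₂ ω e ⟧)))
         (∑-+ (λ e → ι v (edges e) * ⟦ Rd.selC ω e ⟧) (λ e → ι v (edges e) * ⟦ sel₂ ω e ⟧))))
       (≤-by (≤-diff (sel-fits edges loop-free (support (Rd.k ω)) (Rd.U ω) v))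
           (≡-by ((- 1ℚ) ⊙ zer (unc-incidence edges loop-free (Rd.W ω) (full n) v))
          (l₀ (u (full n) v) (∑ (λ e → ι v (edges e) * ⟦ Rd.selC ω e ⟧)) (∑ (λ e → ι v (edges e) * ⟦ sel₂ ω e ⟧)) (u (Rd.U ω) v))))
      where
      l₀ : ∀ f a b w → f - (a + b) - (w - b) ≡ (- 1ℚ) * (w - (f - a))
      l₀ = solve-∀ ring

    T'-size : ∀ ω → ∑ (λ e → ⟦ Rd.selC ω e ⟧) + ∑ (Rd.Pω ω) ≤ ∑ (λ e → ⟦ T' ω e ⟧)
    T'-size ω = ≤-trans (+-monoʳ-≤ (∑ (λ e → ⟦ Rd.selC ω e ⟧)) (≤-trans (size-bound edges loop-free (Rd.k ω) (Rd.k≥0 ω) (Rd.U ω))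
         (≤-trans (≤-reflexive (val-sum edges (support (Rd.k ω)) (Rd.U ω)))
             (∑-mono (λ e → ≤-trans (*-monoʳ (⟦⟧≥0 (sel₂ ω e)) (supp≤1 e)) (≤-reflexive (*-identityʳ ⟦ sel₂ ω e ⟧)))))))
       (≤-reflexive (sym (trans (∑-cong (T'-sum ω)) (∑-+ (λ e → ⟦ Rd.selC ω e ⟧) (λ e → ⟦ sel₂ ω e ⟧)))))
      where
      supp≤1 : ∀ e → lookup (support (Rd.k ω)) e ≤ 1ℚ
      supp≤1 e = ≤-trans (≤-reflexive (lookup-map e positive? (Rd.k ω))) (⟦⟧≤1 (isYes (0ℚ <? lookup (Rd.k ω) e)))

    ET : ℚ
    ET = E Ω (λ ω → ∑ (λ e → ⟦ T' ω e ⟧))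

    ET≥ : ∑ Rd.sC + ∑ Rd.Pe ≤ ET
    ET≥ = ≤-trans (≤-reflexive (trans (cong₂ _+_ (sym (E-∑ Ω (λ e ω → ⟦ Rd.selC ω e ⟧))) (sym (E-∑ Ω (λ e ω → Rd.Pω ω e))))
        (sym (E-+ Ω (λ ω → ∑ (λ e → ⟦ Rd.selC ω e ⟧)) (λ ω → ∑ (Rd.Pω ω))))))
       (E-mono Ω T'-size)

    -- The constructed matching consists of realized edges, so it competes with the maximum
    -- matching. This yields the hypothesis `opt≥` of the rounding.
    ET≤ : ET ≤ opt
    ET≤ = ≤-trans (E-mono Ω (λ ω → maximal ω (T' ω) (T'-fits ω) (λ e h → proj₂ (T'-ok ω e h)))) (≤-reflexive (E-∑ Ω (λ e ω → ⟦ S ω e ⟧)))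

    sample-bound : ∑ (λ e → ⟦ C e ⟧ * x e) - 2ℚ * η * cardC + (∑ Rd.x' - 2ℚ * 2ℚ * (σ * opt) - ∑ X
       - (2ℚ * (Rd.κ̂ * Rd.κ̂ * Rd.cardH) + (Rd.κ̂ * (2ℚ * opt) + Rd.κ̂ * (2ℚ * 2ℚ * (2ℚ * 2ℚ) * (cardC + Rd.κ̂ * Rd.κ̂ * Rd.cardH))))) ≤ ET
    sample-bound = ≤-trans (+-mono-≤ lowC (≤-trans
        (≤-by (≤-diff (Rd.∑-err X X≥0 X≥ opt (≤-trans ET≥ ET≤))) (l₀ (∑ Rd.x' - 2ℚ * 2ℚ * (σ * opt) - ∑ X) _ (∑ Rd.err)))
          (Rd.rounding X X≥0 X≥ opt (≤-trans ET≥ ET≤)))) ET≥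
      where
      l₀ : ∀ a b e → a - e - (a - b) ≡ b - e
      l₀ = solve-∀ ring
      lowC : ∑ (λ e → ⟦ C e ⟧ * x e) - 2ℚ * η * cardC ≤ ∑ Rd.sC
      lowC = ≤-trans (≤-reflexive (trans (cong (λ w → ∑ (λ e → ⟦ C e ⟧ * x e) - w) (sym (∑-* (2ℚ * η) (λ e → ⟦ C e ⟧))))
          (sym (∑-− (λ e → ⟦ C e ⟧ * x e) (λ e → 2ℚ * η * ⟦ C e ⟧)))))
           (∑-mono sC-lower)

  cardC≤ : ∀ {t} → (∀ e → C e ≡ true → 1ℚ ≤ t * x e) → 0ℚ ≤ t → cardC ≤ t * opt
  cardC≤ {t} h t≥0 = ≤-trans (∑-mono one) (≤-reflexive (∑-* t x))
    where
    one : ∀ e → ⟦ C e ⟧ ≤ t * x e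
    one e = go (C e) refl
      where
      go : ∀ c → C e ≡ c → ⟦ c ⟧ ≤ t * x e
      go true q = h e q
      go false q = t≥0 ⊗ x≥0 e

  -- Choosing the samples by averaging

  module Average (τ : ℚ) (hτ : ∀ e → N e ≡ true → nat K * x e ≤ τ) where

    Ωs : Expect (Vec (Vec State m) K)
    Ωs = power Ω K

    Jt : Fin m → Vec (Vec State m) K → ℚ
    Jt e = total (λ ω → ⟦ S ω e ⟧)

    M_N : ℚ
    M_N = ∑ (λ e → ⟦ N e ⟧ * x e)

    -- A lower bound on the number of sampled negligible edges that is quadratic in `Jt`, so that
    -- its mean follows from two moments.
    gain : Vec (Vec State m) K → ℚ
    gain ωs = ∑ (λ e → ⟦ N e ⟧ * (2ℚ * Jt e ωs - Jt e ωs * Jt e ωs))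

    Xs : Fin n → Vec (Vec State m) K → ℚ
    Xs v ωs = cC v * (θ + Θ * ((z v ωs - nv v) * (z v ωs - nv v)) + 2ℚ * η)

    -- Gain and overload are combined because `E-attain` serves one function at a time and both have
    -- to be good for the same samples.
    score : Vec (Vec State m) K → ℚ
    score ωs = r * gain ωs - ∑ (λ v → Xs v ωs)

    E-Jt : ∀ e → E Ωs (λ ωs → 2ℚ * Jt e ωs - Jt e ωs * Jt e ωs) ≡ 2ℚ * (nat K * x e) - (nat K * x e + (nat K * nat K - nat K) * (x e * x e))
    E-Jt e = trans (E-− Ωs (λ ωs → 2ℚ * Jt e ωs) (λ ωs → Jt e ωs * Jt e ωs)) (cong₂ _-_
       (trans (E-* Ωs 2ℚ (Jt e)) (cong (2ℚ *_) (E-total Ω K (λ ω → ⟦ S ω e ⟧))))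
       (trans (E-total² Ω K (λ ω → ⟦ S ω e ⟧)) (cong (λ w → nat K * w + (nat K * nat K - nat K) * (x e * x e))
           (E-cong Ω (λ ω → ⟦⟧-idem (S ω e))))))

    -- Repeated hits cost an edge at most the square of its expected multiplicity `nat K * x e`,
    -- which for a negligible edge is at most the fraction `τ` of that multiplicity.
    E-gain : M_N - τ * M_N ≤ r * E Ωs gain
    E-gain = ≤-trans (≤-reflexive eq₁) (≤-trans (∑-mono one)
        (≤-reflexive (trans (∑-* r (λ e → ⟦ N e ⟧ * E Ωs (λ ωs → 2ℚ * Jt e ωs - Jt e ωs * Jt e ωs)))
        (cong (r *_) (sym (trans (E-∑ Ωs (λ e ωs → ⟦ N e ⟧ * (2ℚ * Jt e ωs - Jt e ωs * Jt e ωs)))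
            (∑-cong (λ e → E-* Ωs ⟦ N e ⟧ (λ ωs → 2ℚ * Jt e ωs - Jt e ωs * Jt e ωs)))))))))
      where
      l₀ : ∀ n x t → n * x - t * (n * x) ≡ n * (x - t * x)
      l₀ = solve-∀ ring
      eq₁ : M_N - τ * M_N ≡ ∑ (λ e → ⟦ N e ⟧ * (x e - τ * x e))
      eq₁ = trans (cong (λ w → M_N - w) (sym (∑-* τ (λ e → ⟦ N e ⟧ * x e))))
          (trans (sym (∑-− (λ e → ⟦ N e ⟧ * x e) (λ e → τ * (⟦ N e ⟧ * x e)))) (∑-cong (λ e → l₀ ⟦ N e ⟧ (x e) τ)))
      l₁ : ∀ r k x → r * (2ℚ * (k * x) - (k * x + (k * k - k) * (x * x))) - (x - k * x * x + x * x) ≡ (x - k * x * x + x * x) * (k * r - 1ℚ)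
      l₁ = solve-∀ ring
      l₂ : ∀ x t k → x - k * x * x + x * x - (x - t * x) ≡ (t - k * x) * x + x * x
      l₂ = solve-∀ ring
      l₃ : ∀ a r b → a * (r * b) ≡ r * (a * b)
      l₃ = solve-∀ ring
      one : ∀ e → ⟦ N e ⟧ * (x e - τ * x e) ≤ r * (⟦ N e ⟧ * E Ωs (λ ωs → 2ℚ * Jt e ωs - Jt e ωs * Jt e ωs))
      one e = ≤-trans (go (N e) refl) (≤-reflexive
          (trans (cong (⟦ N e ⟧ *_) (sym (trans (cong (r *_) (E-Jt e))
          (≡-by ((x e - nat K * x e * x e + x e * x e) ⊙ zer rK) (l₁ r (nat K) (x e))))))
          (l₃ ⟦ N e ⟧ r (E Ωs (λ ωs → 2ℚ * Jt e ωs - Jt e ωs * Jt e ωs)))))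
        where
        go : ∀ b → N e ≡ b → ⟦ b ⟧ * (x e - τ * x e) ≤ ⟦ b ⟧ * (x e - nat K * x e * x e + x e * x e)
        go false h = ≤-reflexive (trans (*-zeroˡ (x e - τ * x e)) (sym (*-zeroˡ (x e - nat K * x e * x e + x e * x e))))
        go true h = *-monoʳ {x e - τ * x e} {x e - nat K * x e * x e + x e * x e} 0≤1
            (≤-by (≤-diff (hτ e h) ⊗ x≥0 e ⊕ sq≥0 (x e)) (l₂ (x e) τ (nat K)))

    variance : ∀ v → E Ωs (λ ωs → (z v ωs - nv v) * (z v ωs - nv v)) ≤ r
    variance v = ≤-trans (≤-reflexive eq) (≤-by (recip≥0 K' ⊗ (≤-diff q≤1 ⊕ sq≥0 (nv v))) (l₂ r Q (nv v)))
      where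
      Q = E Ω (λ ω → ψ v ω * ψ v ω)
      q≤1 : Q ≤ 1ℚ
      q≤1 = E-≤c Ω (λ ω → *-mono (ψ≥0 v ω) 0≤1 (ψ≤1 v ω) (ψ≤1 v ω))
      l₀ : ∀ r t n → (r * t - n) * (r * t - n) ≡ r * r * (t * t) + ((- (2ℚ * r * n)) * t + n * n)
      l₀ = solve-∀ ring
      l₁ : ∀ r k q n → r * r * (k * q + (k * k - k) * (n * n)) + ((- (2ℚ * r * n)) * (k * n) + n * n) - (r * q - r * (n * n))
         ≡ (r * q + (k * r - 1ℚ) * (n * n) - r * (n * n)) * (k * r - 1ℚ)
      l₁ = solve-∀ ring
      l₂ : ∀ r q n → r - (r * q - r * (n * n)) ≡ r * (1ℚ - q + n * n)
      l₂ = solve-∀ ring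
      t = total (ψ v)
      eq : E Ωs (λ ωs → (z v ωs - nv v) * (z v ωs - nv v)) ≡ r * Q - r * (nv v * nv v)
      eq = trans (E-cong Ωs (λ ωs → l₀ r (t ωs) (nv v)))
        (trans (E-+ Ωs (λ ωs → r * r * (t ωs * t ωs)) (λ ωs → (- (2ℚ * r * nv v)) * t ωs + nv v * nv v))
         (trans (cong₂ _+_ (trans (E-* Ωs (r * r) (λ ωs → t ωs * t ωs)) (cong (r * r *_) (E-total² Ω K (ψ v))))
             (trans (E-+ Ωs (λ ωs → (- (2ℚ * r * nv v)) * t ωs) (λ _ → nv v * nv v))
                 (cong₂ _+_ (trans (E-* Ωs (- (2ℚ * r * nv v)) t) (cong ((- (2ℚ * r * nv v)) *_) (E-total Ω K (ψ v))))
                 (E-const Ωs (nv v * nv v)))))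
          (≡-by ((r * Q + (nat K * r - 1ℚ) * (nv v * nv v) - r * (nv v * nv v)) ⊙ zer rK) (l₁ r (nat K) Q (nv v)))))

    E-Xs : E Ωs (λ ωs → ∑ (λ v → Xs v ωs)) ≤ 2ℚ * cardC * (θ + Θ * r + 2ℚ * η)
    E-Xs = ≤-trans (≤-reflexive (E-∑ Ωs Xs)) (≤-trans (∑-mono one)
        (≤-reflexive (trans (∑-*ʳ cC (θ + Θ * r + 2ℚ * η)) (cong (_* (θ + Θ * r + 2ℚ * η)) twice))))
      where
      twice : ∑ cC ≡ 2ℚ * cardC
      twice = trans (∑-cong (λ v → sym (*-identityˡ (cC v)))) (trans (∑∑-ι edges (λ _ → 1ℚ) (λ e → ⟦ C e ⟧)) (∑-* 2ℚ (λ e → ⟦ C e ⟧)))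
      one : ∀ v → E Ωs (Xs v) ≤ cC v * (θ + Θ * r + 2ℚ * η)
      one v = ≤-trans (≤-reflexive (E-* Ωs (cC v) (λ ωs → θ + Θ * dev ωs + 2ℚ * η))) (*-monoʳ (cC≥0 v)
         (≤-trans (≤-reflexive (trans (E-+ Ωs (λ ωs → θ + Θ * dev ωs) (λ _ → 2ℚ * η))
             (cong₂ _+_ (trans (E-+ Ωs (λ _ → θ) (λ ωs → Θ * dev ωs)) (cong₂ _+_ (E-const Ωs θ) (E-* Ωs Θ dev)))
             (E-const Ωs (2ℚ * η)))))
           (+-monoˡ-≤ (2ℚ * η) (+-monoʳ-≤ θ (*-monoʳ Θ≥0 (variance v))))))
        where
        dev : Vec (Vec State m) K → ℚ
        dev ωs = (z v ωs - nv v) * (z v ωs - nv v)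

    good : Σ (Vec (Vec State m) K) λ ωs → M_N - τ * M_N - 2ℚ * cardC * (θ + Θ * r + 2ℚ * η) ≤ r * ∑ (λ e → ⟦ H ωs e ⟧) - ∑ (λ v → Xs v ωs)
    good = ωs , ≤-trans (≤-trans low (proj₂ att))
        (≤-by (recip≥0 K' ⊗ ≤-diff (∑-mono (λ e → hit≥ S ωs e (N e)))) (l₁ r (gain ωs) _ (∑ (λ v → Xs v ωs))))
      where
      att = E-attain Ωs score
      ωs = proj₁ att
      l₀ : ∀ a b c d → c - d - (a - b) ≡ (c - a) + (b - d)
      l₀ = solve-∀ ring
      l₁ : ∀ r g h x → r * h - x - (r * g - x) ≡ r * (h - g)
      l₁ = solve-∀ ring
      low : M_N - τ * M_N - 2ℚ * cardC * (θ + Θ * r + 2ℚ * η) ≤ E Ωs score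
      low = ≤-trans (≤-by (≤-diff E-gain ⊕ ≤-diff E-Xs) (l₀ (M_N - τ * M_N) _ (r * E Ωs gain) (E Ωs (λ ωs → ∑ (λ v → Xs v ωs)))))
        (≤-reflexive (sym (trans (E-− Ωs (λ ωs → r * gain ωs) (λ ωs → ∑ (λ v → Xs v ωs)))
            (cong (λ w → w - E Ωs (λ ωs → ∑ (λ v → Xs v ωs))) (E-* Ωs r gain)))))

    cardH≤ : ∀ B → (∀ ω → ∑ (λ e → ⟦ S ω e ⟧) ≤ B) → ∀ ωs → ∑ (λ e → ⟦ H ωs e ⟧) ≤ nat K * B
    cardH≤ B hB ωs = ≤-trans (∑-mono (λ e → ≤-trans (hit≤ S ωs e (N e)) (≤-reflexive (sym (*-identityˡ _)))))
       (≤-trans (≤-reflexive (total-∑ (λ _ → 1ℚ) (λ e ω → ⟦ N e ∧ S ω e ⟧) ωs))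
         (total-≤ (λ ω → ∑ (λ e → 1ℚ * ⟦ N e ∧ S ω e ⟧)) B ωs
             (λ ω → ≤-trans (∑-mono (λ e → ≤-trans (≤-reflexive (*-identityˡ ⟦ N e ∧ S ω e ⟧))
             (⟦⟧-mono (∧-conicalʳ (N e) (S ω e))))) (hB ω))))

    -- The values `x` at the edges of `v` sum to at most 1, which leaves room for `t` critical
    -- edges; each sample is a matching and adds at most one edge.
    degree : ∀ {t} → (∀ e → C e ≡ true → 1ℚ ≤ t * x e) → 0ℚ ≤ t → ∀ ωs v → ∑ (λ e → ι v (edges e) * ⟦ C e ∨ H ωs e ⟧) ≤ t + nat K
    degree {t} h t≥0 ωs v = ≤-trans (∑-mono (λ e → ≤-trans (*-monoʳ (ι≥0 v (edges e)) (∨-sum (C e) (H ωs e)))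
        (≤-reflexive (*-distribˡ-+ (ι v (edges e)) ⟦ C e ⟧ ⟦ H ωs e ⟧))))
       (≤-trans (≤-reflexive (∑-+ (λ e → ι v (edges e) * ⟦ C e ⟧) (λ e → ι v (edges e) * ⟦ H ωs e ⟧))) (+-mono-≤ degC degH))
      where
      ∨-sum : ∀ a b → ⟦ a ∨ b ⟧ ≤ ⟦ a ⟧ + ⟦ b ⟧
      ∨-sum true b = ≤-by (⟦⟧≥0 b) (l₀ ⟦ b ⟧)
        where
        l₀ : ∀ b → 1ℚ + b - 1ℚ ≡ b
        l₀ = solve-∀ ring
      ∨-sum false b = ≤-reflexive (sym (+-identityˡ ⟦ b ⟧))
      l₁ : ∀ i t x → i * (t * x) ≡ t * (i * x)
      l₁ = solve-∀ ring
      one : ∀ e → ⟦ C e ⟧ ≤ t * x e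
      one e = go (C e) refl
        where
        go : ∀ c → C e ≡ c → ⟦ c ⟧ ≤ t * x e
        go true q = h e q
        go false q = t≥0 ⊗ x≥0 e
      degC : cC v ≤ t
      degC = ≤-trans (∑-mono (λ e → ≤-trans (*-monoʳ (ι≥0 v (edges e)) (one e)) (≤-reflexive (l₁ (ι v (edges e)) t (x e)))))
        (≤-trans (≤-reflexive (∑-* t (λ e → ι v (edges e) * x e)))
            (≤-trans (*-monoʳ t≥0 (≤-trans (≤-reflexive
            (sym (trans (E-∑ Ω (λ e ω → ι v (edges e) * ⟦ S ω e ⟧)) (∑-cong (λ e → E-* Ω (ι v (edges e)) (λ ω → ⟦ S ω e ⟧))))))
            (E-≤c Ω (λ ω → fits1 ω v)))) (≤-reflexive (*-identityʳ t))))
      degH : ∑ (λ e → ι v (edges e) * ⟦ H ωs e ⟧) ≤ nat K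
      degH = ≤-trans (∑-mono (λ e → *-monoʳ (ι≥0 v (edges e)) (hit≤ S ωs e (N e))))
          (≤-trans (≤-reflexive (total-∑ (λ e → ι v (edges e)) (λ e ω → ⟦ N e ∧ S ω e ⟧) ωs))
         (≤-trans (total-≤ (ψ v) 1ℚ ωs (ψ≤1 v)) (≤-reflexive (*-identityʳ (nat K)))))

    -- In order: the discarded middle edges, repeated hits, all errors proportional to `cardC`, the
    -- tight vertices, and the remaining decoupling errors, where `cardH` has been bounded by
    -- `nat K * (q * opt)`.
    loss : ℚ → ℚ → ℚ
    loss t ε₁ = ε₁ + τ + t * (2ℚ * 2ℚ * η + 2ℚ * η + 2ℚ * (θ + Θ * r) + 2ℚ * 2ℚ * (2ℚ * 2ℚ) * (s * s * r * q))
      + 2ℚ * 2ℚ * σ + 2ℚ * (s * s * r * q) + (2ℚ + 2ℚ * 2ℚ * (2ℚ * 2ℚ)) * (s * s * (s * s) * (q * q * q) * r)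

    module _ (τ≥0 : 0ℚ ≤ τ) (t : ℚ) (t≥0 : 0ℚ ≤ t) (hC : ∀ e → C e ≡ true → 1ℚ ≤ t * x e)
             (B : ℚ) (hB : ∀ ω → ∑ (λ e → ⟦ S ω e ⟧) ≤ B) (B≤ : B ≤ q * opt) (κ̂≤1 : s * s * r * q ≤ 1ℚ)
             (ε₁ : ℚ) (mass : opt - ε₁ * opt ≤ ∑ (λ e → ⟦ C e ⟧ * x e) + M_N) where

      ωs* : Vec (Vec State m) K
      ωs* = proj₁ good

      ET* : ℚ
      ET* = Sample.ET ωs*

      ET-large : opt * (1ℚ - loss t ε₁) ≤ ET*
      ET-large = ≤-by (≤-diff (Sample.sample-bound ωs*) ⊕ ≤-diff good' ⊕ ≤-diff mass ⊕ τ≥0 ⊗ ≤-diff MN≤ ⊕ ≤-diff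
          (cardC≤ hC t≥0) ⊗ coeff≥0 ⊕ ≤-diff err≤)
        (l₀ opt ET* (∑ (λ e → ⟦ C e ⟧ * x e)) M_N η cardC (∑ x*) σ (∑ X*) errs θ (Θ * r) τ ε₁ t κ̂ (s * s * (s * s) * (q * q * q) * r))
        where
        x* : Fin m → ℚ
        x* e = r * ⟦ H ωs* e ⟧
        X* : Fin n → ℚ
        X* v = Xs v ωs*
        h κ̂ 16ℚ 18ℚ errs : ℚ
        h = ∑ (λ e → ⟦ H ωs* e ⟧)
        κ̂ = s * s * r * q
        16ℚ = 2ℚ * 2ℚ * (2ℚ * 2ℚ)
        18ℚ = 2ℚ + 16ℚ
        errs = 2ℚ * (κ̂ * κ̂ * h) + (κ̂ * (2ℚ * opt) + κ̂ * (16ℚ * (cardC + κ̂ * κ̂ * h)))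
        2≥0 : 0ℚ ≤ 2ℚ
        2≥0 = 0≤1 ⊕ 0≤1
        κ̂≥0 : 0ℚ ≤ κ̂
        κ̂≥0 = ((s≥0 ⊗ s≥0) ⊗ recip≥0 K') ⊗ q≥0
        16≥0 : 0ℚ ≤ 16ℚ
        16≥0 = (2≥0 ⊗ 2≥0) ⊗ (2≥0 ⊗ 2≥0)
        18≥0 : 0ℚ ≤ 18ℚ
        18≥0 = 2≥0 ⊕ 16≥0
        h≥0 : 0ℚ ≤ h
        h≥0 = ∑-≥0 (λ e → ⟦⟧≥0 (H ωs* e))
        h≤ : h ≤ nat K * (q * opt)
        h≤ = ≤-trans (cardH≤ B hB ωs*) (*-monoʳ (nat≥0 K) B≤)
        MN≤ : M_N ≤ opt
        MN≤ = ∑-mono (λ e → ≤-trans (*-mono (⟦⟧≥0 (N e)) (x≥0 e) (⟦⟧≤1 (N e)) ≤-refl) (≤-reflexive (*-identityˡ (x e))))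
        coeff≥0 : 0ℚ ≤ 2ℚ * 2ℚ * η + 2ℚ * η + 2ℚ * (θ + Θ * r) + 16ℚ * κ̂
        coeff≥0 = (((2≥0 ⊗ 2≥0) ⊗ recip≥0 noise ⊕ 2≥0 ⊗ recip≥0 noise) ⊕ 2≥0 ⊗ (θ≥0 ⊕ Θ≥0 ⊗ recip≥0 K')) ⊕ 16≥0 ⊗ κ̂≥0
        good' : M_N - τ * M_N - 2ℚ * cardC * (θ + Θ * r + 2ℚ * η) ≤ ∑ x* - ∑ X*
        good' = ≤-trans (proj₂ good) (≤-reflexive (cong (λ z → z - ∑ X*) (sym (∑-* r (λ e → ⟦ H ωs* e ⟧)))))
        -- `κ̂≤1` lowers the cubic term to a quadratic one, whence 18 = 2 + 16; the factor `nat K`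
        -- in the bound on `h` cancels one `r` of `κ̂ * κ̂`.
        err≤ : errs ≤ κ̂ * (2ℚ * opt) + κ̂ * (16ℚ * cardC) + 18ℚ * (s * s * (s * s) * (q * q * q) * r) * opt
        err≤ = ≤-by ((16≥0 ⊗ (κ̂≥0 ⊗ κ̂≥0)) ⊗ ≤-diff κ̂≤1 ⊗ h≥0 ⊕ (18≥0 ⊗ (κ̂≥0 ⊗ κ̂≥0)) ⊗ ≤-diff h≤)
           (≡-by ((- (18ℚ * opt)) ⊙ zer κ̂²) (l₁ κ̂ opt cardC h (nat K) q (s * s * (s * s) * (q * q * q) * r)))
          where
          l₂ : ∀ s r q k → s * s * r * q * (s * s * r * q) * (k * q) - s * s * (s * s) * (q * q * q) * r ≡ s * s * (s * s) *
              (q * q * q) * r * (k * r - 1ℚ)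
          l₂ = solve-∀ ring
          κ̂² : κ̂ * κ̂ * (nat K * q) ≡ s * s * (s * s) * (q * q * q) * r
          κ̂² = ≡-by ((s * s * (s * s) * (q * q * q) * r) ⊙ zer rK) (l₂ s r q (nat K))
          l₁ : ∀ κ o c h k q g → κ * (2ℚ * o) + κ * (2ℚ * 2ℚ * (2ℚ * 2ℚ) * c) + (2ℚ + 2ℚ * 2ℚ * (2ℚ * 2ℚ)) * g * o
              - (2ℚ * (κ * κ * h) + (κ * (2ℚ * o) + κ * (2ℚ * 2ℚ * (2ℚ * 2ℚ) * (c + κ * κ * h))))
              - (2ℚ * 2ℚ * (2ℚ * 2ℚ) * (κ * κ) * ((1ℚ - κ) * h) + (2ℚ + 2ℚ * 2ℚ * (2ℚ * 2ℚ)) * (κ * κ) * (k * (q * o) - h))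
              ≡ (- ((2ℚ + 2ℚ * 2ℚ * (2ℚ * 2ℚ)) * o)) * (κ * κ * (k * q) - g)
          l₁ = solve-∀ ring
        l₀ : ∀ o ET MC MN η c xs σ X e θ Q τ ε t κ g →
          ET - o * (1ℚ - (ε + τ + t * (2ℚ * 2ℚ * η + 2ℚ * η + 2ℚ * (θ + Q) + 2ℚ * 2ℚ * (2ℚ * 2ℚ) * κ) + 2ℚ * 2ℚ * σ + 2ℚ * κ +
              (2ℚ + 2ℚ * 2ℚ * (2ℚ * 2ℚ)) * g))
          ≡ (ET - (MC - 2ℚ * η * c + (xs - 2ℚ * 2ℚ * (σ * o) - X - e)))
            + ((xs - X - (MN - τ * MN - 2ℚ * c * (θ + Q + 2ℚ * η))) +
                ((MC + MN - (o - ε * o)) + (τ * (o - MN) +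
                ((t * o - c) * (2ℚ * 2ℚ * η + 2ℚ * η + 2ℚ * (θ + Q) + 2ℚ * 2ℚ * (2ℚ * 2ℚ) * κ)
            + (κ * (2ℚ * o) + κ * (2ℚ * 2ℚ * (2ℚ * 2ℚ) * c) + (2ℚ + 2ℚ * 2ℚ * (2ℚ * 2ℚ)) * g * o - e)))))
        l₀ = solve-∀ ring

-- Translation between graphs and indicator sums

simple-distinct : ∀ {n m} (G : Graph n m) → Distinct (ends G)
simple-distinct G e f h with e ≟F f
... | yes q = q
... | no ne = ⊥-elim (simple G e f ne (inj₁ (cong proj₁ h , cong proj₂ h)))

size-∑ : ∀ {m} (S : EdgeSet m) → nat (size S) ≡ ∑ (λ e → ⟦ S e ⟧)
size-∑ {zero} S = refl
size-∑ {suc m} S with S zero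
... | true = cong (1ℚ +_) (size-∑ (tl S))
... | false = trans (size-∑ (tl S)) (sym (+-identityˡ _))

nat-mono : ∀ {a b} → a ℕ.≤ b → nat a ≤ nat b
nat-mono {b = b} ℕ.z≤n = nat≥0 b
nat-mono (ℕ.s≤s h) = +-monoʳ-≤ 1ℚ (nat-mono h)

nat-cancel : ∀ {a b} → nat a ≤ nat b → a ℕ.≤ b
nat-cancel {zero} h = ℕ.z≤n
nat-cancel {suc a} {zero} h = ⊥-elim (<-irrefl refl (<-≤-trans (nat-suc>0 a) h))
nat-cancel {suc a} {suc b} h = ℕ.s≤s (nat-cancel (≤-by (≤-diff h) (l₀ (nat a) (nat b))))
  where
  l₀ : ∀ a b → b - a ≡ 1ℚ + b - (1ℚ + a)
  l₀ = solve-∀ ring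

touches : ∀ {n} → Fin n → Pair n → Bool
touches v (a , b) = isYes (v ≟F a) ∨ isYes (v ≟F b)

touches≤ι : ∀ {n} v (p : Pair n) → ⟦ touches v p ⟧ ≤ ι v p
touches≤ι v (a , b) with isYes (v ≟F a) | isYes (v ≟F b)
... | true | y = ≤-by (⟦⟧≥0 y) (l₀ ⟦ y ⟧)
  where
  l₀ : ∀ y → 1ℚ + y - 1ℚ ≡ y
  l₀ = solve-∀ ring
... | false | y = ≤-reflexive (sym (+-identityˡ ⟦ y ⟧))

ι≤touches : ∀ {n} v (p : Pair n) → proj₁ p ≢ proj₂ p → ι v p ≤ ⟦ touches v p ⟧
ι≤touches v (a , b) ne with v ≟F a | v ≟F b
... | yes refl | yes refl = ⊥-elim (ne refl)
... | yes _ | no _ = ≤-refl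
... | no _ | yes _ = ≤-refl
... | no _ | no _ = ≤-refl

touches-end : ∀ {n} v (p : Pair n) → touches v p ≡ true → v ≡ proj₁ p ⊎ v ≡ proj₂ p
touches-end v (a , b) h with v ≟F a | v ≟F b
... | yes q | _ = inj₁ q
... | no _ | yes q = inj₂ q
touches-end v (a , b) () | no _ | no _

two≤∑ : ∀ {m} (f : Fin m → ℚ) → (∀ e → 0ℚ ≤ f e) → ∀ e e' → e ≢ e' → f e + f e' ≤ ∑ f
two≤∑ f h zero zero ne = ⊥-elim (ne refl)
two≤∑ f h zero (suc e') ne = +-monoʳ-≤ (f zero) (term≤∑ (λ i → h (suc i)) e')
two≤∑ f h (suc e) zero ne = ≤-trans (≤-reflexive (+-comm (f (suc e)) (f zero))) (+-monoʳ-≤ (f zero) (term≤∑ (λ i → h (suc i)) e))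
two≤∑ f h (suc e) (suc e') ne = ≤-trans (two≤∑ (λ i → f (suc i)) (λ i → h (suc i)) e e' (λ q → ne (cong suc q)))
  (≤-by (h zero) (cancelʳ (f zero) _))

fits⇒matching : ∀ {n m} (G : Graph n m) S → Fits (ends G) (full n) S → IsMatching G S
fits⇒matching {n} G S fits e f ne Se Sf = (ne' a (ι₁ (ends G e)) c (ι₁ (ends G f)) , ne' a (ι₁ (ends G e)) d (ι₂ (ends G f))) ,
    (ne' b (ι₂ (ends G e)) c (ι₁ (ends G f)) , ne' b (ι₂ (ends G e)) d (ι₂ (ends G f)))
  where
  a = proj₁ (ends G e)
  b = proj₂ (ends G e)
  c = proj₁ (ends G f)
  d = proj₂ (ends G f)
  F : Fin n → Fin _ → ℚ
  F v e = ι v (ends G e) * ⟦ S e ⟧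
  one : ∀ v e → S e ≡ true → 1ℚ ≤ ι v (ends G e) → 1ℚ ≤ F v e
  one v e Se h = ≤-trans h (≤-reflexive (trans (sym (*-identityʳ (ι v (ends G e)))) (cong (λ x → ι v (ends G e) * ⟦ x ⟧) (sym Se))))
  ne' : ∀ v → 1ℚ ≤ ι v (ends G e) → ∀ w → 1ℚ ≤ ι w (ends G f) → v ≢ w
  ne' v hv .v hw refl = <-irrefl refl (<-≤-trans 1<2 (≤-trans (+-mono-≤ (one v e Se hv) (one v f Sf hw))
      (≤-trans (two≤∑ (F v) (λ e → ι≥0 v (ends G e) ⊗ ⟦⟧≥0 (S e)) e f ne) (≤-trans (fits v) (⟦⟧≤1 (lookup (full n) v))))))
    where
    1<2 : 1ℚ < 1ℚ + 1ℚ
    1<2 = ≰⇒> (λ h → <-irrefl refl (<-≤-trans (positive⁻¹ 1ℚ) (≤-by (≤-diff h) refl)))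

matching⇒fits : ∀ {n m} (G : Graph n m) S → IsMatching G S → Fits (ends G) (full n) S
matching⇒fits {n} G S mt v = ≤-trans (∑-mono
    (λ e → ≤-trans (*-mono (ι≥0 v (ends G e)) (⟦⟧≥0 (S e)) (ι≤touches v (ends G e) (loopless G e)) ≤-refl)
    (≤-reflexive (sym (⟦∧⟧ (touches v (ends G e)) (S e))))))
    (≤-trans (∑-atMostOne (λ e → touches v (ends G e) ∧ S e) uniq) (≤-reflexive (sym (cong ⟦_⟧ (lookup-replicate v true)))))
  where
  meet : ∀ e f → (v ≡ proj₁ (ends G e) ⊎ v ≡ proj₂ (ends G e)) → (v ≡ proj₁ (ends G f) ⊎ v ≡ proj₂ (ends G f)) → ¬ Disjoint
      (ends G e) (ends G f)
  meet e f (inj₁ p) (inj₁ q) ((h , _) , _) = h (trans (sym p) q)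
  meet e f (inj₁ p) (inj₂ q) ((_ , h) , _) = h (trans (sym p) q)
  meet e f (inj₂ p) (inj₁ q) (_ , (h , _)) = h (trans (sym p) q)
  meet e f (inj₂ p) (inj₂ q) (_ , (_ , h)) = h (trans (sym p) q)
  uniq : ∀ e f → touches v (ends G e) ∧ S e ≡ true → touches v (ends G f) ∧ S f ≡ true → e ≡ f
  uniq e f p q with e ≟F f
  ... | yes r = r
  ... | no ne = ⊥-elim (meet e f (touches-end v (ends G e) (∧-conicalˡ _ _ p)) (touches-end v (ends G f) (∧-conicalˡ _ _ q))
                  (mt e f ne (∧-conicalʳ (touches v (ends G e)) _ p) (∧-conicalʳ (touches v (ends G f)) _ q)))

-- Edge sets are functions, so a given one matches a listed one pointwise only; this is why `size`,
-- `μ` and the expectations need congruence lemmas.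
allEdgeSets-complete : ∀ {m} (S : EdgeSet m) → Σ (EdgeSet m) λ S' → S' ∈ allEdgeSets m × (∀ e → S' e ≡ S e)
allEdgeSets-complete {zero} S = _ , here refl , λ ()
allEdgeSets-complete {suc m} S with allEdgeSets-complete (tl S) | S zero in s₀
... | S' , S'∈ , eq | false = _ , ∈-++⁺ˡ (∈-map⁺ _ S'∈) , λ { zero → sym s₀ ; (suc e) → eq e }
... | S' , S'∈ , eq | true = _ , ∈-++⁺ʳ _ (∈-map⁺ _ S'∈) , λ { zero → sym s₀ ; (suc e) → eq e }

module _ {A : Set} (f : A → ℕ) {P : A → Set} (P? : ∀ x → Dec (P x)) where

  max≥ : ∀ {x} xs → x ∈ xs → P x → f x ℕ.≤ foldr ℕ._⊔_ 0 (List.map f (filter P? xs))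
  max≥ (x ∷ xs) (here refl) px with P? x
  ... | yes _ = ℕ.m≤m⊔n (f x) _
  ... | no np = ⊥-elim (np px)
  max≥ (y ∷ xs) (there x∈) px with P? y
  ... | yes _ = ℕ.≤-trans (max≥ xs x∈ px) (ℕ.m≤n⊔m (f y) _)
  ... | no _ = max≥ xs x∈ px

  max-attained : ∀ xs → foldr ℕ._⊔_ 0 (List.map f (filter P? xs)) ≡ 0 ⊎ Σ A λ x → P x × f x ≡ foldr ℕ._⊔_ 0 (List.map f (filter P? xs))
  max-attained [] = inj₁ refl
  max-attained (x ∷ xs) with P? x
  ... | no _ = max-attained xs
  ... | yes px with ℕ.⊔-sel (f x) (foldr ℕ._⊔_ 0 (List.map f (filter P? xs)))
  ... | inj₁ q = inj₂ (x , px , sym q)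
  ... | inj₂ q with max-attained xs
  ... | inj₁ z = inj₁ (trans q z)
  ... | inj₂ (y , py , e) = inj₂ (y , py , trans e (sym q))

size-cong : ∀ {m} {S S' : EdgeSet m} → (∀ e → S e ≡ S' e) → size S ≡ size S'
size-cong {zero} h = refl
size-cong {suc m} h = cong₂ ℕ._+_ (cong (λ b → if b then 1 else 0) (h zero)) (size-cong (λ e → h (suc e)))

size-empty : ∀ m → size {m} (λ _ → false) ≡ 0
size-empty zero = refl
size-empty (suc m) = size-empty m

μ-upper : ∀ {n m} (G : Graph n m) H S → S ⊆E H → IsMatching G S → size S ℕ.≤ μ G H
μ-upper G H S sub mt with allEdgeSets-complete S
... | S' , S'∈ , eq = subst (ℕ._≤ μ G H) (size-cong eq) (max≥ size _ (allEdgeSets _) S'∈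
   ((λ e h → sub e (trans (sym (eq e)) h)) , λ e f ne p q → mt e f ne (trans (sym (eq e)) p) (trans (sym (eq f)) q)))

maximum-matching : ∀ {n m} (G : Graph n m) H → Σ (EdgeSet m) λ S → (S ⊆E H × IsMatching G S) × size S ≡ μ G H
maximum-matching {m = m} G H with max-attained size _ (allEdgeSets m)
... | inj₂ (S , ok , e) = S , ok , e
... | inj₁ z = (λ _ → false) , ((λ e ()) , λ e f ne ()) , trans (size-empty m) (sym z)

μ-mono : ∀ {n m} (G : Graph n m) H H' → H ⊆E H' → μ G H ℕ.≤ μ G H'
μ-mono G H H' sub with maximum-matching G H
... | S , (S⊆ , mt) , e = subst (ℕ._≤ μ G H') e (μ-upper G H' S (λ f h → sub f (S⊆ f h)) mt)

μ-cong : ∀ {n m} (G : Graph n m) H H' → (∀ e → H e ≡ H' e) → μ G H ≡ μ G H'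
μ-cong G H H' h = ℕ.≤-antisym (μ-mono G H H' (λ e p → trans (sym (h e)) p)) (μ-mono G H' H (λ e p → trans (h e) p))

real : ∀ {m} → Vec State m → EdgeSet m
real ω e = is-just (lookup ω e)

sumℚ-map-cong : ∀ {A : Set} {f g : A → ℚ} (xs : List A) → (∀ x → f x ≡ g x) → sumℚ (List.map f xs) ≡ sumℚ (List.map g xs)
sumℚ-map-cong [] h = refl
sumℚ-map-cong (x ∷ xs) h = cong₂ _+_ (h x) (sumℚ-map-cong xs h)

sumℚ-map-* : ∀ {A : Set} c (f : A → ℚ) (xs : List A) → sumℚ (List.map (λ x → c * f x) xs) ≡ c * sumℚ (List.map f xs)
sumℚ-map-* c f [] = sym (*-zeroʳ c)
sumℚ-map-* c f (x ∷ xs) = trans (cong (c * f x +_) (sumℚ-map-* c f xs)) (sym (*-distribˡ-+ c (f x) _))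

sumℚ-two : ∀ {A B : Set} (F : B → ℚ) (g h : A → B) (xs ys : List A) →
  sumℚ (List.map F (List.map g xs ++ List.map h ys)) ≡ sumℚ (List.map (λ x → F (g x)) xs) + sumℚ (List.map (λ x → F (h x)) ys)
sumℚ-two F g h [] [] = refl
sumℚ-two F g h [] (y ∷ ys) = trans (cong (F (h y) +_) (sumℚ-two F g h [] ys)) (l₀ (F (h y)) _)
  where
  l₀ : ∀ a b → a + (0ℚ + b) ≡ 0ℚ + (a + b)
  l₀ = solve-∀ ring
sumℚ-two F g h (x ∷ xs) ys = trans (cong (F (g x) +_) (sumℚ-two F g h xs ys)) (sym (+-assoc (F (g x)) _ _))

coins-step : ∀ {m} (p : Fin (suc m) → ℚ) p≥0 p≤1 l (F : Vec State (suc m) → ℚ) → let ν = coins (λ e → p (suc e)) (λ e → p≥0 (suc e)) (λ e → p≤1 (suc e)) l in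
  E (coins p p≥0 p≤1 l) F ≡ (1ℚ - p zero) * E ν (λ ω → F (nothing ∷ ω)) + p zero * E (uniform l just) (λ a → E ν (λ ω → F (a ∷ ω)))
coins-step p p≥0 p≤1 l F = refl

-- The noise integrates out because `h` sees only which edges are realized.
E-realization : ∀ {m} (p : Fin m → ℚ) p≥0 p≤1 l (h : EdgeSet m → ℚ) → (∀ S S' → (∀ e → S e ≡ S' e) → h S ≡ h S') →
  sumℚ (List.map (λ R → prob p R * h R) (allEdgeSets m)) ≡ E (coins p p≥0 p≤1 l) (λ ω → h (real ω))
E-realization {zero} p p≥0 p≤1 l h ext = trans (+-identityʳ _) (trans (*-identityˡ _) (ext _ _ (λ ())))
E-realization {suc m} p p≥0 p≤1 l h ext = step
      (λ S → refl) (λ S → refl) (λ S S' q → λ { zero → refl ; (suc e) → q e }) (λ S S' q → λ { zero → refl ; (suc e) → q e })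
      (λ ω → λ { zero → refl ; (suc e) → refl }) (λ k ω → λ { zero → refl ; (suc e) → refl })
  where
  ν : Expect (Vec State m)
  ν = coins (λ e → p (suc e)) (λ e → p≥0 (suc e)) (λ e → p≤1 (suc e)) l
  half : ∀ c (g : EdgeSet m → EdgeSet (suc m)) r → (∀ S → prob p (g S) ≡ c * prob (λ e → p (suc e)) S) →
      (∀ S S' → (∀ e → S e ≡ S' e) → ∀ e → g S e ≡ g S' e) →
    E ν (λ ω → h (g (real ω))) ≡ r → sumℚ (List.map (λ S → prob p (g S) * h (g S)) (allEdgeSets m)) ≡ c * r
  half c g r hp hg hr = trans (sumℚ-map-cong (allEdgeSets m)
      (λ S → trans (cong (_* h (g S)) (hp S)) (*-assoc c (prob (λ e → p (suc e)) S) (h (g S)))))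
     (trans (sumℚ-map-* c (λ S → prob (λ e → p (suc e)) S * h (g S)) (allEdgeSets m))
      (cong (c *_) (trans (E-realization (λ e → p (suc e)) (λ e → p≥0 (suc e)) (λ e → p≤1 (suc e)) l (λ S → h (g S))
          (λ S S' q → ext (g S) (g S') (hg S S' q))) hr)))
  -- `g₀` and `g₁` are the two anonymous extension maps inside `allEdgeSets`, found by unification
  -- and described by their pointwise behaviour.
  step : ∀ {g₀ g₁ : EdgeSet m → EdgeSet (suc m)} → (∀ S → prob p (g₀ S) ≡ (1ℚ - p zero) * prob (λ e → p (suc e)) S) →
      (∀ S → prob p (g₁ S) ≡ p zero * prob (λ e → p (suc e)) S) →
    (∀ S S' → (∀ e → S e ≡ S' e) → ∀ e → g₀ S e ≡ g₀ S' e) → (∀ S S' → (∀ e → S e ≡ S' e) → ∀ e → g₁ S e ≡ g₁ S' e) →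
    (∀ ω e → g₀ (real ω) e ≡ real (nothing ∷ ω) e) → (∀ k ω e → g₁ (real ω) e ≡ real (just k ∷ ω) e) →
    sumℚ (List.map (λ R → prob p R * h R) (List.map g₀ (allEdgeSets m) ++ List.map g₁ (allEdgeSets m))) ≡ E (coins p p≥0 p≤1 l)
        (λ ω → h (real ω))
  step {g₀} {g₁} p₀ p₁ e₀ e₁ r₀ r₁ = trans (sumℚ-two (λ R → prob p R * h R) g₀ g₁ (allEdgeSets m) (allEdgeSets m))
     (trans (cong₂ _+_ s₀ s₁) (sym (coins-step p p≥0 p≤1 l (λ ω → h (real ω)))))
    where
    F₀ : ℚ
    F₀ = E ν (λ ω → h (real (nothing ∷ ω)))
    F₁ : State → ℚ
    F₁ a = E ν (λ ω → h (real (a ∷ ω)))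
    q₀ : E ν (λ ω → h (g₀ (real ω))) ≡ F₀
    q₀ = E-cong ν (λ ω → ext (g₀ (real ω)) (real (nothing ∷ ω)) (r₀ ω))
    q₁ : ∀ k → E ν (λ ω → h (g₁ (real ω))) ≡ F₁ (just k)
    q₁ k = E-cong ν (λ ω → ext (g₁ (real ω)) (real (just k ∷ ω)) (r₁ k ω))
    q₂ : E ν (λ ω → h (g₁ (real ω))) ≡ E (uniform l just) F₁
    q₂ = E-uniform-const l just F₁ (E ν (λ ω → h (g₁ (real ω)))) q₁
    s₀ : sumℚ (List.map (λ S → prob p (g₀ S) * h (g₀ S)) (allEdgeSets m)) ≡ (1ℚ - p zero) * F₀
    s₀ = half (1ℚ - p zero) g₀ F₀ p₀ e₀ q₀
    s₁ : sumℚ (List.map (λ S → prob p (g₁ S) * h (g₁ S)) (allEdgeSets m)) ≡ p zero * E (uniform l just) F₁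
    s₁ = half (p zero) g₁ (E (uniform l just) F₁) p₁ e₁ q₂

𝔼-realization : ∀ {n m} (M : Model n m) (f : EdgeSet m → ℕ) → (∀ R R' → (∀ e → R e ≡ R' e) → f R ≡ f R') →
  𝔼 (Model.p M) f ≡ E (Model.Ω M) (λ ω → nat (f (real ω)))
𝔼-realization M f ext = trans (E-realization p p≥0 p≤1 noise (λ R → ℕ→ℚ (f R)) (λ R R' h → cong ℕ→ℚ (ext R R' h)))
    (E-cong Ω (λ ω → sym (nat-/1 (f (real ω)))))
  where open Model M

-- Choice of the constants

0<* : ∀ {a b} → 0ℚ < a → 0ℚ < b → 0ℚ < a * b
0<* {a} {b} p q = positive⁻¹ (a * b) {{pos*pos⇒pos a {{Data.Rational.positive p}} b {{Data.Rational.positive q}}}}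

inv>0 : ∀ {z} → 0ℚ < z → 0ℚ < inv z
inv>0 {z} h = ≰⇒> (λ le → <-irrefl refl (<-≤-trans (positive⁻¹ 1ℚ)
    (≤-trans (≤-reflexive (sym (inv-* h))) (≤-trans (*-monoʳ (<⇒≤ h) le) (≤-reflexive (*-zeroʳ z))))))

recip-small : ∀ r → 0ℚ < r → Σ ℕ λ k → recip k ≤ r
recip-small r h with archimedean (inv r)
... | k , le = k , inv-≤ (nat-suc>0 k) (≤-trans (≤-reflexive (sym (inv-* h)))
    (≤-trans (*-monoʳ (<⇒≤ h) le) (*-monoʳ (<⇒≤ h) (≤-by 0≤1 (l₀ (nat k))))))
  where
  l₀ : ∀ k → 1ℚ + k - k ≡ 1ℚ
  l₀ = solve-∀ ring

recip-suc : ∀ k → recip (suc k) ≤ recip k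
recip-suc k = inv-≤ (nat-suc>0 (suc k)) (≤-by (recip≥0 k) (≡-by (zer (inv-* (nat-suc>0 k))) (l₀ (recip k) (nat (suc k)))))
  where
  l₀ : ∀ r k → r * (1ℚ + k) - 1ℚ - r ≡ k * r - 1ℚ
  l₀ = solve-∀ ring

pigeonhole : ∀ (f : ℕ → ℚ) d → 0ℚ ≤ f 0 → ∀ k → (Σ ℕ λ i → i ℕ.≤ k × f (suc i) - f i ≤ d) ⊎ nat k * d ≤ f k
pigeonhole f d f≥0 zero = inj₂ (≤-trans (≤-reflexive (*-zeroˡ d)) f≥0)
pigeonhole f d f≥0 (suc k) with pigeonhole f d f≥0 k
... | inj₁ (i , le , h) = inj₁ (i , ℕ.m≤n⇒m≤1+n le , h)
... | inj₂ h with f (suc k) - f k ≤? d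
... | yes p = inj₁ (k , ℕ.n≤1+n k , p)
... | no np = inj₂ (≤-by (≤-diff h ⊕ ≤-diff (≰⇒≥ np)) (l₀ (nat k) d (f k) (f (suc k))))
  where
  l₀ : ∀ k d a b → b - (1ℚ + k) * d ≡ a - k * d + (b - a - d)
  l₀ = solve-∀ ring

-- The sum 2 + 6 + 2 + 2 + 16 + 4 + 2 + 18 of the coefficients in `loss`, each of whose terms is
-- made at most `ω` times its coefficient.
52ℚ : ℚ
52ℚ = nat 52

module Params (ε p₀ : ℚ) (ε>0 : 0ℚ < ε) (p₀>0 : 0ℚ < p₀) where

  q : ℚ
  q = inv p₀

  q≥0 : 0ℚ ≤ q
  q≥0 = inv-≥0 p₀>0

  private
    k₀ : Σ ℕ λ k → recip k ≤ ε * inv 52ℚ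
    k₀ = recip-small (ε * inv 52ℚ) (0<* ε>0 (inv>0 (nat-suc>0 51)))

  -- The successor makes `W` at least 2, hence `2ω≤1`. Later `W` serves as s, and `ω` as σ, as the
  -- bound on repeated hits and as the share of discarded mass.
  w : ℕ
  w = suc (proj₁ k₀)

  W ω : ℚ
  W = nat (suc w)
  ω = recip w

  W>0 : 0ℚ < W
  W>0 = nat-suc>0 w

  W≥0 : 0ℚ ≤ W
  W≥0 = <⇒≤ W>0

  ω≥0 : 0ℚ ≤ ω
  ω≥0 = recip≥0 w

  Wω : W * ω ≡ 1ℚ
  Wω = inv-* W>0

  52ω≤ε : 52ℚ * ω ≤ ε
  52ω≤ε = ≤-trans (*-monoʳ {c = 52ℚ} (nat≥0 52) (≤-trans (recip-suc (proj₁ k₀)) (proj₂ k₀)))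
     (≤-reflexive (trans (l₀ 52ℚ ε (inv 52ℚ)) (trans (cong (ε *_) (inv-* {52ℚ} (nat-suc>0 51))) (*-identityʳ ε))))
    where
    l₀ : ∀ a b c → a * (b * c) ≡ b * (a * c)
    l₀ = solve-∀ ring

  2ω≤1 : 2ℚ * ω ≤ 1ℚ
  2ω≤1 = ≤-by (nat≥0 (proj₁ k₀) ⊗ ω≥0) (≡-by ((- 1ℚ) ⊙ zer Wω) (l₀ (nat (proj₁ k₀)) ω))
    where
    l₀ : ∀ k o → 1ℚ - 2ℚ * o - k * o ≡ (- 1ℚ) * ((1ℚ + (1ℚ + k)) * o - 1ℚ)
    l₀ = solve-∀ ring

  ω≤1 : ω ≤ 1ℚ
  ω≤1 = ≤-trans (≤-by ω≥0 (l₀ ω)) 2ω≤1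
    where
    l₀ : ∀ o → 2ℚ * o - o ≡ o
    l₀ = solve-∀ ring

  below : ∀ {t a} → 0ℚ < t → a ≤ inv (t * W) → t * a ≤ ω
  below {t} {a} t>0 h = ≤-trans (*-monoʳ (<⇒≤ t>0) h)
      (≤-reflexive (≡-by ((- (t * inv (t * W))) ⊙ zer Wω ⊞ ω ⊙ zer (inv-* (0<* t>0 W>0))) (l₀ t (inv (t * W)) ω W)))
    where
    l₀ : ∀ t i o w → t * i - o ≡ (- (t * i)) * (w * o - 1ℚ) + o * (t * w * i - 1ℚ)
    l₀ = solve-∀ ring

  module Scale (t : ℚ) (t≥1 : 1ℚ ≤ t) where

    t>0 : 0ℚ < t
    t>0 = <-≤-trans (positive⁻¹ 1ℚ) t≥1

    t≥0 : 0ℚ ≤ t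
    t≥0 = <⇒≤ t>0

    private
      j : Σ ℕ λ k → recip k ≤ inv (t * W)
      j = recip-small (inv (t * W)) (inv>0 (0<* t>0 W>0))

    θ Θ : ℚ
    θ = recip (proj₁ j)
    Θ = nat (suc (proj₁ j))

    θ≥0 : 0ℚ ≤ θ
    θ≥0 = recip≥0 (proj₁ j)

    Θ≥0 : 0ℚ ≤ Θ
    Θ≥0 = nat≥0 (suc (proj₁ j))

    tθ≤ω : t * θ ≤ ω
    tθ≤ω = below t>0 (proj₂ j)

    amgm : ∀ a → a ≤ θ + Θ * (a * a)
    amgm a = ≤-by (½≥0 ⊗ Θ≥0 ⊗ (sq≥0 a ⊕ sq≥0 (a - θ) ⊕ sq≥0 θ)) (≡-by ((a - θ) ⊙ zer Θθ) (l₀ a θ Θ))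
      where
      Θθ : Θ * θ ≡ 1ℚ
      Θθ = inv-* (nat-suc>0 (proj₁ j))
      ½≥0 : 0ℚ ≤ ½
      ½≥0 = nonNegative⁻¹ ½
      l₀ : ∀ a θ Θ → θ + Θ * (a * a) - a - ½ * (Θ * (a * a + ((a - θ) * (a - θ) + θ * θ))) ≡ (a - θ) * (Θ * θ - 1ℚ)
      l₀ = solve-∀ ring

    ssq s⁴q³ big : ℚ
    ssq = W * W * q
    s⁴q³ = W * W * (W * W) * (q * q * q)
    -- Each of the first four summands multiplies `r` in some error term and must be beaten by K;
    -- the last one keeps `big` positive.
    big = t * Θ + (ssq + (t * ssq + (s⁴q³ + 1ℚ)))

    ssq≥0 : 0ℚ ≤ ssq
    ssq≥0 = (W≥0 ⊗ W≥0) ⊗ q≥0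

    s⁴q³≥0 : 0ℚ ≤ s⁴q³
    s⁴q³≥0 = ((W≥0 ⊗ W≥0) ⊗ (W≥0 ⊗ W≥0)) ⊗ ((q≥0 ⊗ q≥0) ⊗ q≥0)

    big>0 : 0ℚ < big
    big>0 = <-≤-trans (positive⁻¹ 1ℚ) (≤-by (t≥0 ⊗ Θ≥0 ⊕ ssq≥0 ⊕ t≥0 ⊗ ssq≥0 ⊕ s⁴q³≥0) (l₀ (t * Θ) ssq (t * ssq) s⁴q³))
      where
      l₀ : ∀ a b c d → a + (b + (c + (d + 1ℚ))) - 1ℚ ≡ a + (b + (c + d))
      l₀ = solve-∀ ring

    private
      kk : Σ ℕ λ k → recip k ≤ ω * inv big
      kk = recip-small (ω * inv big) (0<* (inv>0 W>0) (inv>0 big>0))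

    K' : ℕ
    K' = proj₁ kk

    r : ℚ
    r = recip K'

    r≥0 : 0ℚ ≤ r
    r≥0 = recip≥0 K'

    big-r : big * r ≤ ω
    big-r = ≤-trans (*-monoʳ (<⇒≤ big>0) (proj₂ kk))
        (≤-reflexive (trans (l₀ big ω (inv big)) (trans (cong (ω *_) (inv-* big>0)) (*-identityʳ ω))))
      where
      l₀ : ∀ a b c → a * (b * c) ≡ b * (a * c)
      l₀ = solve-∀ ring

    tΘr≤ω : t * (Θ * r) ≤ ω
    tΘr≤ω = ≤-trans (≤-by (r≥0 ⊗ (ssq≥0 ⊕ (t≥0 ⊗ ssq≥0 ⊕ (s⁴q³≥0 ⊕ 0≤1)))) (l₀ t Θ r ssq s⁴q³)) big-r
      where
      l₀ : ∀ t Θ r a b → (t * Θ + (a + (t * a + (b + 1ℚ)))) * r - t * (Θ * r) ≡ r * (a + (t * a + (b + 1ℚ)))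
      l₀ = solve-∀ ring

    κ̂≤ω : W * W * r * q ≤ ω
    κ̂≤ω = ≤-trans (≤-by (r≥0 ⊗ (t≥0 ⊗ Θ≥0 ⊕ (t≥0 ⊗ ssq≥0 ⊕ (s⁴q³≥0 ⊕ 0≤1)))) (l₀ t Θ r W q s⁴q³)) big-r
      where
      l₀ : ∀ t Θ r w q b → (t * Θ + (w * w * q + (t * (w * w * q) + (b + 1ℚ)))) * r - w * w * r * q ≡ r *
          (t * Θ + (t * (w * w * q) + (b + 1ℚ)))
      l₀ = solve-∀ ring

    tκ̂≤ω : t * (W * W * r * q) ≤ ω
    tκ̂≤ω = ≤-trans (≤-by (r≥0 ⊗ (t≥0 ⊗ Θ≥0 ⊕ (ssq≥0 ⊕ (s⁴q³≥0 ⊕ 0≤1)))) (l₀ t Θ r W q s⁴q³)) big-r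
      where
      l₀ : ∀ t Θ r w q b → (t * Θ + (w * w * q + (t * (w * w * q) + (b + 1ℚ)))) * r - t * (w * w * r * q) ≡ r *
          (t * Θ + (w * w * q + (b + 1ℚ)))
      l₀ = solve-∀ ring

    s⁴q³r≤ω : s⁴q³ * r ≤ ω
    s⁴q³r≤ω = ≤-trans (≤-by (r≥0 ⊗ (t≥0 ⊗ Θ≥0 ⊕ (ssq≥0 ⊕ (t≥0 ⊗ ssq≥0 ⊕ 0≤1)))) (l₀ t Θ r ssq s⁴q³)) big-r
      where
      l₀ : ∀ t Θ r a b → (t * Θ + (a + (t * a + (b + 1ℚ)))) * r - b * r ≡ r * (t * Θ + (a + (t * a + 1ℚ)))
      l₀ = solve-∀ ring

    -- The first summand ensures that an edge below the next threshold has expected multiplicity at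
    -- most `ω` in the samples (`rare`). The summand `t` makes the thresholds increase and lets
    -- `next` dominate the degree `t + nat (suc K')`.
    next : ℚ
    next = nat (suc K') * W + t

    t≤next : t ≤ next
    t≤next = ≤-by (nat≥0 (suc K') ⊗ W≥0) (l₀ (nat (suc K') * W) t)
      where
      l₀ : ∀ a t → a + t - t ≡ a
      l₀ = solve-∀ ring

    t+K≤next : t + nat (suc K') ≤ next
    t+K≤next = ≤-by (nat≥0 (suc K') ⊗ nat≥0 w) (l₀ t (nat (suc K')) (nat w))
      where
      l₀ : ∀ t k w → k * (1ℚ + w) + t - (t + k) ≡ k * w
      l₀ = solve-∀ ring

    rare : ∀ {a} → 0ℚ ≤ a → next * a ≤ 1ℚ → nat (suc K') * a ≤ ω
    rare {a} a≥0 h = ≤-by (ω≥0 ⊗ ≤-diff h ⊕ ω≥0 ⊗ t≥0 ⊗ a≥0) (≡-by ((nat (suc K') * a) ⊙ zer Wω) (l₀ ω (nat (suc K')) W t a))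
      where
      l₀ : ∀ o k w t a → o - k * a - (o * (1ℚ - (k * w + t) * a) + o * (t * a)) ≡ k * a * (w * o - 1ℚ)
      l₀ = solve-∀ ring

    loss≤ : ∀ η → t * η ≤ ω → 0ℚ ≤ η →
      ω + ω + t * (2ℚ * 2ℚ * η + 2ℚ * η + 2ℚ * (θ + Θ * r) + 2ℚ * 2ℚ * (2ℚ * 2ℚ) * (W * W * r * q))
        + 2ℚ * 2ℚ * ω + 2ℚ * (W * W * r * q) + (2ℚ + 2ℚ * 2ℚ * (2ℚ * 2ℚ)) * (W * W * (W * W) * (q * q * q) * r) ≤ 52ℚ * ω
    loss≤ η tη η≥0 = ≤-by (c 6 ⊗ ≤-diff tη ⊕ c 2 ⊗ ≤-diff tθ≤ω ⊕ c 2 ⊗ ≤-diff tΘr≤ω ⊕ c 16 ⊗ ≤-diff tκ̂≤ω ⊕ c 2 ⊗ ≤-diff κ̂≤ω ⊕ c 18 ⊗ ≤-diff s⁴q³r≤ω)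
        (l₀ ω t η θ (Θ * r) (W * W * r * q) (s⁴q³ * r))
      where
      c : ∀ k → 0ℚ ≤ nat k
      c = nat≥0
      l₀ : ∀ o t η θ Q κ z → nat 52 * o - (o + o + t *
          (2ℚ * 2ℚ * η + 2ℚ * η + 2ℚ * (θ + Q) + 2ℚ * 2ℚ * (2ℚ * 2ℚ) * κ) + 2ℚ * 2ℚ * o + 2ℚ * κ + (2ℚ + 2ℚ * 2ℚ * (2ℚ * 2ℚ)) * z)
         ≡ nat 6 * (o - t * η) + (nat 2 * (o - t * θ) +
             (nat 2 * (o - t * Q) + (nat 16 * (o - t * κ) + (nat 2 * (o - κ) + nat 18 * (o - z)))))
      l₀ = solve-∀ ring

  -- The ladder of thresholds, computed from `ε` and `p₀` before any graph is given.
  level : ℕ → Σ ℚ λ t → 1ℚ ≤ t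
  level zero = 1ℚ , ≤-refl
  level (suc i) = Scale.next t h , ≤-trans h (Scale.t≤next t h)
    where
    t = proj₁ (level i)
    h = proj₂ (level i)

  seq : ℕ → ℚ
  seq i = proj₁ (level i)

  seq-suc : ∀ i → seq i ≤ seq (suc i)
  seq-suc i = Scale.t≤next (proj₁ (level i)) (proj₂ (level i))

  seq-mono : ∀ {i k} → i ℕ.≤ k → seq i ≤ seq k
  seq-mono {i} {k} h = go (ℕ.≤⇒≤′ h)
    where
    go : ∀ {k} → i ℕ.≤′ k → seq i ≤ seq k
    go ℕ.≤′-refl = ≤-refl
    go {suc k} (ℕ.≤′-step h) = ≤-trans (go h) (seq-suc k)

  -- The pigeonhole argument uses `suc w` increments, as many as `W` counts; one further level
  -- covers the case in which none of them is small.
  last : ℕ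
  last = suc (suc w)

  degreeBound : Σ ℕ λ D → seq last ≤ nat D
  degreeBound = archimedean (seq last)

  private
    last>0 : 0ℚ < seq last
    last>0 = Scale.t>0 (seq last) (proj₂ (level last))
    -- The noise belongs to the probability space that defines `x`, and the level is chosen from
    -- `x`; so the noise has to suit every level up to `last` in advance.
    noise : Σ ℕ λ l → recip l ≤ inv (seq last * W)
    noise = recip-small (inv (seq last * W)) (inv>0 (0<* last>0 W>0))

  l : ℕ
  l = proj₁ noise

  η≤ : ∀ i → i ℕ.≤ last → seq i * recip l ≤ ω
  η≤ i h = ≤-trans (*-mono (Scale.t≥0 (seq i) (proj₂ (level i))) (recip≥0 l) (seq-mono h) ≤-refl) (below last>0 (proj₂ noise))

-- The sparse subgraph of a given graph

module _ (ε p₀ : ℚ) (ε>0 : 0ℚ < ε) (p₀>0 : 0ℚ < p₀) where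

  private
    module Pm = Params ε p₀ ε>0 p₀>0
    open Pm using (ω; W; w; l; seq; last; level; degreeBound)

  module Construct {n m : ℕ} (G : Graph n m) (p : Fin m → ℚ) (valid : ValidProbs p) (p₀≤p : ∀ e → p₀ ≤ p e) where

    p>0 : ∀ e → 0ℚ < p e
    p>0 e = proj₁ (valid e)

    p≤1 : ∀ e → p e ≤ 1ℚ
    p≤1 e = proj₂ (valid e)

    1≤qp : ∀ e → 1ℚ ≤ Pm.q * p e
    1≤qp e = ≤-trans (≤-reflexive (trans (sym (inv-* p₀>0)) (*-comm p₀ (inv p₀)))) (*-monoʳ Pm.q≥0 (p₀≤p e))

    S : Vec State m → EdgeSet m
    S v = proj₁ (maximum-matching G (real v))

    fits : ∀ v → Fits (ends G) (full n) (S v)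
    fits v = matching⇒fits G (S v) (proj₂ (proj₁ (proj₂ (maximum-matching G (real v)))))

    realized : ∀ v e → S v e ≡ true → is-just (lookup v e) ≡ true
    realized v = proj₁ (proj₁ (proj₂ (maximum-matching G (real v))))

    S-size : ∀ v → ∑ (λ e → ⟦ S v e ⟧) ≡ nat (μ G (real v))
    S-size v = trans (sym (size-∑ (S v))) (cong nat (proj₂ (proj₂ (maximum-matching G (real v)))))

    maximal : ∀ v T → Fits (ends G) (full n) T → (∀ e → T e ≡ true → is-just (lookup v e) ≡ true) → ∑ (λ e → ⟦ T e ⟧) ≤ ∑ (λ e → ⟦ S v e ⟧)
    maximal v T fitsT sub = subst₂ _≤_ (size-∑ T) (sym (S-size v)) (nat-mono (μ-upper G (real v) T sub (fits⇒matching G T fitsT)))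

    model : Model n m
    model = record
      { edges = ends G ; loop-free = loopless G ; distinct = simple-distinct G
      ; p = p ; p>0 = p>0 ; p≤1 = p≤1 ; q = Pm.q ; q≥0 = Pm.q≥0 ; 1≤qp = 1≤qp ; noise = l }

    selection : Selection model
    selection = record { S = S ; fits = fits ; realized = realized ; maximal = maximal }

    open Selection selection using (x; x≥0; opt)

    Ω : Expect (Vec State m)
    Ω = Model.Ω model

    opt≥0 : 0ℚ ≤ opt
    opt≥0 = ∑-≥0 x≥0

    critical : ℕ → Fin m → Bool
    critical i e = isYes (1ℚ ≤? seq i * x e)

    critical-yes : ∀ i e → critical i e ≡ true → 1ℚ ≤ seq i * x e
    critical-yes i e h = isYes-true (1ℚ ≤? seq i * x e) h

    critical-no : ∀ i e → critical i e ≡ false → seq i * x e ≤ 1ℚ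
    critical-no i e h = ≰⇒≥ (isYes-false (1ℚ ≤? seq i * x e) h)

    critical-suc : ∀ i e → critical i e ≡ true → critical (suc i) e ≡ true
    critical-suc i e h = isYes-intro (1ℚ ≤? seq (suc i) * x e)
      (≤-trans (critical-yes i e h) (*-mono (Pm.Scale.t≥0 (seq i) (proj₂ (level i))) (x≥0 e) (Pm.seq-suc i) ≤-refl))

    negligible : ℕ → Fin m → Bool
    negligible i e = not (critical (suc i) e)

    disjoint : ∀ i e → critical i e ≡ true → negligible i e ≡ false
    disjoint i e h = cong not (critical-suc i e h)

    mass : ℕ → ℚ
    mass i = ∑ (λ e → ⟦ critical i e ⟧ * x e)

    mass≤ : ∀ i → mass i ≤ opt
    mass≤ i = ∑-mono (λ e → ≤-trans (*-mono (⟦⟧≥0 (critical i e)) (x≥0 e) (⟦⟧≤1 (critical i e)) ≤-refl) (≤-reflexive (*-identityˡ (x e))))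

    mass≥0 : ∀ i → 0ℚ ≤ mass i
    mass≥0 i = ∑-≥0 (λ e → ⟦⟧≥0 (critical i e) ⊗ x≥0 e)

    -- The masses stay between 0 and `opt`, so some increment is at most `opt / W`; the edges
    -- between these two thresholds are given up.
    gap : Σ ℕ λ i → suc i ℕ.≤ last × mass (suc i) - mass i ≤ ω * opt
    gap = go (pigeonhole mass (ω * opt) (mass≥0 0) (suc w))
      where
      l₀ : ∀ a b o → o - (a - b) ≡ (1ℚ - 1ℚ) * o + ((b - 0ℚ) + (o - a))
      l₀ = solve-∀ ring
      go : (Σ ℕ λ i → i ℕ.≤ suc w × mass (suc i) - mass i ≤ ω * opt) ⊎ nat (suc w) * (ω * opt) ≤ mass (suc w) →
           Σ ℕ λ i → suc i ℕ.≤ last × mass (suc i) - mass i ≤ ω * opt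
      go (inj₁ (i , le , h)) = i , ℕ.s≤s le , h
      -- Here `mass (suc w)` has already reached `opt`, so the next increment cannot be positive.
      go (inj₂ h) = suc w , ℕ.≤-refl , ≤-trans (≤-by (≤-diff (≤-trans (≤-reflexive (sym opt-eq)) h) ⊕ ≤-diff (mass≤ (suc (suc w))))
          (l₁ (mass (suc (suc w))) (mass (suc w)) opt)) (Pm.ω≥0 ⊗ opt≥0)
        where
        opt-eq : nat (suc w) * (ω * opt) ≡ opt
        opt-eq = trans (sym (*-assoc W ω opt)) (trans (cong (_* opt) Pm.Wω) (*-identityˡ opt))
        l₁ : ∀ a b o → 0ℚ - (a - b) ≡ (b - o) + (o - a)
        l₁ = solve-∀ ring

    i : ℕ
    i = proj₁ gap

    t : ℚ
    t = seq i

    module Lv = Pm.Scale t (proj₂ (level i))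

    C N : Fin m → Bool
    C = critical i
    N = negligible i

    rare : ∀ e → N e ≡ true → nat (suc Lv.K') * x e ≤ ω
    rare e h = Lv.rare (x≥0 e) (critical-no (suc i) e (not-true h))
      where
      not-true : ∀ {b} → not b ≡ true → b ≡ false
      not-true {false} h = refl

    plan : Plan m
    plan = record
      { C = C ; N = N ; disj = disjoint i ; K' = Lv.K' ; s = W ; σ = ω ; s≥0 = Pm.W≥0 ; σ≥0 = Pm.ω≥0 ; sσ = Pm.Wω ; 2σ≤1 = Pm.2ω≤1
      ; θ = Lv.θ ; Θ = Lv.Θ ; θ≥0 = Lv.θ≥0 ; Θ≥0 = Lv.Θ≥0 ; amgm = Lv.amgm }

    private
      module Sp = Sparsify model selection plan

    M_N : ℚ
    M_N = ∑ (λ e → ⟦ N e ⟧ * x e)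

    B : ℚ
    B = nat (μ G fullE)

    S≤B : ∀ v → ∑ (λ e → ⟦ S v e ⟧) ≤ B
    S≤B v = ≤-trans (≤-reflexive (S-size v)) (nat-mono (μ-mono G (real v) fullE (λ e h → refl)))

    -- The realized edges of one maximum matching of the whole graph form a matching of expected
    -- size at least `p₀ * B`. This makes the number of sampled edges comparable with the optimum.
    B≤ : B ≤ Pm.q * opt
    B≤ = ≤-trans (≤-reflexive (trans (sym (cong nat (proj₂ (proj₂ (maximum-matching G fullE))))) (size-∑ M₀)))
       (≤-trans (∑-mono (λ e → ≤-trans (≤-reflexive (sym (*-identityʳ ⟦ M₀ e ⟧)))
           (≤-trans (*-monoʳ (⟦⟧≥0 (M₀ e)) (1≤qp e)) (≤-reflexive (l₀ ⟦ M₀ e ⟧ Pm.q (p e))))))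
       (≤-trans (≤-reflexive (∑-* Pm.q (λ e → ⟦ M₀ e ⟧ * p e))) (*-monoʳ Pm.q≥0 below-opt)))
      where
      M₀ : EdgeSet m
      M₀ = proj₁ (maximum-matching G fullE)
      l₀ : ∀ m q p → m * (q * p) ≡ q * (m * p)
      l₀ = solve-∀ ring
      T₀ : Vec State m → EdgeSet m
      T₀ v e = M₀ e ∧ is-just (lookup v e)
      T₀-fits : ∀ v → Fits (ends G) (full n) (T₀ v)
      T₀-fits v x = ≤-trans (∑-mono (λ e → *-monoʳ (ι≥0 x (ends G e)) (⟦⟧-mono (∧-conicalˡ (M₀ e) _))))
          (matching⇒fits G M₀ (proj₂ (proj₁ (proj₂ (maximum-matching G fullE)))) x)
      below-opt : ∑ (λ e → ⟦ M₀ e ⟧ * p e) ≤ opt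
      below-opt = ≤-trans (≤-reflexive (trans (∑-cong (λ e → trans (cong (⟦ M₀ e ⟧ *_) (sym (E-realized model e)))
             (trans (sym (E-* Ω ⟦ M₀ e ⟧ (λ v → ⟦ is-just (lookup v e) ⟧))) (E-cong Ω (λ v → sym (⟦∧⟧ (M₀ e) (is-just (lookup v e))))))))
           (sym (E-∑ Ω (λ e v → ⟦ T₀ v e ⟧)))))
         (≤-trans (E-mono Ω (λ v → maximal v (T₀ v) (T₀-fits v) (λ e h → ∧-conicalʳ (M₀ e) _ h))) (≤-reflexive (E-∑ Ω (λ e v → ⟦ S v e ⟧))))

    enough : opt - ω * opt ≤ mass i + M_N
    enough = ≤-by (≤-diff (proj₂ (proj₂ gap))) (≡-by (zer MN) (l₁ opt ω (mass i) M_N (mass (suc i))))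
      where
      l₀ : ∀ b x → ⟦ not b ⟧ * x ≡ x - ⟦ b ⟧ * x
      l₀ true x = l₂ x
        where
        l₂ : ∀ x → 0ℚ * x ≡ x - 1ℚ * x
        l₂ = solve-∀ ring
      l₀ false x = l₂ x
        where
        l₂ : ∀ x → 1ℚ * x ≡ x - 0ℚ * x
        l₂ = solve-∀ ring
      MN : M_N ≡ opt - mass (suc i)
      MN = trans (∑-cong (λ e → l₀ (critical (suc i) e) (x e))) (∑-− x (λ e → ⟦ critical (suc i) e ⟧ * x e))
      l₁ : ∀ o ω a n b → a + n - (o - ω * o) - (ω * o - (b - a)) ≡ n - (o - b)
      l₁ = solve-∀ ring

    private
      i<last : i ℕ.≤ last
      i<last = ℕ.≤-trans (ℕ.n≤1+n i) (proj₁ (proj₂ gap))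

    samples : Vec (Vec State m) (suc Lv.K')
    samples = proj₁ (Sp.Average.good ω rare)

    loss : ℚ
    loss = Sp.Average.loss ω rare t ω

    large : opt * (1ℚ - loss) ≤ Sp.Sample.ET samples
    large = Sp.Average.ET-large ω rare Pm.ω≥0 t Lv.t≥0 (critical-yes i) B S≤B B≤ (≤-trans Lv.κ̂≤ω Pm.ω≤1) ω enough

    T' : Vec State m → EdgeSet m
    T' = Sp.Sample.T' samples

    Q : EdgeSet m
    Q e = C e ∨ (N e ∧ hit S samples e)

    Q-degree : MaxDegree≤ G Q (proj₁ degreeBound)
    Q-degree v = nat-cancel (≤-trans (≤-reflexive (size-∑ (λ e → Q e ∧ touches v (ends G e))))
      (≤-trans (∑-mono (λ e → ≤-trans (≤-reflexive (trans (⟦∧⟧ (Q e) (touches v (ends G e))) (*-comm ⟦ Q e ⟧ ⟦ touches v (ends G e) ⟧)))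
           (*-mono (⟦⟧≥0 (touches v (ends G e))) (⟦⟧≥0 (Q e)) (touches≤ι v (ends G e)) ≤-refl)))
       (≤-trans (Sp.Average.degree ω rare (critical-yes i) Lv.t≥0 samples v)
           (≤-trans Lv.t+K≤next (≤-trans (Pm.seq-mono {suc i} (proj₁ (proj₂ gap))) (proj₂ degreeBound))))))

    E-μ : ∀ (f : EdgeSet m → ℕ) → (∀ R R' → (∀ e → R e ≡ R' e) → f R ≡ f R') → 𝔼 p f ≡ E Ω (λ v → nat (f (real v)))
    E-μ f ext = 𝔼-realization model f ext

    opt-eq : 𝔼μG G p ≡ opt
    opt-eq = trans (E-μ (λ R → μ G R) (λ R R' → μ-cong G R R')) (trans (E-cong Ω (λ v → sym (S-size v))) (E-∑ Ω (λ e v → ⟦ S v e ⟧)))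

    Q-good : (1ℚ - ε) * 𝔼μG G p ≤ 𝔼 p (λ R → μ G (Q ∩E R))
    Q-good = ≤-trans (≤-reflexive (cong ((1ℚ - ε) *_) opt-eq))
        (≤-trans (≤-by (opt≥0 ⊗ ≤-diff (≤-trans (Lv.loss≤ (recip l) (Pm.η≤ i i<last) (recip≥0 l)) Pm.52ω≤ε)) (l₀ opt ε (loss)))
      (≤-trans large (≤-trans (E-mono Ω size≤) (≤-reflexive
          (sym (E-μ (λ R → μ G (Q ∩E R)) (λ R R' h → μ-cong G (Q ∩E R) (Q ∩E R') (λ e → cong (Q e ∧_) (h e)))))))))
      where
      l₀ : ∀ o ε L → o * (1ℚ - L) - (1ℚ - ε) * o ≡ o * (ε - L)
      l₀ = solve-∀ ring
      both : ∀ {a b} → a ≡ true → b ≡ true → a ∧ b ≡ true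
      both refl refl = refl
      size≤ : ∀ v → ∑ (λ e → ⟦ T' v e ⟧) ≤ nat (μ G (Q ∩E real v))
      size≤ v = subst (_≤ nat (μ G (Q ∩E real v))) (size-∑ (T' v))
        (nat-mono (μ-upper G (Q ∩E real v) (T' v)
            (λ e h → both (proj₁ (Sp.Sample.T'-ok samples v e h)) (proj₂ (Sp.Sample.T'-ok samples v e h)))
            (fits⇒matching G (T' v) (Sp.Sample.T'-fits samples v))))

-- Exhaustive search and conclusion

module _ {A : Set} (f : A → ℚ) {P : A → Set} (P? : ∀ a → Dec (P a)) where

  best : A → List A → A
  best d [] = d
  best d (a ∷ as) with P? a | f (best d as) ≤? f a
  ... | yes _ | yes _ = a
  ... | _ | _ = best d as

  best-P : ∀ d as → P d → P (best d as)
  best-P d [] pd = pd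
  best-P d (a ∷ as) pd with P? a | f (best d as) ≤? f a
  ... | yes pa | yes _ = pa
  ... | yes _ | no _ = best-P d as pd
  ... | no _ | yes _ = best-P d as pd
  ... | no _ | no _ = best-P d as pd

  best-≥ : ∀ d as {a} → a ∈ as → P a → f a ≤ f (best d as)
  best-≥ d (a ∷ as) (here refl) pa with P? a | f (best d as) ≤? f a
  ... | yes _ | yes _ = ≤-refl
  ... | yes _ | no nle = ≰⇒≥ nle
  ... | no np | _ = ⊥-elim (np pa)
  best-≥ d (b ∷ as) (there a∈) pa with P? b | f (best d as) ≤? f b
  ... | yes _ | yes le = ≤-trans (best-≥ d as a∈ pa) le
  ... | yes _ | no _ = best-≥ d as a∈ pa
  ... | no _ | yes _ = best-≥ d as a∈ pa
  ... | no _ | no _ = best-≥ d as a∈ pa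

minimum : ∀ {m} → (Fin m → ℚ) → ℚ
-- A positive default for the edgeless graph, where `IsMin` cannot hold, keeps `minimum>0` free of
-- exceptions.
minimum {zero} p = 1ℚ
minimum {suc m} p = p (proj₁ (argmax (λ e → - p e)))

minimum≤ : ∀ {m} (p : Fin m → ℚ) e → minimum p ≤ p e
minimum≤ {suc m} p e = ≤-by (≤-diff (proj₂ (argmax (λ e → - p e)) e)) (l₀ (p e) (minimum p))
  where
  l₀ : ∀ a b → a - b ≡ - b - (- a)
  l₀ = solve-∀ ring

minimum>0 : ∀ {m} (p : Fin m → ℚ) → (∀ e → 0ℚ < p e) → 0ℚ < minimum p
minimum>0 {zero} p h = positive⁻¹ 1ℚ
minimum>0 {suc m} p h = h (proj₁ (argmax (λ e → - p e)))

minimum-unique : ∀ {m} (p : Fin m → ℚ) p₀ → IsMin p p₀ → minimum p ≡ p₀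
minimum-unique {zero} p p₀ (_ , () , _)
minimum-unique {suc m} p p₀ (le , e , eq) = ≤-antisym (subst (minimum p ≤_) eq (minimum≤ p e)) (le (proj₁ (argmax (λ e → - p e))))

-- The function D of the theorem receives a bare rational, so positivity has to be decided; with the
-- decision as an argument, `sparse-subgraph` can split on the same one.
degree-bound : ∀ ε → 0ℚ < ε → ∀ {p₀} → Dec (0ℚ < p₀) → ℕ
degree-bound ε ε>0 {p₀} (yes p₀>0) = proj₁ (Params.degreeBound ε p₀ ε>0 p₀>0)
degree-bound ε ε>0 (no _) = 0  -- junk value

sparse-subgraph : ∀ ε (ε>0 : 0ℚ < ε) {p₀} (d : Dec (0ℚ < p₀)) → 0ℚ < p₀ → ∀ {n m} (G : Graph n m) (p : Fin m → ℚ) → ValidProbs p →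
    (∀ e → p₀ ≤ p e) →
  Σ (EdgeSet m) λ Q → MaxDegree≤ G Q (degree-bound ε ε>0 d) × (1ℚ - ε) * 𝔼μG G p ≤ 𝔼 p (λ R → μ G (Q ∩E R))
sparse-subgraph ε ε>0 {p₀} (yes p₀>0) _ G p valid le = Con.Q , Con.Q-degree , Con.Q-good
  where module Con = Construct ε p₀ ε>0 p₀>0 G p valid le
sparse-subgraph ε ε>0 (no np) p₀>0 G p valid le = ⊥-elim (np p₀>0)

theorem1p1 : (ε : ℚ) → 0ℚ < ε →
    Σ (ℚ → ℕ) λ D →
    Σ ({n m : ℕ} → Graph n m → (Fin m → ℚ) → Dist m) λ alg →
    {n m : ℕ} (G : Graph n m) (p : Fin m → ℚ) → ValidProbs p →
    IsDistribution (alg G p)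
    × ((p₀ : ℚ) → IsMin p p₀ → ∀ {x} → x ∈ alg G p → MaxDegree≤ G (proj₂ x) (D p₀))
    × ((1ℚ - ε) * 𝔼μG G p ≤ 𝔼μQ G p (alg G p))
theorem1p1 ε ε>0 = D , (λ G p → (1ℚ , choice G p) ∷ []) , λ G p valid →
    ((λ { (here refl) → 0≤1 }) , refl) ,
    (λ { p₀ isMin (here refl) → subst (λ r → MaxDegree≤ G (choice G p) (D r)) (minimum-unique p p₀ isMin) (choice-degree G p) }) ,
    ≤-trans (search G p valid) (≤-reflexive (sym (trans (+-identityʳ _) (*-identityˡ _))))
  where
  D : ℚ → ℕ
  D p₀ = degree-bound ε ε>0 (0ℚ <? p₀)
  value : ∀ {n m} → Graph n m → (Fin m → ℚ) → EdgeSet m → ℚ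
  value G p Q = 𝔼 p (λ R → μ G (Q ∩E R))
  sparse? : ∀ {n m} (G : Graph n m) d (Q : EdgeSet m) → Dec (MaxDegree≤ G Q d)
  sparse? G d Q = all? (λ v → deg G Q v ℕ.≤? d)
  choice : ∀ {n m} → Graph n m → (Fin m → ℚ) → EdgeSet m
  -- The algorithm receives no proof that `p` is valid, so it searches all sufficiently sparse edge
  -- sets, starting from the empty one; for valid `p` the result is at least as good as the
  -- constructed subgraph.
  choice {m = m} G p = best (value G p) (sparse? G (D (minimum p))) (λ _ → false) (allEdgeSets m)
  choice-degree : ∀ {n m} (G : Graph n m) (p : Fin m → ℚ) → MaxDegree≤ G (choice G p) (D (minimum p))
  choice-degree {m = m} G p = best-P (value G p) (sparse? G (D (minimum p))) (λ _ → false) (allEdgeSets m)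
    (λ v → subst (ℕ._≤ D (minimum p)) (sym (size-empty m)) ℕ.z≤n)
  value-cong : ∀ {n m} (G : Graph n m) (p : Fin m → ℚ) Q Q' → (∀ e → Q e ≡ Q' e) → value G p Q ≡ value G p Q'
  value-cong {m = m} G p Q Q' h = sumℚ-map-cong (allEdgeSets m)
      (λ R → cong (λ k → prob p R * ℕ→ℚ k) (μ-cong G (Q ∩E R) (Q' ∩E R) (λ e → cong (_∧ R e) (h e))))
  search : ∀ {n m} (G : Graph n m) (p : Fin m → ℚ) → ValidProbs p → (1ℚ - ε) * 𝔼μG G p ≤ value G p (choice G p)
  search {m = m} G p valid = ≤-trans (proj₂ (proj₂ sub)) (≤-trans (≤-reflexive (value-cong G p Q Q' (λ e → sym (eq e))))
      (best-≥ (value G p) (sparse? G (D (minimum p))) (λ _ → false) (allEdgeSets m) (proj₁ (proj₂ listed))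
        (λ v → subst (ℕ._≤ D (minimum p)) (size-cong (λ e → cong (_∧ touches v (ends G e)) (sym (eq e)))) (proj₁ (proj₂ sub) v))))
    where
    sub : Σ (EdgeSet m) λ Q → MaxDegree≤ G Q (D (minimum p)) × (1ℚ - ε) * 𝔼μG G p ≤ value G p Q
    sub = sparse-subgraph ε ε>0 (0ℚ <? minimum p) (minimum>0 p (λ e → proj₁ (valid e))) G p valid (minimum≤ p)
    Q : EdgeSet m
    Q = proj₁ sub
    listed : Σ (EdgeSet m) λ S' → S' ∈ allEdgeSets m × (∀ e → S' e ≡ Q e)
    listed = allEdgeSets-complete Q
    Q' : EdgeSet m
    Q' = proj₁ listed
    eq : ∀ e → Q' e ≡ Q e
    eq = proj₂ (proj₂ listed)
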